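{- Given a vector addition system $\mathcal V$ of dimension $d$ and $\vec x\in\mathbb N_\omega^d$, one can decide whether $\vec x\in\mathrm{Lim}\,\mathrm{Post}^*(\mathcal V)$.
   Context: A VAS of dimension $d$ is $\mathcal V=\langle A,\delta,\vec x_{in}\rangle$ with $A$ a finite alphabet, $\delta:A\to\mathbb Z^d$, $\vec x_{in}\in\mathbb N^d$. For $\vec x,\vec y\in\mathbb N^d$, $\vec x\xrightarrow{a}\vec y$ iff $\vec y-\vec x=\delta(a)$, extended to words by composition. $\mathrm{Post}^*(\mathcal V)=\{\vec y\in\mathbb N^d\mid\exists u\in A^*,\ \vec x_{in}\xrightarrow{u}\vec y\}$. $\mathbb N_\omega=\mathbb N\cup\{\omega\}$. A sequence in $\mathbb N_\omega$ converges to $\ell$ if it is ultimately constant equal to $\ell$, or its integer-valued subsequence is infinite and tends to infinity and $\ell=\omega$; convergence in $\mathbb N_\omega^d$ is componentwise. For $\vec M\subseteq\mathbb N_\omega^d$, $\mathrm{Lim}\,\vec M$ is the set of limits of sequences of elements of $\vec M$. -}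

module Defs where

open import Data.Nat using (ℕ; _≤_)
open import Data.Integer as ℤ using (ℤ; +_)
open import Data.Fin using (Fin)
open import Data.Vec using (Vec; map; zipWith; lookup)
open import Data.List using (List; []; _∷_)
open import Data.Product using (Σ; ∃; _×_; _,_)
open import Data.Sum using (_⊎_)
open import Relation.Binary.PropositionalEquality using (_≡_)

record VAS (d : ℕ) : Set where
  field
    k    : ℕ
    δ    : Fin k → Vec ℤ d
    x-in : Vec ℕ d
open VAS public

Step : ∀ {d} (V : VAS d) → Vec ℕ d → Fin (k V) → Vec ℕ d → Set
Step V x a y = zipWith ℤ._-_ (map +_ y) (map +_ x) ≡ δ V a

data Run {d} (V : VAS d) : Vec ℕ d → List (Fin (k V)) → Vec ℕ d → Set where
  run-[] : ∀ {x} → Run V x [] x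
  run-∷  : ∀ {x y z a u} → Step V x a y → Run V y u z → Run V x (a ∷ u) z

Post* : ∀ {d} → VAS d → Vec ℕ d → Set
Post* V y = ∃ λ u → Run V (x-in V) u y

data ℕω : Set where
  nat : ℕ → ℕω
  ω   : ℕω

IntSubseqInfinite : (ℕ → ℕω) → Set
IntSubseqInfinite s = ∀ m → ∃ λ n → m ≤ n × ∃ λ v → s n ≡ nat v

IntSubseqTendsToInfinity : (ℕ → ℕω) → Set
IntSubseqTendsToInfinity s = ∀ B → ∃ λ N → ∀ n v → N ≤ n → s n ≡ nat v → B ≤ v

Converges : (ℕ → ℕω) → ℕω → Set
Converges s ℓ =
  (∃ λ N → ∀ n → N ≤ n → s n ≡ ℓ)
  ⊎ (IntSubseqInfinite s × IntSubseqTendsToInfinity s × ℓ ≡ ω)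

ConvergesVec : ∀ {d} → (ℕ → Vec ℕω d) → Vec ℕω d → Set
ConvergesVec {d} s ℓ = ∀ (i : Fin d) → Converges (λ n → lookup (s n) i) (lookup ℓ i)

Lim : ∀ {d} → (Vec ℕω d → Set) → Vec ℕω d → Set
Lim {d} M ℓ = Σ (ℕ → Vec ℕω d) λ s → (∀ n → M (s n)) × ConvergesVec s ℓ

Post*ω : ∀ {d} → VAS d → Vec ℕω d → Set
Post*ω V x = ∃ λ y → Post* V y × x ≡ map nat y

{-# OPTIONS --safe #-}

-- The argument is the Kosaraju-Lambert decomposition, arranged so that it is constructive.  A problem is a sequence of
-- components; a component is a finite graph whose edges change d counters, entry and exit markings with finite and free (ω)
-- entries, and a set of active counters, which must stay nonnegative.  Its runs satisfy a linear system over ℕ, and for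
-- every unknown of such a system one can compute a bound, or else a homogeneous solution in which the unknown is positive.
--
-- * If an ω entry is bounded, instantiate it; if the number of uses of an edge is bounded, unfold the walks along the uses
--   of this edge, which leaves components without it.
-- * If no cycle at the entry raises all the finitely marked active counters, Rackoff's argument bounds one of them along
--   every run, and this counter can be moved into the states.  The same holds backwards from the exit.
-- * Otherwise Euler's theorem turns solutions into walks, and pumping up at the entry and down at the exit makes those
--   walks safe.  The runs obtained are unbounded in every counter in which the final vector is unbounded in the system.
--
-- Each refinement replaces one component by finitely many of smaller rank (active counters, edges, ω entries), so the
-- process ends, and it decides whether the final vector can be arbitrarily large in all the ω coordinates of the target
-- at once; for natural numbers instead of ω this is reachability.
module Submission where

open import Defs hiding (Run)
import Defs as D
import Algebra.Properties.CommutativeMonoid.Sum as Sum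
open import Data.Bool using (Bool; true; false)
import Data.Bool.Properties as BoolP
open import Data.Nat as ℕ using (ℕ; zero; suc; z≤n; s≤s)
import Data.Nat.Induction as ℕI
import Data.Nat.Properties as ℕP
open import Data.Nat.Tactic.RingSolver using () renaming (solve-∀ to ℕ-solve-∀)
open import Data.Integer as ℤ using (ℤ; +_; -[1+_]; ∣_∣)
import Data.Integer.Properties as ℤP
open import Data.Integer.Tactic.RingSolver using (solve-∀)
open import Data.Fin using (Fin; zero; suc; _≟_; punchIn; punchOut; toℕ; fromℕ<; combine; join; splitAt)
import Data.Fin.Properties as FinP
open import Data.List using (List; []; _∷_; _++_; map; length; reverse; _∷ʳ_; [_]; concatMap; upTo; filter; lookup; allFin; tabulate; cartesianProduct)
import Data.List.Properties as ListP
open import Data.List.Membership.Propositional using (_∈_)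
open import Data.List.Membership.Propositional.Properties using (∈-map⁺; ∈-concatMap⁺; ∈-filter⁺; ∈-filter⁻; ∈-upTo⁺; ∈-lookup; ∈-allFin; ∈-cartesianProduct⁺; ∈-cartesianProduct⁻)
open import Data.List.Relation.Unary.All as All using (All; []; _∷_)
import Data.List.Relation.Unary.All.Properties as AllP
open import Data.List.Relation.Unary.Any as Any using (Any; here; there)
import Data.List.Relation.Unary.Any.Properties as AnyP
open import Data.Vec as Vec using (Vec)
import Data.Vec.Functional as VF
import Data.Vec.Properties as VecP
open import Data.Product using (Σ; ∃; _×_; _,_; proj₁; proj₂)
open import Data.Product.Relation.Binary.Lex.Strict using (×-Lex; ×-wellFounded)
open import Data.Sum as ⊎ using (_⊎_; inj₁; inj₂) renaming ([_,_] to case⊎)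
import Data.Sum.Properties as SumP
open import Data.Unit using (⊤; tt)
open import Data.Empty using (⊥; ⊥-elim)
open import Function using (_∘_; _on_)
open import Induction.WellFounded using (WellFounded; Acc; acc)
import Relation.Binary.Construct.On as On
open import Relation.Nullary using (Dec; yes; no; ¬_)
open import Relation.Nullary.Decidable using (_×-dec_; _⊎-dec_; map′)
open import Relation.Binary.PropositionalEquality hiding ([_])

import Algebra.Properties.CommutativeMonoid.Sum as Sum

-- A vector is a limit of reachable ones exactly when, for every bound, some reachable vector agrees
-- with it at its finite coordinates and exceeds the bound at all `ω` coordinates. Both answers are
-- given positive form: solutions beyond every bound, or one bound that every solution respects in
-- some required coordinate. Such alternatives can be merged over finitely many parts without any
-- undecidable case distinction. The obstacle is that a solution of the linear system is not a run:
-- its edges may be disconnected, and counters may dip below 0 on the way. A homogeneous solution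
-- `h` that uses every edge makes each component strongly connected, which removes the first defect.
-- Against the second, the solution z + r s h has two multipliers: `s` makes room inside s h for the
-- pumping cycles at both ends, and then `r` lifts the counters above the dips of everything in
-- between, which depends on `s`. Exits are glued to entries, so all components share `s` and `r`;
-- this is why thresholds for both are carried along instead of single values.

module ∑ℕ = Sum ℕP.+-0-commutativeMonoid
module ∑ℤ = Sum ℤP.+-0-commutativeMonoid

-- Vectors over ℕ and their integer weights

infixl 6 _⊕_
_⊕_ : {V : Set} → (V → ℕ) → (V → ℕ) → V → ℕ
(f ⊕ g) v = f v ℕ.+ g v

infixl 7 _⊙_
_⊙_ : {V : Set} → ℕ → (V → ℕ) → V → ℕ
(n ⊙ f) v = n ℕ.* f v

𝟘 : {V : Set} → V → ℕ
𝟘 _ = 0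

[_]? : {P : Set} → Dec P → ℕ
[ yes _ ]? = 1
[ no _ ]? = 0

[]?-yes : {P : Set} (d : Dec P) → P → [ d ]? ≡ 1
[]?-yes (yes _) p = refl
[]?-yes (no ¬p) p = ⊥-elim (¬p p)

[]?-no : {P : Set} (d : Dec P) → ¬ P → [ d ]? ≡ 0
[]?-no (yes p) ¬p = ⊥-elim (¬p p)
[]?-no (no _) ¬p = refl

[]?≤1 : {P : Set} (d : Dec P) → [ d ]? ℕ.≤ 1
[]?≤1 (yes _) = ℕP.≤-refl
[]?≤1 (no _) = z≤n

δ⟨_⟩ : ∀ {n} → Fin n → Fin n → ℕ
δ⟨ i ⟩ j = [ i ≟ j ]?

δ-suc : ∀ {n} (i j : Fin n) → δ⟨ suc i ⟩ (suc j) ≡ δ⟨ i ⟩ j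
δ-suc i j with i ≟ j
... | yes _ = refl
... | no _ = refl

δ-same : ∀ {n} (i : Fin n) → δ⟨ i ⟩ i ≡ 1
δ-same i = []?-yes (i ≟ i) refl

δ-other : ∀ {n} {i j : Fin n} → i ≢ j → δ⟨ i ⟩ j ≡ 0
δ-other {i = i} {j} = []?-no (i ≟ j)

dot : ∀ {n} → (Fin n → ℕ) → (Fin n → ℤ) → ℤ
dot φ f = ∑ℤ.sum (λ e → + φ e ℤ.* f e)

dot-congˡ : ∀ {n} {φ ψ : Fin n → ℕ} (f : Fin n → ℤ) → φ ≗ ψ → dot φ f ≡ dot ψ f
dot-congˡ f eq = ∑ℤ.sum-cong-≗ (λ e → cong (λ k → + k ℤ.* f e) (eq e))

dot-𝟘 : ∀ {n} (f : Fin n → ℤ) → dot 𝟘 f ≡ + 0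
dot-𝟘 {n} f = trans (∑ℤ.sum-cong-≗ (λ e → ℤP.*-zeroˡ (f e))) (∑ℤ.sum-replicate-zero n)

dot-⊕ : ∀ {n} (φ ψ : Fin n → ℕ) (f : Fin n → ℤ) → dot (φ ⊕ ψ) f ≡ dot φ f ℤ.+ dot ψ f
dot-⊕ φ ψ f = trans
  (∑ℤ.sum-cong-≗ (λ e → trans (cong (ℤ._* f e) (ℤP.pos-+ (φ e) (ψ e)))
                               (ℤP.*-distribʳ-+ (f e) (+ φ e) (+ ψ e))))
  (∑ℤ.∑-distrib-+ (λ e → + φ e ℤ.* f e) (λ e → + ψ e ℤ.* f e))

suc* : ∀ r x → + suc r ℤ.* x ≡ x ℤ.+ + r ℤ.* x
suc* r x = trans (cong (ℤ._* x) (ℤP.pos-+ 1 r)) (lem (+ r) x)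
  where lem : ∀ r x → (+ 1 ℤ.+ r) ℤ.* x ≡ x ℤ.+ r ℤ.* x
        lem = solve-∀

dot-⊙ : ∀ {n} k (φ : Fin n → ℕ) (f : Fin n → ℤ) → dot (k ⊙ φ) f ≡ + k ℤ.* dot φ f
dot-⊙ zero φ f = trans (dot-𝟘 f) (sym (ℤP.*-zeroˡ (dot φ f)))
dot-⊙ (suc k) φ f = trans (dot-⊕ φ (k ⊙ φ) f)
  (trans (cong (λ x → dot φ f ℤ.+ x) (dot-⊙ k φ f)) (sym (suc* k (dot φ f))))

∑ℤ-zero : ∀ {n} (f : Fin n → ℤ) → (∀ i → f i ≡ + 0) → ∑ℤ.sum f ≡ + 0
∑ℤ-zero {n} f z = trans (∑ℤ.sum-cong-≗ z) (∑ℤ.sum-replicate-zero n)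

dot-δ : ∀ {n} (e : Fin n) (f : Fin n → ℤ) → dot δ⟨ e ⟩ f ≡ f e
dot-δ {suc n} zero f = trans
  (cong₂ ℤ._+_ (ℤP.*-identityˡ (f zero)) (∑ℤ-zero _ (λ i → ℤP.*-zeroˡ (f (suc i)))))
  (ℤP.+-identityʳ (f zero))
dot-δ {suc n} (suc e) f = trans
  (cong₂ ℤ._+_ (ℤP.*-zeroˡ (f zero))
     (trans (dot-congˡ (f ∘ suc) (δ-suc e)) (dot-δ e (f ∘ suc))))
  (ℤP.+-identityˡ _)

term≤∑ : ∀ {n} (f : Fin n → ℕ) i → f i ℕ.≤ ∑ℕ.sum f
term≤∑ f zero = ℕP.m≤m+n (f zero) _
term≤∑ f (suc i) = ℕP.≤-trans (term≤∑ (f ∘ suc) i) (ℕP.m≤n+m _ (f zero))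

∑-mono-≤ : ∀ {n} {f g : Fin n → ℕ} → (∀ i → f i ℕ.≤ g i) → ∑ℕ.sum f ℕ.≤ ∑ℕ.sum g
∑-mono-≤ {zero} h = z≤n
∑-mono-≤ {suc n} h = ℕP.+-mono-≤ (h zero) (∑-mono-≤ (h ∘ suc))

∑-mono-< : ∀ {n} {f g : Fin n → ℕ} → (∀ i → f i ℕ.≤ g i) → (i : Fin n) → f i ℕ.< g i → ∑ℕ.sum f ℕ.< ∑ℕ.sum g
∑-mono-< h zero lt = ℕP.+-mono-<-≤ lt (∑-mono-≤ (h ∘ suc))
∑-mono-< h (suc i) lt = ℕP.+-mono-≤-< (h zero) (∑-mono-< (h ∘ suc) i lt)

ℤ-cancelˡ : ∀ x {y z} → x ℤ.+ y ≡ x ℤ.+ z → y ≡ z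
ℤ-cancelˡ x {y} {z} eq = trans (lem x y) (trans (cong (ℤ._- x) eq) (sym (lem x z)))
  where lem : ∀ x y → y ≡ (x ℤ.+ y) ℤ.- x
        lem = solve-∀

-- Linear systems over ℕ

comb : ∀ {V : Set} {k} → (Fin k → ℕ) → (Fin k → V → ℕ) → V → ℕ
comb c P v = ∑ℕ.sum (λ k → c k ℕ.* P k v)

comb-⊕ : ∀ {V : Set} {k} (c c′ : Fin k → ℕ) (P : Fin k → V → ℕ) → comb (c ⊕ c′) P ≗ comb c P ⊕ comb c′ P
comb-⊕ c c′ P v = trans (∑ℕ.sum-cong-≗ (λ k → ℕP.*-distribʳ-+ (P k v) (c k) (c′ k)))
                        (∑ℕ.∑-distrib-+ (λ k → c k ℕ.* P k v) (λ k → c′ k ℕ.* P k v))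

comb-𝟘 : ∀ {V : Set} {k} (P : Fin k → V → ℕ) → comb 𝟘 P ≗ 𝟘
comb-𝟘 {k = k} P v = ∑ℕ.sum-replicate-zero k

comb-δ : ∀ {V : Set} {k} (i : Fin k) (P : Fin k → V → ℕ) → comb δ⟨ i ⟩ P ≗ P i
comb-δ {k = suc k} zero P v = trans
  (cong₂ ℕ._+_ (ℕP.+-identityʳ (P zero v)) (∑ℕ.sum-replicate-zero k))
  (ℕP.+-identityʳ (P zero v))
comb-δ {k = suc k} (suc i) P v = trans
  (∑ℕ.sum-cong-≗ (λ j → cong (ℕ._* P (suc j) v) (δ-suc i j)))
  (comb-δ i (P ∘ suc) v)

box : ℕ → ∀ k → List (Fin k → ℕ)
box K zero = (λ ()) ∷ []
box K (suc k) = concatMap (λ a → map (a VF.∷_) (box K k)) (upTo (suc K))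

box-complete : ∀ K {k} (y : Fin k → ℕ) → (∀ i → y i ℕ.≤ K) → ∃ λ y′ → y′ ∈ box K k × y ≗ y′
box-complete K {zero} y le = (λ ()) , here refl , λ ()
box-complete K {suc k} y le with box-complete K (y ∘ suc) (le ∘ suc)
... | y′ , y′∈ , eq =
  (y zero VF.∷ y′) ,
  ∈-concatMap⁺ (λ a → map (a VF.∷_) (box K k))
    (Any.map (λ { refl → ∈-map⁺ (y zero VF.∷_) y′∈ }) (∈-upTo⁺ (s≤s (le zero)))) ,
  λ { zero → refl ; (suc i) → eq i }

posPart negPart : ℤ → ℕ
posPart (+ n) = n
posPart -[1+ n ] = 0
negPart (+ n) = 0
negPart -[1+ n ] = suc n

posPart-negPart : ∀ z → z ℤ.+ + negPart z ≡ + posPart z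
posPart-negPart (+ n) = ℤP.+-identityʳ (+ n)
posPart-negPart -[1+ n ] = ℤP.+-inverseˡ (+ suc n)

posPart≤∣∣ : ∀ z → posPart z ℕ.≤ ∣ z ∣
posPart≤∣∣ (+ n) = ℕP.≤-refl
posPart≤∣∣ -[1+ n ] = z≤n

negPart≤∣∣ : ∀ z → negPart z ℕ.≤ ∣ z ∣
negPart≤∣∣ (+ n) = z≤n
negPart≤∣∣ -[1+ n ] = ℕP.≤-refl

sum-parts : ∀ {k} (y : Fin k → ℕ) (w : Fin k → ℤ) →
  dot y w ℤ.+ + ∑ℕ.sum (λ i → y i ℕ.* negPart (w i)) ≡ + ∑ℕ.sum (λ i → y i ℕ.* posPart (w i))
sum-parts {zero} y w = refl
sum-parts {suc k} y w = begin
  (a ℤ.* b ℤ.+ r) ℤ.+ + (y zero ℕ.* n ℕ.+ s)     ≡⟨ cong (λ t → a ℤ.* b ℤ.+ r ℤ.+ t) (trans (ℤP.pos-+ (y zero ℕ.* n) s) (cong (ℤ._+ + s) (ℤP.pos-* (y zero) n))) ⟩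
  (a ℤ.* b ℤ.+ r) ℤ.+ (a ℤ.* + n ℤ.+ + s)         ≡⟨ regroup a b r (+ n) (+ s) ⟩
  a ℤ.* (b ℤ.+ + n) ℤ.+ (r ℤ.+ + s)               ≡⟨ cong₂ (λ t u → a ℤ.* t ℤ.+ u) (posPart-negPart b) (sum-parts (y ∘ suc) (w ∘ suc)) ⟩
  a ℤ.* + posPart b ℤ.+ + ∑ℕ.sum (λ i → y (suc i) ℕ.* posPart (w (suc i)))
    ≡⟨ cong (λ t → t ℤ.+ + ∑ℕ.sum (λ i → y (suc i) ℕ.* posPart (w (suc i)))) (sym (ℤP.pos-* (y zero) (posPart b))) ⟩
  + (y zero ℕ.* posPart b) ℤ.+ + ∑ℕ.sum (λ i → y (suc i) ℕ.* posPart (w (suc i)))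
    ≡⟨ sym (ℤP.pos-+ (y zero ℕ.* posPart b) _) ⟩
  + (y zero ℕ.* posPart b ℕ.+ ∑ℕ.sum (λ i → y (suc i) ℕ.* posPart (w (suc i)))) ∎
  where
  open ≡-Reasoning
  a = + y zero
  b = w zero
  r = dot (y ∘ suc) (w ∘ suc)
  n = negPart (w zero)
  s = ∑ℕ.sum (λ i → y (suc i) ℕ.* negPart (w (suc i)))
  regroup : ∀ a b r n s → (a ℤ.* b ℤ.+ r) ℤ.+ (a ℤ.* n ℤ.+ s) ≡ a ℤ.* (b ℤ.+ n) ℤ.+ (r ℤ.+ s)
  regroup = solve-∀

+-monus : ∀ {V : Set} {h y : V → ℕ} → (∀ v → h v ℕ.≤ y v) → y ≗ h ⊕ (λ v → y v ℕ.∸ h v)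
+-monus le v = sym (ℕP.m+[n∸m]≡n (le v))

-- One equation  Σ yᵢ wᵢ = e  over ℕ.  As long as y dominates a nonzero vector of a suitable box with
-- weight 0, subtract it; a y that dominates none is bounded.
module SingleEquation {k} (w : Fin k → ℤ) (e : ℤ) where

  -- `K` bounds the entries of the null vectors that are needed: unit vectors and `exchange`
  -- vectors, with entries up to `S` + `S`; the successor keeps 1 in the box when `S` is 0. `K′`
  -- bounds a solution that dominates none of them: on one sign its entries are at most `S`, so that
  -- side weighs at most `S` times `S`, and the equation lets the other side weigh at most `∣ e ∣`
  -- more.
  S K : ℕ
  S = ∑ℕ.sum (λ i → ∣ w i ∣)
  K = suc (S ℕ.+ S)
  K′ = S ℕ.+ (S ℕ.* S ℕ.+ ∣ e ∣)

  NonZero Null : (Fin k → ℕ) → Set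
  NonZero h = ∃ λ i → 1 ℕ.≤ h i
  Null h = NonZero h × dot h w ≡ + 0

  null? : ∀ h → Dec (Null h)
  null? h = FinP.any? (λ i → 1 ℕP.≤? h i) ×-dec (dot h w ℤP.≟ + 0)

  solves? : ∀ h → Dec (dot h w ≡ e)
  solves? h = dot h w ℤP.≟ e

  nulls bases : List (Fin k → ℕ)
  nulls = filter null? (box K k)
  bases = filter solves? (box K′ k)

  null-complete : ∀ h → (∀ i → h i ℕ.≤ K) → Null h → ∃ λ h′ → h′ ∈ nulls × h ≗ h′
  null-complete h le ((i , hi) , z) with box-complete K h le
  ... | h′ , h′∈ , eq = h′ , ∈-filter⁺ null? h′∈ ((i , subst (1 ℕ.≤_) (eq i) hi) , trans (sym (dot-congˡ w eq)) z) , eq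

  ∣w∣≤S : ∀ i → ∣ w i ∣ ℕ.≤ S
  ∣w∣≤S = term≤∑ (λ i → ∣ w i ∣)

  1≤K : 1 ℕ.≤ K
  1≤K = s≤s z≤n

  -- If `w i` and `w j` have opposite signs, the two multiples cancel, which makes this a null
  -- vector.
  exchange : Fin k → Fin k → Fin k → ℕ
  exchange i j = ∣ w j ∣ ⊙ δ⟨ i ⟩ ⊕ ∣ w i ∣ ⊙ δ⟨ j ⟩

  module Irreducible (y : Fin k → ℕ) (irr : ¬ Any (λ h → ∀ i → h i ℕ.≤ y i) nulls) where

    dominates-no-null : ∀ h → (∀ i → h i ℕ.≤ K) → Null h → ¬ (∀ i → h i ℕ.≤ y i)
    dominates-no-null h le nu h≤y with null-complete h le nu
    ... | h′ , h′∈ , eq = irr (Any.map (λ { refl i → subst (ℕ._≤ y i) (eq i) (h≤y i) }) h′∈)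

    weight-zero : ∀ i → w i ≡ + 0 → y i ≡ 0
    weight-zero i wi with y i in eq
    ... | zero = refl
    ... | suc m = ⊥-elim (dominates-no-null δ⟨ i ⟩ (λ j → ℕP.≤-trans ([]?≤1 (i ≟ j)) 1≤K)
        ((i , ℕP.≤-reflexive (sym (δ-same i))) , trans (dot-δ i w) wi) le)
      where le : ∀ j → δ⟨ i ⟩ j ℕ.≤ y j
            le j with i ≟ j
            ... | yes refl = subst (1 ℕ.≤_) (sym eq) (s≤s z≤n)
            ... | no _ = z≤n

    dot-exchange : ∀ i j → dot (exchange i j) w ≡ + ∣ w j ∣ ℤ.* w i ℤ.+ + ∣ w i ∣ ℤ.* w j
    dot-exchange i j = trans (dot-⊕ (∣ w j ∣ ⊙ δ⟨ i ⟩) (∣ w i ∣ ⊙ δ⟨ j ⟩) w)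
      (cong₂ ℤ._+_ (trans (dot-⊙ ∣ w j ∣ δ⟨ i ⟩ w) (cong (λ t → + ∣ w j ∣ ℤ.* t) (dot-δ i w)))
                   (trans (dot-⊙ ∣ w i ∣ δ⟨ j ⟩ w) (cong (λ t → + ∣ w i ∣ ℤ.* t) (dot-δ j w))))

    -- Otherwise `y` dominates `exchange i j`, whose entries are absolute weights and hence at most
    -- `S`.
    not-both-large : ∀ i j {a b} → w i ≡ + suc a → w j ≡ -[1+ b ] → S ℕ.≤ y i → S ℕ.≤ y j → ⊥
    not-both-large i j {a} {b} wi wj yi yj = dominates-no-null (exchange i j) small
        ((i , subst (1 ℕ.≤_) (sym exchange-i) (s≤s z≤n)) , balanced) le
      where
      i≢j : i ≢ j
      i≢j refl with trans (sym wi) wj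
      ... | ()
      times : ∀ n {P : Set} (d : Dec P) → n ℕ.* [ d ]? ℕ.≤ n
      times n (yes _) = ℕP.≤-reflexive (ℕP.*-identityʳ n)
      times n (no _) = subst (ℕ._≤ n) (sym (ℕP.*-zeroʳ n)) z≤n
      small : ∀ v → exchange i j v ℕ.≤ K
      small v = ℕP.m≤n⇒m≤1+n (ℕP.+-mono-≤ (ℕP.≤-trans (times ∣ w j ∣ (i ≟ v)) (∣w∣≤S j))
                                              (ℕP.≤-trans (times ∣ w i ∣ (j ≟ v)) (∣w∣≤S i)))
      exchange-i : exchange i j i ≡ suc b
      exchange-i = trans (cong₂ ℕ._+_ (cong (∣ w j ∣ ℕ.*_) (δ-same i)) (cong (∣ w i ∣ ℕ.*_) (δ-other (i≢j ∘ sym))))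
        (trans (cong₂ ℕ._+_ (ℕP.*-identityʳ ∣ w j ∣) (ℕP.*-zeroʳ ∣ w i ∣)) (trans (ℕP.+-identityʳ _) (cong ∣_∣ wj)))
      balanced : dot (exchange i j) w ≡ + 0
      balanced = trans (dot-exchange i j) (trans (cong₂ (λ p q → + ∣ q ∣ ℤ.* p ℤ.+ + ∣ p ∣ ℤ.* q) wi wj)
                   (cancel (+ suc a) (+ suc b)))
        where cancel : ∀ s t → t ℤ.* s ℤ.+ s ℤ.* (ℤ.- t) ≡ + 0
              cancel = solve-∀
      le : ∀ v → exchange i j v ℕ.≤ y v
      le v with i ≟ v | j ≟ v
      ... | yes refl | yes refl = ⊥-elim (i≢j refl)
      ... | yes refl | no _ rewrite ℕP.*-identityʳ ∣ w j ∣ | ℕP.*-zeroʳ ∣ w i ∣ | ℕP.+-identityʳ ∣ w j ∣ = ℕP.≤-trans (∣w∣≤S j) yi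
      ... | no _ | yes refl rewrite ℕP.*-identityʳ ∣ w i ∣ | ℕP.*-zeroʳ ∣ w j ∣ = ℕP.≤-trans (∣w∣≤S i) yj
      ... | no _ | no _ rewrite ℕP.*-zeroʳ ∣ w i ∣ | ℕP.*-zeroʳ ∣ w j ∣ = z≤n

    -- `a` and `b` stand for the two sign parts of `w`. Entries of `y` are at most `S` where `a` is
    -- positive, so the side of `a` weighs at most `S` times `S`; the balance carries this over to
    -- the side of `b`, where a single entry is at most the whole weight.
    propagate : (a b : Fin k → ℕ) → (∀ i → a i ℕ.≤ ∣ w i ∣) → (∀ i → y i ℕ.* a i ℕ.≤ S ℕ.* a i) →
      ∑ℕ.sum (λ i → y i ℕ.* b i) ℕ.≤ ∑ℕ.sum (λ i → y i ℕ.* a i) ℕ.+ ∣ e ∣ →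
      ∀ j → 1 ℕ.≤ b j → y j ℕ.≤ K′
    propagate a b a≤ ya le j 1≤b = begin
      y j                                    ≡⟨ sym (ℕP.*-identityʳ (y j)) ⟩
      y j ℕ.* 1                              ≤⟨ ℕP.*-monoʳ-≤ (y j) 1≤b ⟩
      y j ℕ.* b j                            ≤⟨ term≤∑ (λ i → y i ℕ.* b i) j ⟩
      ∑ℕ.sum (λ i → y i ℕ.* b i)             ≤⟨ le ⟩
      ∑ℕ.sum (λ i → y i ℕ.* a i) ℕ.+ ∣ e ∣   ≤⟨ ℕP.+-monoˡ-≤ ∣ e ∣ (ℕP.≤-trans (∑-mono-≤ (λ i → ℕP.≤-trans (ya i) (ℕP.*-monoʳ-≤ S (a≤ i)))) (ℕP.≤-reflexive (sym (distrib S (λ i → ∣ w i ∣))))) ⟩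
      S ℕ.* S ℕ.+ ∣ e ∣                      ≤⟨ ℕP.m≤n+m _ S ⟩
      K′ ∎
      where
      open ℕP.≤-Reasoning
      distrib : ∀ {n} x (f : Fin n → ℕ) → x ℕ.* ∑ℕ.sum f ≡ ∑ℕ.sum (λ i → x ℕ.* f i)
      distrib {zero} x f = ℕP.*-zeroʳ x
      distrib {suc n} x f = trans (ℕP.*-distribˡ-+ x (f zero) _) (cong (x ℕ.* f zero ℕ.+_) (distrib x (f ∘ suc)))

    S≤K′ : S ℕ.≤ K′
    S≤K′ = ℕP.m≤m+n S _

    ΣP ΣN : ℕ
    ΣP = ∑ℕ.sum (λ i → y i ℕ.* posPart (w i))
    ΣN = ∑ℕ.sum (λ i → y i ℕ.* negPart (w i))

    module _ (sol : dot y w ≡ e) where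

      e-balance : e ℤ.+ + ΣN ≡ + ΣP
      e-balance = trans (cong (ℤ._+ + ΣN) (sym sol)) (sum-parts y w)

      N≤P : ΣN ℕ.≤ ΣP ℕ.+ ∣ e ∣
      N≤P = go e e-balance
        where go : ∀ e → e ℤ.+ + ΣN ≡ + ΣP → ΣN ℕ.≤ ΣP ℕ.+ ∣ e ∣
              go (+ n) eq = ℕP.≤-trans (ℕP.≤-trans (ℕP.m≤n+m ΣN n) (ℕP.≤-reflexive (ℤP.+-injective eq))) (ℕP.m≤m+n ΣP n)
              go -[1+ n ] eq = ℕP.≤-reflexive (ℤP.+-injective (trans (shift (-[1+ n ]) (+ ΣN)) (trans (cong (ℤ._- -[1+ n ]) eq) refl)))
                where shift : ∀ a b → b ≡ a ℤ.+ b ℤ.- a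
                      shift = solve-∀

      P≤N : ΣP ℕ.≤ ΣN ℕ.+ ∣ e ∣
      P≤N = go e e-balance
        where go : ∀ e → e ℤ.+ + ΣN ≡ + ΣP → ΣP ℕ.≤ ΣN ℕ.+ ∣ e ∣
              go (+ n) eq = ℕP.≤-reflexive (trans (sym (ℤP.+-injective eq)) (ℕP.+-comm n ΣN))
              go -[1+ n ] eq = ℕP.≤-trans (ℤP.drop‿+≤+ (subst (ℤ._≤ + ΣN) eq shrink)) (ℕP.m≤m+n ΣN _)
                where shrink : -[1+ n ] ℤ.+ + ΣN ℤ.≤ + ΣN
                      shrink = ℤP.≤-trans (ℤP.+-monoˡ-≤ (+ ΣN) (ℤ.-≤+ {n} {0})) (ℤP.≤-reflexive (ℤP.+-identityˡ (+ ΣN)))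

      bounded : ∀ j → y j ℕ.≤ K′
      -- One large entry of positive weight forces all entries of negative weight to be small; if
      -- there is none, the positive side is the small one.
      bounded j with FinP.any? (λ i → (1 ℕP.≤? posPart (w i)) ×-dec (S ℕP.≤? y i))
      ... | yes (i , pi , yi) = goA j
        where
        neg-small : ∀ j b → w j ≡ -[1+ b ] → y j ℕ.≤ S
        neg-small j b wj with S ℕP.≤? y j
        ... | no ¬p = ℕP.<⇒≤ (ℕP.≰⇒> ¬p)
        ... | yes p with w i in wi
        ... | + suc a = ⊥-elim (not-both-large i j wi wj yi p)
        neg-prod : ∀ i → y i ℕ.* negPart (w i) ℕ.≤ S ℕ.* negPart (w i)
        neg-prod i with w i in wi
        ... | + n = ℕP.≤-reflexive (trans (ℕP.*-zeroʳ (y i)) (sym (ℕP.*-zeroʳ S)))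
        ... | -[1+ b ] = ℕP.*-monoˡ-≤ (suc b) (neg-small i b wi)
        goA : ∀ j → y j ℕ.≤ K′
        goA j with w j in wj
        ... | + zero = subst (ℕ._≤ K′) (sym (weight-zero j wj)) z≤n
        ... | + suc a = propagate (λ i → negPart (w i)) (λ i → posPart (w i)) (λ i → negPart≤∣∣ (w i)) neg-prod P≤N j
                          (subst (1 ℕ.≤_) (sym (cong posPart wj)) (s≤s z≤n))
        ... | -[1+ b ] = ℕP.≤-trans (neg-small j b wj) S≤K′
      ... | no none = goB j
        where
        pos-small : ∀ j → 1 ℕ.≤ posPart (w j) → y j ℕ.≤ S
        pos-small j p with S ℕP.≤? y j
        ... | yes q = ⊥-elim (none (j , p , q))
        ... | no ¬q = ℕP.<⇒≤ (ℕP.≰⇒> ¬q)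
        pos-prod : ∀ i → y i ℕ.* posPart (w i) ℕ.≤ S ℕ.* posPart (w i)
        pos-prod i with posPart (w i) in eq
        ... | zero = ℕP.≤-reflexive (trans (ℕP.*-zeroʳ (y i)) (sym (ℕP.*-zeroʳ S)))
        ... | suc a = ℕP.*-monoˡ-≤ (suc a) (pos-small i (subst (1 ℕ.≤_) (sym eq) (s≤s z≤n)))
        goB : ∀ j → y j ℕ.≤ K′
        goB j with w j in wj
        ... | + zero = subst (ℕ._≤ K′) (sym (weight-zero j wj)) z≤n
        ... | + suc a = ℕP.≤-trans (pos-small j (subst (1 ℕ.≤_) (sym (cong posPart wj)) (s≤s z≤n))) S≤K′
        ... | -[1+ b ] = propagate (λ i → posPart (w i)) (λ i → negPart (w i)) (λ i → posPart≤∣∣ (w i)) pos-prod N≤P j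
                          (subst (1 ℕ.≤_) (sym (cong negPart wj)) (s≤s z≤n))

  Covered : (Fin k → ℕ) → Set
  Covered y = ∃ λ b → b ∈ bases × ∃ λ c → y ≗ b ⊕ comb c (lookup nulls)

  -- `N` is fuel above the sum of the entries, which each subtraction of a nonzero vector lowers.
  cover : ∀ N y → ∑ℕ.sum y ℕ.< N → dot y w ≡ e → Covered y
  cover (suc N) y (s≤s lt) sol with Any.any? (λ h → FinP.all? (λ i → h i ℕP.≤? y i)) nulls
  ... | no irr with box-complete K′ y (Irreducible.bounded y irr sol)
  ... | b , b∈ , eq = b , ∈-filter⁺ solves? b∈ (trans (sym (dot-congˡ w eq)) sol) , 𝟘 ,
          λ v → trans (eq v) (trans (sym (ℕP.+-identityʳ (b v))) (cong (b v ℕ.+_) (sym (comb-𝟘 (lookup nulls) v))))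
  cover (suc N) y (s≤s lt) sol | yes any = result (cover N y₁ smaller sol₁)
    where
    j = Any.index any
    h = lookup nulls j
    h≤y : ∀ i → h i ℕ.≤ y i
    h≤y = AnyP.lookup-index any
    h-null : Null h
    h-null = proj₂ (∈-filter⁻ null? {xs = box K k} (∈-lookup j))
    y₁ : Fin k → ℕ
    y₁ i = y i ℕ.∸ h i
    split : y ≗ h ⊕ y₁
    split = +-monus h≤y
    smaller : ∑ℕ.sum y₁ ℕ.< N
    smaller = ℕP.<-≤-trans (∑-mono-< (λ i → ℕP.m∸n≤m (y i) (h i)) (proj₁ (proj₁ h-null))
      (ℕP.∸-monoʳ-< (proj₂ (proj₁ h-null)) (h≤y _))) lt
    sol₁ : dot y₁ w ≡ e
    sol₁ = trans (sym (ℤP.+-identityˡ _)) (trans (cong (ℤ._+ dot y₁ w) (sym (proj₂ h-null)))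
      (trans (sym (dot-⊕ h y₁ w)) (trans (sym (dot-congˡ w split)) sol)))
    result : Covered y₁ → Covered y
    result (b , b∈ , c , eq) = b , b∈ , δ⟨ j ⟩ ⊕ c , λ v → begin
      y v                                             ≡⟨ split v ⟩
      h v ℕ.+ y₁ v                                    ≡⟨ cong (h v ℕ.+_) (eq v) ⟩
      h v ℕ.+ (b v ℕ.+ comb c (lookup nulls) v)        ≡⟨ swap (h v) (b v) (comb c (lookup nulls) v) ⟩
      b v ℕ.+ (h v ℕ.+ comb c (lookup nulls) v)        ≡⟨ cong (λ t → b v ℕ.+ (t ℕ.+ comb c (lookup nulls) v)) (sym (comb-δ j (lookup nulls) v)) ⟩
      b v ℕ.+ (comb δ⟨ j ⟩ (lookup nulls) v ℕ.+ comb c (lookup nulls) v) ≡⟨ cong (b v ℕ.+_) (sym (comb-⊕ δ⟨ j ⟩ c (lookup nulls) v)) ⟩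
      b v ℕ.+ comb (δ⟨ j ⟩ ⊕ c) (lookup nulls) v ∎
      where
      open ≡-Reasoning
      swap : ∀ x y z → x ℕ.+ (y ℕ.+ z) ≡ y ℕ.+ (x ℕ.+ z)
      swap x y z = trans (sym (ℕP.+-assoc x y z)) (trans (cong (ℕ._+ z) (ℕP.+-comm x y)) (ℕP.+-assoc y x z))

-- Systems of equations and their semilinear solution sets

record Functional (V : Set) : Set where
  field
    fn   : (V → ℕ) → ℤ
    ext  : ∀ {z z′} → z ≗ z′ → fn z ≡ fn z′
    zer  : fn 𝟘 ≡ + 0
    add  : ∀ z z′ → fn (z ⊕ z′) ≡ fn z ℤ.+ fn z′

  scale : ∀ n z → fn (n ⊙ z) ≡ + n ℤ.* fn z
  scale zero z = trans zer (sym (ℤP.*-zeroˡ (fn z)))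
  scale (suc n) z = trans (add z (n ⊙ z)) (trans (cong (λ t → fn z ℤ.+ t) (scale n z)) (sym (suc* n (fn z))))

  fn-comb : ∀ {k} (c : Fin k → ℕ) P → fn (comb c P) ≡ dot c (fn ∘ P)
  fn-comb {zero} c P = zer
  fn-comb {suc k} c P = trans (add (c zero ⊙ P zero) (comb (c ∘ suc) (P ∘ suc)))
    (cong₂ ℤ._+_ (scale (c zero) (P zero)) (fn-comb (c ∘ suc) (P ∘ suc)))

open Functional public

System : Set → Set
System V = List (Functional V × ℤ)

Satisfies Homogeneous : ∀ {V} → System V → (V → ℕ) → Set
Satisfies sys z = All (λ (f , c) → fn f z ≡ c) sys
Homogeneous sys z = All (λ (f , c) → fn f z ≡ + 0) sys

-- The linear sets from the theory of semilinear sets: an offset and finitely many periods with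
-- coefficients in ℕ. Solution sets turn out to be finite unions of them.
record Linear (V : Set) : Set where
  field
    base : V → ℕ
    #per : ℕ
    per  : Fin #per → V → ℕ
open Linear

_∈L_ : ∀ {V} → (V → ℕ) → Linear V → Set
z ∈L l = ∃ λ c → z ≗ base l ⊕ comb c (per l)

record LinearSolutions {V : Set} (sys : System V) (l : Linear V) : Set where
  field
    base-sol : Satisfies sys (base l)
    per-sol  : ∀ k → Homogeneous sys (per l k)
open LinearSolutions

comb-comb : ∀ {V : Set} {k l} (c : Fin l → ℕ) (Q : Fin l → Fin k → ℕ) (P : Fin k → V → ℕ) →
  comb (comb c Q) P ≗ comb c (λ i → comb (Q i) P)
comb-comb {l = zero} c Q P v = comb-𝟘 P v
comb-comb {l = suc l} c Q P v = trans (comb-⊕ (c zero ⊙ Q zero) (comb (c ∘ suc) (Q ∘ suc)) P v)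
  (cong₂ ℕ._+_ (scale-comb (c zero) (Q zero)) (comb-comb (c ∘ suc) (Q ∘ suc) P v))
  where
  scale-comb : ∀ n q → comb (n ⊙ q) P v ≡ n ℕ.* comb q P v
  scale-comb zero q = comb-𝟘 P v
  scale-comb (suc n) q = trans (comb-⊕ q (n ⊙ q) P v) (cong (comb q P v ℕ.+_) (scale-comb n q))

comb-cong : ∀ {V : Set} {k} {c c′ : Fin k → ℕ} (P : Fin k → V → ℕ) → c ≗ c′ → comb c P ≗ comb c′ P
comb-cong P eq v = ∑ℕ.sum-cong-≗ (λ i → cong (ℕ._* P i v) (eq i))

all-comb : ∀ {V k} (sys : System V) (c : Fin k → ℕ) P → (∀ i → Homogeneous sys (P i)) → Homogeneous sys (comb c P)
all-comb [] c P h = []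
all-comb ((f , a) ∷ sys) c P h =
  trans (fn-comb f c P) (∑ℤ-zero _ (λ i → trans (cong (λ t → + c i ℤ.* t) (All.head (h i))) (ℤP.*-zeroʳ (+ c i))))
  ∷ all-comb sys c P (λ i → All.tail (h i))

all-shift : ∀ {V} (sys : System V) {b p} → Satisfies sys b → Homogeneous sys p → Satisfies sys (b ⊕ p)
all-shift [] [] [] = []
all-shift ((f , a) ∷ sys) {b} {p} (e ∷ es) (h ∷ hs) =
  trans (add f b p) (trans (cong₂ ℤ._+_ e h) (ℤP.+-identityʳ a)) ∷ all-shift sys es hs

-- On a linear set, an equation for the vector is one equation for its coefficients, weighted by the
-- values at the periods. The bases and null vectors that cover its solutions, carried back, form
-- linear sets again.
module Intersect {V : Set} (l : Linear V) (f : Functional V) (a : ℤ) where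

  open SingleEquation (fn f ∘ per l) (a ℤ.- fn f (base l))

  section : (Fin (#per l) → ℕ) → Linear V
  section b = record { base = base l ⊕ comb b (per l)
                     ; #per = length nulls
                     ; per = λ j → comb (lookup nulls j) (per l) }

  sections : List (Linear V)
  sections = map section bases

  sections-sound : ∀ {sys} → LinearSolutions sys l → All (LinearSolutions ((f , a) ∷ sys)) sections
  sections-sound {sys} ls = AllP.map⁺ (All.tabulate λ {b} b∈ → record
    { base-sol = trans (add f (base l) _) (trans (cong (λ t → fn f (base l) ℤ.+ t) (trans (fn-comb f b (per l))
                   (proj₂ (∈-filter⁻ solves? {xs = box K′ _} b∈)))) (cancel (fn f (base l)) a))
                 ∷ all-shift sys (base-sol ls) (all-comb sys b (per l) (per-sol ls))
    ; per-sol = λ j → trans (fn-comb f (lookup nulls j) (per l)) (proj₂ (proj₂ (∈-filter⁻ null? {xs = box K _} (∈-lookup j))))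
                 ∷ all-comb sys (lookup nulls j) (per l) (per-sol ls) })
    where cancel : ∀ x a → x ℤ.+ (a ℤ.- x) ≡ a
          cancel = solve-∀

  sections-complete : ∀ z → fn f z ≡ a → z ∈L l → Any (z ∈L_) sections
  sections-complete z fz (c , eq) = finish (cover _ c ℕP.≤-refl sol)
    where
    shift : ∀ x y → y ≡ (x ℤ.+ y) ℤ.- x
    shift = solve-∀
    sol : dot c (fn f ∘ per l) ≡ a ℤ.- fn f (base l)
    sol = trans (sym (fn-comb f c (per l))) (trans (shift (fn f (base l)) _)
      (cong (ℤ._- fn f (base l)) (trans (sym (add f (base l) (comb c (per l)))) (trans (sym (ext f eq)) fz))))
    finish : Covered c → Any (z ∈L_) sections
    finish (b , b∈ , c′ , eq′) = AnyP.map⁺ (Any.map (λ { refl → c′ , λ v →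
      trans (eq v) (trans (cong (base l v ℕ.+_) (trans (comb-cong (per l) eq′ v)
        (trans (comb-⊕ b (comb c′ (lookup nulls)) (per l) v) (cong (comb b (per l) v ℕ.+_) (comb-comb c′ (lookup nulls) (per l) v)))))
        (sym (ℕP.+-assoc (base l v) _ _))) }) b∈)

record Finite (V : Set) : Set where
  field
    size   : ℕ
    index  : V → Fin size
    elem   : Fin size → V
    elem-index : ∀ v → elem (index v) ≡ v
open Finite

everything : ∀ {V} → Finite V → Linear V
everything fin = record { base = 𝟘 ; #per = size fin ; per = λ k v → δ⟨ index fin v ⟩ k }

everything-complete : ∀ {V} (fin : Finite V) z → z ∈L everything fin
everything-complete fin z = (λ k → z (elem fin k)) , λ v → sym (trans (pick (λ k → z (elem fin k)) (index fin v)) (cong z (elem-index fin v)))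
  where
  pick : ∀ {n} (y : Fin n → ℕ) i → ∑ℕ.sum (λ k → y k ℕ.* δ⟨ i ⟩ k) ≡ y i
  pick y i = trans (∑ℕ.sum-cong-≗ (λ k → ℕP.*-comm (y k) (δ⟨ i ⟩ k))) (comb-δ i (λ k (_ : ⊤) → y k) tt)

-- The equations are imposed one at a time, starting from the set of all vectors, whose periods are
-- the unit vectors.
pieces : ∀ {V} → Finite V → (sys : System V) →
  ∃ λ ls → All (LinearSolutions sys) ls × (∀ z → Satisfies sys z → Any (z ∈L_) ls)
pieces fin [] = everything fin ∷ [] , record { base-sol = [] ; per-sol = λ _ → [] } ∷ [] ,
  λ z _ → here (everything-complete fin z)
pieces fin ((f , a) ∷ sys) with pieces fin sys
... | ls , sound , complete = concatMap (λ l → Intersect.sections l f a) ls ,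
  AllP.concat⁺ (AllP.map⁺ (All.map (λ {l} → Intersect.sections-sound l f a) sound)) ,
  λ { z (e ∷ es) → AnyP.concat⁺ (AnyP.map⁺ (Any.map (λ {l} → Intersect.sections-complete l f a z e) (complete z es))) }

record Profile {V : Set} (sys : System V) : Set where
  field
    z₀        : V → ℕ
    z₀-sol    : Satisfies sys z₀
    h         : V → ℕ
    h-hom     : Homogeneous sys h
    dichotomy : ∀ v → 1 ℕ.≤ h v ⊎ (h v ≡ 0 × ∃ λ B → ∀ z → Satisfies sys z → z v ℕ.≤ B)

-- `h` is the sum of all periods of all pieces. Where it vanishes every period vanishes, so each
-- solution has there the value of some offset, and the sum of the offsets is a bound.
profile : ∀ {V} → Finite V → (sys : System V) → (∀ z → ¬ Satisfies sys z) ⊎ Profile sys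
profile {V} fin sys with pieces fin sys
... | [] , _ , complete = inj₁ (λ z sat → none (complete z sat))
  where none : ∀ {P : Linear V → Set} → Any P [] → ⊥
        none ()
... | ls@(l ∷ _) , sound@(s ∷ _) , complete = inj₂ record
    { z₀ = base l ; z₀-sol = base-sol s ; h = total ls ; h-hom = total-hom ls sound ; dichotomy = dich }
  where
  total : List (Linear V) → V → ℕ
  total [] = 𝟘
  total (l ∷ ls) = comb (λ _ → 1) (per l) ⊕ total ls
  total-hom : ∀ ls → All (LinearSolutions sys) ls → Homogeneous sys (total ls)
  total-hom [] [] = All.universal (λ (f , _) → zer f) sys
  total-hom (l ∷ ls) (s ∷ ss) = hom-⊕ sys (all-comb sys (λ _ → 1) (per l) (per-sol s)) (total-hom ls ss)
    where hom-⊕ : ∀ sys {p q} → Homogeneous sys p → Homogeneous sys q → Homogeneous sys (p ⊕ q)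
          hom-⊕ [] [] [] = []
          hom-⊕ ((f , _) ∷ sys) {p} {q} (e ∷ es) (e′ ∷ es′) = trans (add f p q) (cong₂ ℤ._+_ e e′) ∷ hom-⊕ sys es es′
  bound : List (Linear V) → V → ℕ
  bound [] = 𝟘
  bound (l ∷ ls) = base l ⊕ bound ls
  constant : ∀ v ls → total ls v ≡ 0 → ∀ z → Any (z ∈L_) ls → z v ℕ.≤ bound ls v
  constant v (l ∷ ls) t z (there a) = ℕP.≤-trans (constant v ls (ℕP.m+n≡0⇒n≡0 _ t) z a) (ℕP.m≤n+m _ (base l v))
  constant v (l ∷ ls) t z (here (c , eq)) = ℕP.≤-trans (ℕP.≤-reflexive (trans (eq v)
      (trans (cong (base l v ℕ.+_) no-per) (ℕP.+-identityʳ _)))) (ℕP.m≤m+n (base l v) _)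
    where
    per-zero : ∀ i → per l i v ≡ 0
    per-zero i = trans (sym (ℕP.*-identityˡ _)) (ℕP.n≤0⇒n≡0 (ℕP.≤-trans (term≤∑ (λ i → 1 ℕ.* per l i v) i) (ℕP.≤-reflexive (ℕP.m+n≡0⇒m≡0 _ t))))
    no-per : comb c (per l) v ≡ 0
    no-per = trans (∑ℕ.sum-cong-≗ (λ i → trans (cong (c i ℕ.*_) (per-zero i)) (ℕP.*-zeroʳ (c i)))) (∑ℕ.sum-replicate-zero (#per l))
  dich : ∀ v → 1 ℕ.≤ total ls v ⊎ (total ls v ≡ 0 × ∃ λ B → ∀ z → Satisfies sys z → z v ℕ.≤ B)
  dich v with total ls v in eq
  ... | suc n = inj₁ (s≤s z≤n)
  ... | zero = inj₂ (refl , bound ls v , λ z sat → constant v ls eq z (complete z sat))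

-- Graphs and walks

record Graph (r n : ℕ) : Set where
  field src tgt : Fin n → Fin r
open Graph public

Path : ∀ {r n} → Graph r n → Fin r → List (Fin n) → Fin r → Set
Path G s [] q = s ≡ q
Path G s (e ∷ u) q = src G e ≡ s × Path G (tgt G e) u q

path? : ∀ {r n} (G : Graph r n) s u q → Dec (Path G s u q)
path? G s [] q = s ≟ q
path? G s (e ∷ u) q = (src G e ≟ s) ×-dec path? G (tgt G e) u q

Path-++ : ∀ {r n} (G : Graph r n) {s} u {t w q} → Path G s u t → Path G t w q → Path G s (u ++ w) q
Path-++ G [] refl pw = pw
Path-++ G (e ∷ u) (eq , pu) pw = eq , Path-++ G u pu pw

Path-split : ∀ {r n} (G : Graph r n) {s} u {w q} → Path G s (u ++ w) q → ∃ λ t → Path G s u t × Path G t w q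
Path-split G [] p = _ , refl , p
Path-split G (e ∷ u) (eq , p) with Path-split G u p
... | t , pu , pw = t , (eq , pu) , pw

iterate : ∀ {A : Set} → ℕ → List A → List A
iterate zero u = []
iterate (suc k) u = u ++ iterate k u

Path-iterate : ∀ {r n} (G : Graph r n) {s} k u → Path G s u s → Path G s (iterate k u) s
Path-iterate G zero u p = refl
Path-iterate G (suc k) u p = Path-++ G u p (Path-iterate G k u p)

rev : ∀ {r n} → Graph r n → Graph r n
rev G = record { src = tgt G ; tgt = src G }

Path-reverse : ∀ {r n} (G : Graph r n) {s} u {q} → Path G s u q → Path (rev G) q (reverse u) s
Path-reverse G [] p = sym p
Path-reverse G {s} (e ∷ u) {q} (eq , p) = subst (λ w → Path (rev G) q w s) (sym (ListP.unfold-reverse e u))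
  (Path-++ (rev G) (reverse u) (Path-reverse G u p) (refl , eq))

total : ∀ {n} → (Fin n → ℤ) → List (Fin n) → ℤ
total f [] = + 0
total f (e ∷ u) = f e ℤ.+ total f u

total-++ : ∀ {n} (f : Fin n → ℤ) u w → total f (u ++ w) ≡ total f u ℤ.+ total f w
total-++ f [] w = sym (ℤP.+-identityˡ _)
total-++ f (e ∷ u) w = trans (cong (λ t → f e ℤ.+ t) (total-++ f u w)) (sym (ℤP.+-assoc (f e) _ _))

total-map : ∀ {n n′} (f : Fin n → ℤ) (o : Fin n′ → Fin n) u → total f (map o u) ≡ total (f ∘ o) u
total-map f o [] = refl
total-map f o (e ∷ u) = cong (λ t → f (o e) ℤ.+ t) (total-map f o u)

total-reverse : ∀ {n} (f : Fin n → ℤ) u → total f (reverse u) ≡ total f u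
total-reverse f [] = refl
total-reverse f (e ∷ u) = trans (cong (total f) (ListP.unfold-reverse e u)) (trans (total-++ f (reverse u) [ e ])
  (trans (cong₂ ℤ._+_ (total-reverse f u) (ℤP.+-identityʳ (f e))) (ℤP.+-comm (total f u) (f e))))

total-neg : ∀ {n} (f : Fin n → ℤ) u → total (λ e → ℤ.- f e) u ≡ ℤ.- total f u
total-neg f [] = refl
total-neg f (e ∷ u) = trans (cong (λ t → ℤ.- f e ℤ.+ t) (total-neg f u)) (sym (ℤP.neg-distrib-+ (f e) (total f u)))

total-iterate : ∀ {n} (f : Fin n → ℤ) k u → total f (iterate k u) ≡ + k ℤ.* total f u
total-iterate f zero u = sym (ℤP.*-zeroˡ (total f u))
total-iterate f (suc k) u = trans (total-++ f u (iterate k u)) (trans (cong (λ t → total f u ℤ.+ t) (total-iterate f k u))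
  (sym (suc* k (total f u))))

-- A single counter is followed: a vector of counters is safe along a word if each of them is, so
-- all estimates can be made one counter at a time.
Along : ∀ {n} → (ℤ → Set) → (Fin n → ℤ) → ℤ → List (Fin n) → Set
Along P f z [] = P z
Along P f z (e ∷ u) = P z × Along P f (z ℤ.+ f e) u

Along-map : ∀ {n n′ P} (f : Fin n → ℤ) (o : Fin n′ → Fin n) z u → Along P (f ∘ o) z u → Along P f z (map o u)
Along-map f o z [] a = a
Along-map f o z (e ∷ u) (p , a) = p , Along-map f o _ u a

Along-map⁻ : ∀ {n n′ P} (f : Fin n → ℤ) (o : Fin n′ → Fin n) z u → Along P f z (map o u) → Along P (f ∘ o) z u
Along-map⁻ f o z [] a = a
Along-map⁻ f o z (e ∷ u) (p , a) = p , Along-map⁻ f o _ u a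

Along-shift : ∀ {n} {P Q : ℤ → Set} (f : Fin n → ℤ) k z u → (∀ z → P z → Q (z ℤ.+ k)) → Along P f z u → Along Q f (z ℤ.+ k) u
Along-shift f k z [] i p = i _ p
Along-shift {Q = Q} f k z (e ∷ u) i (p , a) = i _ p ,
  subst (λ t → Along Q f t u) (swap z (f e) k) (Along-shift f k (z ℤ.+ f e) u i a)
  where swap : ∀ z a k → z ℤ.+ a ℤ.+ k ≡ z ℤ.+ k ℤ.+ a
        swap = solve-∀

Along-⇒ : ∀ {n} {P Q : ℤ → Set} (f : Fin n → ℤ) z u → (∀ z → P z → Q z) → Along P f z u → Along Q f z u
Along-⇒ f z [] i p = i _ p
Along-⇒ f z (e ∷ u) i (p , a) = i _ p , Along-⇒ f _ u i a

Along-start : ∀ {n P} (f : Fin n → ℤ) z u → Along P f z u → P z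
Along-start f z [] p = p
Along-start f z (e ∷ u) (p , _) = p

Along-end : ∀ {n} {P : ℤ → Set} (f : Fin n → ℤ) z u → Along P f z u → P (z ℤ.+ total f u)
Along-end {P = P} f z [] p = subst P (sym (ℤP.+-identityʳ z)) p
Along-end {P = P} f z (e ∷ u) (_ , a) = subst P (ℤP.+-assoc z (f e) _) (Along-end f _ u a)

Along-++ : ∀ {n} {P : ℤ → Set} (f : Fin n → ℤ) z u w → Along P f z u → Along P f (z ℤ.+ total f u) w → Along P f z (u ++ w)
Along-++ {P = P} f z [] w a b = subst (λ t → Along P f t w) (ℤP.+-identityʳ z) b
Along-++ {P = P} f z (e ∷ u) w (p , a) b = p , Along-++ f _ u w a (subst (λ t → Along P f t w) (sym (ℤP.+-assoc z (f e) _)) b)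

Along-++⁻ : ∀ {n} {P : ℤ → Set} (f : Fin n → ℤ) z u w → Along P f z (u ++ w) → Along P f z u × Along P f (z ℤ.+ total f u) w
Along-++⁻ {P = P} f z [] w a = Along-start f z w a , subst (λ t → Along P f t w) (sym (ℤP.+-identityʳ z)) a
Along-++⁻ {P = P} f z (e ∷ u) w (p , a) with Along-++⁻ f _ u w a
... | b , c = (p , b) , subst (λ t → Along P f t w) (ℤP.+-assoc z (f e) _) c

-- Backwards and with negated effects the word visits the same values; this carries statements about
-- entries over to exits.
Along-reverse : ∀ {n} {P : ℤ → Set} (f : Fin n → ℤ) z u → Along P f z u →
  Along P (λ e → ℤ.- f e) (z ℤ.+ total f u) (reverse u)
Along-reverse {P = P} f z [] p = subst P (sym (ℤP.+-identityʳ z)) p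
Along-reverse {P = P} f z (e ∷ u) (p , a) = subst (Along P g (z ℤ.+ (f e ℤ.+ total f u))) (sym (ListP.unfold-reverse e u))
  (Along-++ g _ (reverse u) [ e ]
    (subst (λ t → Along P g t (reverse u)) (ℤP.+-assoc z (f e) _) (Along-reverse f (z ℤ.+ f e) u a))
    (subst P (sym start) (Along-start f _ u a) , subst P (sym end) p))
  where
  g = λ e → ℤ.- f e
  cancel : ∀ z a t → z ℤ.+ (a ℤ.+ t) ℤ.+ (ℤ.- t) ≡ z ℤ.+ a
  cancel = solve-∀
  cancel′ : ∀ z a → z ℤ.+ a ℤ.+ (ℤ.- a) ≡ z
  cancel′ = solve-∀
  start : z ℤ.+ (f e ℤ.+ total f u) ℤ.+ total g (reverse u) ≡ z ℤ.+ f e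
  start = trans (cong (λ t → z ℤ.+ (f e ℤ.+ total f u) ℤ.+ t) (trans (total-reverse g u) (total-neg f u))) (cancel z (f e) (total f u))
  end : z ℤ.+ (f e ℤ.+ total f u) ℤ.+ total g (reverse u) ℤ.+ g e ≡ z
  end = trans (cong (λ t → t ℤ.+ g e) start) (cancel′ z (f e))

parikh : ∀ {n} → List (Fin n) → Fin n → ℕ
parikh [] = 𝟘
parikh (e ∷ u) = δ⟨ e ⟩ ⊕ parikh u

parikh-++ : ∀ {n} (u w : List (Fin n)) → parikh (u ++ w) ≗ parikh u ⊕ parikh w
parikh-++ [] w e = refl
parikh-++ (x ∷ u) w e = trans (cong (δ⟨ x ⟩ e ℕ.+_) (parikh-++ u w e)) (sym (ℕP.+-assoc (δ⟨ x ⟩ e) _ _))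

dot-parikh : ∀ {n} (u : List (Fin n)) (f : Fin n → ℤ) → dot (parikh u) f ≡ total f u
dot-parikh [] f = dot-𝟘 f
dot-parikh (e ∷ u) f = trans (dot-⊕ δ⟨ e ⟩ (parikh u) f) (cong₂ ℤ._+_ (dot-δ e f) (dot-parikh u f))

parikh≤length : ∀ {n} (u : List (Fin n)) e → parikh u e ℕ.≤ length u
parikh≤length [] e = z≤n
parikh≤length (x ∷ u) e = ℕP.+-mono-≤ ([]?≤1 (x ≟ e)) (parikh≤length u e)

delete : ∀ {r n} → Graph r (suc n) → Fin (suc n) → Graph r n
delete G e = record { src = src G ∘ punchIn e ; tgt = tgt G ∘ punchIn e }

Path-undelete : ∀ {r n} (G : Graph r (suc n)) e {s} u {q} → Path (delete G e) s u q → Path G s (map (punchIn e) u) q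
Path-undelete G e [] p = p
Path-undelete G e (x ∷ u) (eq , p) = eq , Path-undelete G e u p

-- A walk through e, cut at its first and last use of e.
through : ∀ {r n} (G : Graph r (suc n)) e {s} u {q} → Path G s u q →
  (∃ λ u′ → Path (delete G e) s u′ q) ⊎
  ((∃ λ a → Path (delete G e) s a (src G e)) × (∃ λ b → Path (delete G e) (tgt G e) b q))
through G e [] p = inj₁ ([] , p)
through G e (x ∷ u) (eq , p) with e ≟ x | through G e u p
... | yes refl | inj₁ b = inj₂ (([] , sym eq) , b)
... | yes refl | inj₂ (_ , b) = inj₂ (([] , sym eq) , b)
... | no e≢x | inj₁ (u′ , p′) = inj₁ (punchOut e≢x ∷ u′ , trans (step (src G)) eq , subst (λ t → Path (delete G e) t u′ _) (sym (step (tgt G))) p′)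
  where step : (g : Fin _ → Fin _) → g (punchIn e (punchOut e≢x)) ≡ g x
        step g = cong g (FinP.punchIn-punchOut e≢x)
... | no e≢x | inj₂ ((a , pa) , b) = inj₂ ((punchOut e≢x ∷ a , trans (step (src G)) eq , subst (λ t → Path (delete G e) t a _) (sym (step (tgt G))) pa) , b)
  where step : (g : Fin _ → Fin _) → g (punchIn e (punchOut e≢x)) ≡ g x
        step g = cong g (FinP.punchIn-punchOut e≢x)

concat-via : ∀ {r n} (G : Graph r (suc n)) e {s q} a b → Path (delete G e) s a (src G e) → Path (delete G e) (tgt G e) b q →
  Path G s (map (punchIn e) a ++ e ∷ map (punchIn e) b) q
concat-via G e a b pa pb = Path-++ G (map (punchIn e) a) (Path-undelete G e a pa) (refl , Path-undelete G e b pb)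

-- Induction on the number of edges: a walk through edge `zero` is replaced by a short walk to its
-- first use, the edge itself and a short walk from its last use, both avoiding the edge. So the
-- bound doubles and grows by one.
shorten : ∀ {r n} (G : Graph r n) → ∃ λ L → ∀ s u q → Path G s u q → ∃ λ u′ → length u′ ℕ.≤ L × Path G s u′ q
shorten {n = zero} G = 0 , λ { s [] q p → [] , z≤n , p }
shorten {n = suc n} G with shorten (delete G zero)
... | L , sh = L ℕ.+ suc L , go
  where
  mapped : ∀ u → length u ℕ.≤ L → length (map (punchIn zero) u) ℕ.≤ L
  mapped u le = subst (ℕ._≤ L) (sym (ListP.length-map (punchIn zero) u)) le
  go : ∀ s u q → Path G s u q → ∃ λ u′ → length u′ ℕ.≤ L ℕ.+ suc L × Path G s u′ q
  go s u q p with through G zero u p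
  ... | inj₁ (u′ , p′) with sh s u′ q p′
  ... | v , le , pv = map (punchIn zero) v , ℕP.≤-trans (mapped v le) (ℕP.m≤m+n L _) , Path-undelete G zero v pv
  go s u q p | inj₂ ((a , pa) , (b , pb)) with sh _ a _ pa | sh _ b _ pb
  ... | a′ , la , pa′ | b′ , lb , pb′ = _ ,
    subst (ℕ._≤ L ℕ.+ suc L) (sym (ListP.length-++ (map (punchIn zero) a′))) (ℕP.+-mono-≤ (mapped a′ la) (s≤s (mapped b′ lb))) ,
    concat-via G zero a′ b′ pa′ pb′

reachable? : ∀ {r n} (G : Graph r n) s q → Dec (∃ λ u → Path G s u q)
reachable? {n = zero} G s q with s ≟ q
... | yes p = yes ([] , p)
... | no ¬p = no λ { ([] , p) → ¬p p }
reachable? {n = suc n} G s q = map′ to from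
  (reachable? (delete G zero) s q ⊎-dec (reachable? (delete G zero) s (src G zero) ×-dec reachable? (delete G zero) (tgt G zero) q))
  where
  to : _ → ∃ λ u → Path G s u q
  to (inj₁ (u , p)) = _ , Path-undelete G zero u p
  to (inj₂ ((a , pa) , (b , pb))) = _ , concat-via G zero a b pa pb
  from : (∃ λ u → Path G s u q) → _
  from (u , p) = through G zero u p

path-to-edge : ∀ {r n} (G : Graph r n) {s} u {q} e → Path G s u q → 1 ℕ.≤ parikh u e → ∃ λ w → Path G s w (src G e)
path-to-edge G (x ∷ u) e (eq , p) c with x ≟ e
... | yes refl = [] , sym eq
... | no _ with path-to-edge G u e p c
... | w , pw = x ∷ w , eq , pw

-- Euler walks

Visited : ∀ {r n} → Graph r n → Fin r → List (Fin n) → Fin r → Fin r → Set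
Visited G p u q a = ∃ λ u₁ → ∃ λ u₂ → u ≡ u₁ ++ u₂ × Path G p u₁ a × Path G a u₂ q

visited-tgt : ∀ {r n} (G : Graph r n) {s} u {q} e → Path G s u q → 1 ℕ.≤ parikh u e → Visited G s u q (tgt G e)
visited-tgt G (x ∷ u) e (eq , p) c with x ≟ e
... | yes refl = [ x ] , u , refl , (eq , refl) , p
... | no _ with visited-tgt G u e p c
... | u₁ , u₂ , refl , p₁ , p₂ = x ∷ u₁ , u₂ , refl , (eq , p₁) , p₂

visited-start : ∀ {r n} (G : Graph r n) {s} u {q} → Path G s u q → Visited G s u q s
visited-start G u p = [] , u , refl , refl , p

-- Signed incidence: weighted by the uses of the edges it sums to outdegree minus indegree at `t`.
-- `Flow` is thus Kirchhoff's law with source `s` and sink `q`.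
κ : ∀ {r n} → Graph r n → Fin r → Fin n → ℤ
κ G t e = + [ src G e ≟ t ]? ℤ.- + [ tgt G e ≟ t ]?

Flow : ∀ {r n} → Graph r n → Fin r → Fin r → (Fin n → ℕ) → Set
Flow G s q φ = ∀ t → dot φ (κ G t) ≡ + [ s ≟ t ]? ℤ.- + [ q ≟ t ]?

Circulation : ∀ {r n} → Graph r n → (Fin n → ℕ) → Set
Circulation G φ = ∀ t → dot φ (κ G t) ≡ + 0

path-flow : ∀ {r n} (G : Graph r n) {s} u {q} → Path G s u q → Flow G s q (parikh u)
path-flow G {s} [] refl t = trans (dot-𝟘 (κ G t)) (sym (ℤP.+-inverseʳ (+ [ s ≟ t ]?)))
path-flow G {s} (e ∷ u) {q} (refl , p) t = trans (dot-⊕ δ⟨ e ⟩ (parikh u) (κ G t))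
  (trans (cong₂ ℤ._+_ (dot-δ e (κ G t)) (path-flow G u p t)) (lem (+ [ s ≟ t ]?) (+ [ tgt G e ≟ t ]?) (+ [ q ≟ t ]?)))
  where lem : ∀ a b c → (a ℤ.- b) ℤ.+ (b ℤ.- c) ≡ a ℤ.- c
        lem = solve-∀

product-nonpos : ∀ a b → ¬ (1 ℕ.≤ a × + 1 ℤ.≤ b) → + a ℤ.* b ℤ.≤ + 0
product-nonpos zero b _ = ℤP.≤-reflexive (ℤP.*-zeroˡ b)
product-nonpos (suc a) (+ zero) _ = ℤP.≤-reflexive (ℤP.*-zeroʳ (+ suc a))
product-nonpos (suc a) (+ suc b) ¬p = ⊥-elim (¬p (s≤s z≤n , ℤ.+≤+ (s≤s z≤n)))
product-nonpos (suc a) -[1+ b ] _ = ℤ.-≤+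

positive-term : ∀ {m} (φ : Fin m → ℕ) (f : Fin m → ℤ) → + 1 ℤ.≤ dot φ f → ∃ λ e → 1 ℕ.≤ φ e × + 1 ℤ.≤ f e
positive-term {zero} φ f (ℤ.+≤+ ())
positive-term {suc m} φ f le with (1 ℕP.≤? φ zero) ×-dec (+ 1 ℤP.≤? f zero)
... | yes p = zero , p
... | no ¬p with positive-term (φ ∘ suc) (f ∘ suc) (ℤP.≤-trans le (ℤP.≤-trans (ℤP.+-monoˡ-≤ (dot (φ ∘ suc) (f ∘ suc)) nonpos) (ℤP.≤-reflexive (ℤP.+-identityˡ _))))
  where
  nonpos : + φ zero ℤ.* f zero ℤ.≤ + 0
  nonpos = product-nonpos (φ zero) (f zero) ¬p
... | e , q = suc e , q

module _ {r n : ℕ} (G : Graph r n) where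

  κ-positive : ∀ t e → + 1 ℤ.≤ κ G t e → src G e ≡ t
  κ-positive t e le with src G e ≟ t | tgt G e ≟ t
  ... | yes p | _ = p
  κ-positive t e (ℤ.+≤+ ()) | no _ | no _
  κ-positive t e () | no _ | yes _

  minus : (Fin n → ℕ) → Fin n → Fin n → ℕ
  minus φ e x = φ x ℕ.∸ δ⟨ e ⟩ x

  minus-⊕ : ∀ φ e → 1 ℕ.≤ φ e → φ ≗ δ⟨ e ⟩ ⊕ minus φ e
  minus-⊕ φ e le = +-monus λ x → go x
    where go : ∀ x → δ⟨ e ⟩ x ℕ.≤ φ x
          go x with e ≟ x
          ... | yes refl = le
          ... | no _ = z≤n

  minus-smaller : ∀ φ e → 1 ℕ.≤ φ e → ∑ℕ.sum (minus φ e) ℕ.< ∑ℕ.sum φ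
  minus-smaller φ e le = ∑-mono-< (λ x → ℕP.m∸n≤m (φ x) (δ⟨ e ⟩ x)) e
    (ℕP.∸-monoʳ-< (ℕP.≤-reflexive (sym (δ-same e))) (subst (ℕ._≤ φ e) (sym (δ-same e)) le))

  minus-flow : ∀ φ e q → 1 ℕ.≤ φ e → Flow G (src G e) q φ → Flow G (tgt G e) q (minus φ e)
  minus-flow φ e q le flow t = trans (shift (κ G t e) _) (trans (cong (ℤ._- κ G t e)
      (trans (cong (ℤ._+ dot (minus φ e) (κ G t)) (sym (dot-δ e (κ G t))))
        (trans (sym (dot-⊕ δ⟨ e ⟩ (minus φ e) (κ G t))) (trans (sym (dot-congˡ (κ G t) (minus-⊕ φ e le))) (flow t)))))
      (lem (+ [ src G e ≟ t ]?) (+ [ tgt G e ≟ t ]?) (+ [ q ≟ t ]?)))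
    where
    shift : ∀ x y → y ≡ (x ℤ.+ y) ℤ.- x
    shift = solve-∀
    lem : ∀ a b c → (a ℤ.- c) ℤ.- (a ℤ.- b) ≡ b ℤ.- c
    lem = solve-∀

  -- Away from `q` the flow law leaves one more outgoing than incoming edge at `s`, so the walk can
  -- go on, and taking the edge moves the source of the flow to its target. `ψ` is what is left on
  -- arrival.
  walk : ∀ N s q φ → ∑ℕ.sum φ ℕ.< N → Flow G s q φ → ∃ λ u → ∃ λ ψ → Path G s u q × φ ≗ parikh u ⊕ ψ
  walk (suc N) s q φ (s≤s lt) flow with s ≟ q
  ... | yes s≡q = [] , φ , s≡q , λ _ → refl
  ... | no s≢q with positive-term φ (κ G s) (ℤP.≤-reflexive (sym (trans (flow s) (cong₂ (λ a b → + a ℤ.- + b)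
                     ([]?-yes (s ≟ s) refl) ([]?-no (q ≟ s) (s≢q ∘ sym))))))
  ... | e , le , pos with κ-positive s e pos
  ... | refl with walk N (tgt G e) q (minus φ e) (ℕP.<-≤-trans (minus-smaller φ e le) lt) (minus-flow φ e q le flow)
  ... | u , ψ , p , eq = e ∷ u , ψ , (refl , p) , λ x → trans (minus-⊕ φ e le x) (trans (cong (δ⟨ e ⟩ x ℕ.+_) (eq x)) (sym (ℕP.+-assoc (δ⟨ e ⟩ x) _ _)))

  circulation→flow : ∀ φ s → Circulation G φ → Flow G s s φ
  circulation→flow φ s c t = trans (c t) (sym (ℤP.+-inverseʳ (+ [ s ≟ t ]?)))

  remainder : ∀ φ u ψ {s q} → φ ≗ parikh u ⊕ ψ → Flow G s q φ → Path G s u q → Circulation G ψ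
  remainder φ u ψ {s} {q} eq flow p t = trans (shift (dot (parikh u) (κ G t)) _)
    (trans (cong₂ ℤ._-_ (trans (sym (dot-⊕ (parikh u) ψ (κ G t))) (trans (sym (dot-congˡ (κ G t) eq)) (flow t))) (path-flow G u p t))
       (ℤP.+-inverseʳ (+ [ s ≟ t ]? ℤ.- + [ q ≟ t ]?)))
    where shift : ∀ x y → y ≡ (x ℤ.+ y) ℤ.- x
          shift = solve-∀

  module _ (p q : Fin r) (φ : Fin n → ℕ) (flow : Flow G p q φ) (full : ∀ e → 1 ℕ.≤ φ e)
           (reach : ∀ e → ∃ λ w → Path G p w (src G e)) where

    -- Follow `w` from a visited vertex. An edge with nothing left over occurs in `u`, because `φ`
    -- uses every edge, so its target is visited too; hence the first edge with something left over
    -- starts at a visited vertex.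
    attached-edge : ∀ u ψ → Path G p u q → φ ≗ parikh u ⊕ ψ → ∀ w a e → Path G a w (src G e) → Visited G p u q a → 1 ℕ.≤ ψ e →
      ∃ λ e′ → 1 ℕ.≤ ψ e′ × Visited G p u q (src G e′)
    attached-edge u ψ pu eq [] a e refl vis le = e , le , vis
    attached-edge u ψ pu eq (x ∷ w) a e (refl , pw) vis le with ψ x in ψx
    ... | suc _ = x , subst (1 ℕ.≤_) (sym ψx) (s≤s z≤n) , vis
    ... | zero = attached-edge u ψ pu eq w (tgt G x) e pw (visited-tgt G u x pu
          (subst (1 ℕ.≤_) (trans (eq x) (trans (cong (parikh u x ℕ.+_) ψx) (ℕP.+-identityʳ _))) (full x))) le

    -- Hierholzer's construction: the remainder is a circulation, so an attached edge extends to a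
    -- closed walk inside it, which is inserted where `u` visits its source.
    splice : ∀ N u ψ → ∑ℕ.sum ψ ℕ.< N → Path G p u q → φ ≗ parikh u ⊕ ψ → ∃ λ u′ → Path G p u′ q × φ ≗ parikh u′
    splice (suc N) u ψ (s≤s lt) pu eq with FinP.any? (λ e → 1 ℕP.≤? ψ e)
    ... | no none = u , pu , λ x → trans (eq x) (trans (cong (parikh u x ℕ.+_) (ψ≡0 x)) (ℕP.+-identityʳ _))
      where ψ≡0 : ∀ x → ψ x ≡ 0
            ψ≡0 x with ψ x in ψx
            ... | zero = refl
            ... | suc _ = ⊥-elim (none (x , subst (1 ℕ.≤_) (sym ψx) (s≤s z≤n)))
    ... | yes (e₀ , le₀) with attached-edge u ψ pu eq (proj₁ (reach e₀)) p e₀ (proj₂ (reach e₀)) (visited-start G u pu) le₀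
    ... | e , le , u₁ , u₂ , refl , p₁ , p₂ with walk _ (tgt G e) (src G e) (minus ψ e) ℕP.≤-refl
             (minus-flow ψ e (src G e) le (circulation→flow ψ (src G e) (remainder φ (u₁ ++ u₂) ψ eq flow pu)))
    ... | c , ψ′ , pc , eq′ = splice N (u₁ ++ (e ∷ c ++ u₂)) ψ′ smaller
              (Path-++ G u₁ p₁ (Path-++ G (e ∷ c) (refl , pc) p₂)) eq″
      where
      ψ-split : ψ ≗ δ⟨ e ⟩ ⊕ (parikh c ⊕ ψ′)
      ψ-split x = trans (minus-⊕ ψ e le x) (cong (δ⟨ e ⟩ x ℕ.+_) (eq′ x))
      smaller : ∑ℕ.sum ψ′ ℕ.< N
      smaller = ℕP.<-≤-trans (ℕP.≤-<-trans (∑-mono-≤ (λ x → subst (ψ′ x ℕ.≤_) (sym (eq′ x)) (ℕP.m≤n+m (ψ′ x) (parikh c x)))) (minus-smaller ψ e le)) lt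
      rearrange : ∀ a b d c s → a ℕ.+ b ℕ.+ (d ℕ.+ (c ℕ.+ s)) ≡ a ℕ.+ (d ℕ.+ (c ℕ.+ b)) ℕ.+ s
      rearrange = ℕ-solve-∀
      eq″ : φ ≗ parikh (u₁ ++ (e ∷ c ++ u₂)) ⊕ ψ′
      eq″ x = trans (eq x) (trans (cong₂ ℕ._+_ (parikh-++ u₁ u₂ x) (ψ-split x))
        (trans (rearrange (parikh u₁ x) (parikh u₂ x) (δ⟨ e ⟩ x) (parikh c x) (ψ′ x))
          (cong (ℕ._+ ψ′ x) (sym (trans (parikh-++ u₁ (e ∷ c ++ u₂) x)
            (cong (λ t → parikh u₁ x ℕ.+ (δ⟨ e ⟩ x ℕ.+ t)) (parikh-++ c u₂ x)))))))

    euler : ∃ λ u → Path G p u q × φ ≗ parikh u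
    euler with walk _ p q φ ℕP.≤-refl flow
    ... | u , ψ , pu , eq = splice _ u ψ ℕP.≤-refl pu eq

-- Bounded counters

Within : ℕ → ℤ → Set
Within B z = ∃ λ (b : Fin (suc B)) → z ≡ + toℕ b

NonNeg : ℤ → Set
NonNeg z = + 0 ℤ.≤ z

Within⇒NonNeg : ∀ {B} z → Within B z → NonNeg z
Within⇒NonNeg z (b , refl) = ℤ.+≤+ z≤n

below⇒Within : ∀ {B} z → NonNeg z → ¬ (+ B ℤ.≤ z) → Within B z
below⇒Within {B} (+ z) _ ¬le = fromℕ< lt , cong +_ (sym (FinP.toℕ-fromℕ< lt))
  where lt : z ℕ.< suc B
        lt = ℕP.m≤n⇒m≤1+n (ℕP.≰⇒> (λ le → ¬le (ℤ.+≤+ le)))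

-- The value of one counter, known to stay in [0,B], is moved into the states of the graph.
module Fold {r n} (G : Graph r n) (g : Fin n → ℤ) (B : ℕ) where

  Edge : Set
  Edge = Fin n × Fin (suc B) × Fin (suc B)

  Consistent : Edge → Set
  Consistent (e , b , b′) = + toℕ b ℤ.+ g e ≡ + toℕ b′

  consistent? : ∀ x → Dec (Consistent x)
  consistent? (e , b , b′) = (+ toℕ b ℤ.+ g e) ℤP.≟ + toℕ b′

  candidates edges : List Edge
  candidates = cartesianProduct (allFin n) (cartesianProduct (allFin (suc B)) (allFin (suc B)))
  edges = filter consistent? candidates

  folded : Graph (r ℕ.* suc B) (length edges)
  folded = record { src = λ k → combine (src G (proj₁ (lookup edges k))) (proj₁ (proj₂ (lookup edges k)))
                  ; tgt = λ k → combine (tgt G (proj₁ (lookup edges k))) (proj₂ (proj₂ (lookup edges k))) }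

  orig : Fin (length edges) → Fin n
  orig k = proj₁ (lookup edges k)

  lift : ∀ s u q b → Path G s u q → Along (Within B) g (+ toℕ b) u →
    ∃ λ u′ → ∃ λ b′ → Path folded (combine s b) u′ (combine q b′) × map orig u′ ≡ u × + toℕ b′ ≡ + toℕ b ℤ.+ total g u
  lift s [] q b refl _ = [] , b , refl , refl , sym (ℤP.+-identityʳ _)
  lift s (e ∷ u) q b (refl , p) (_ , al) with Along-start g _ u al
  ... | b₁ , eq₁ with lift (tgt G e) u q b₁ p (subst (λ t → Along (Within B) g t u) eq₁ al)
  ... | u′ , b′ , p′ , refl , eq′ = Any.index e∈ ∷ u′ , b′ , (src-eq , subst (λ t → Path folded t u′ (combine q b′)) (sym tgt-eq) p′) ,
        cong (_∷ map orig u′) (cong proj₁ here-edge) ,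
        trans eq′ (trans (cong (ℤ._+ total g u) (sym eq₁)) (ℤP.+-assoc (+ toℕ b) (g e) (total g u)))
    where
    e∈ : (e , b , b₁) ∈ edges
    e∈ = ∈-filter⁺ consistent? {xs = candidates} (∈-cartesianProduct⁺ (∈-allFin e) (∈-cartesianProduct⁺ (∈-allFin b) (∈-allFin b₁))) eq₁
    here-edge : lookup edges (Any.index e∈) ≡ (e , b , b₁)
    here-edge = sym (AnyP.lookup-index e∈)
    src-eq : src folded (Any.index e∈) ≡ combine (src G e) b
    src-eq = cong (λ x → combine (src G (proj₁ x)) (proj₁ (proj₂ x))) here-edge
    tgt-eq : tgt folded (Any.index e∈) ≡ combine (tgt G e) b₁
    tgt-eq = cong (λ x → combine (tgt G (proj₁ x)) (proj₂ (proj₂ x))) here-edge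

  project : ∀ s u q b b′ → Path folded (combine s b) u (combine q b′) →
    Path G s (map orig u) q × Along (Within B) g (+ toℕ b) (map orig u) × + toℕ b′ ≡ + toℕ b ℤ.+ total g (map orig u)
  project s [] q b b′ p with FinP.combine-injective s b q b′ p
  ... | refl , refl = refl , (b , refl) , sym (ℤP.+-identityʳ _)
  project s (k ∷ u) q b b′ (eq , p) with FinP.combine-injective (src G (orig k)) (proj₁ (proj₂ (lookup edges k))) s b eq
  ... | refl , refl with project (tgt G (orig k)) u q (proj₂ (proj₂ (lookup edges k))) b′ p
  ... | p′ , al , eq′ = (refl , p′) , ((b , refl) , subst (λ t → Along (Within B) g t (map orig u)) (sym ok) al) ,
        trans eq′ (trans (cong (ℤ._+ total g (map orig u)) (sym ok)) (ℤP.+-assoc (+ toℕ (proj₁ (proj₂ (lookup edges k)))) (g (orig k)) (total g (map orig u))))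
    where ok : Consistent (lookup edges k)
          ok = proj₂ (∈-filter⁻ consistent? {xs = candidates} (∈-lookup k))

-- Once the counters are folded into the states, staying within bounds just means being a walk, and
-- `shorten` applies. The last state records the final values, so the totals survive.
shorten-within : ∀ {r n} (G : Graph r n) B k (f : Fin k → Fin n → ℤ) → ∃ λ L → ∀ s u q (v : Fin k → ℤ) → Path G s u q →
  (∀ j → Along (Within B) (f j) (v j) u) →
  ∃ λ u′ → length u′ ℕ.≤ L × Path G s u′ q × (∀ j → Along (Within B) (f j) (v j) u′) × (∀ j → total (f j) u′ ≡ total (f j) u)
shorten-within G B zero f with shorten G
... | L , sh = L , λ s u q v p _ → let (u′ , le , p′) = sh s u q p in u′ , le , p′ , (λ ()) , λ ()
shorten-within {r} {n} G B (suc k) f with shorten-within (Fold.folded G (f zero) B) B k (λ j → f (suc j) ∘ Fold.orig G (f zero) B)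
... | L , sh = L , go
  where
  open Fold G (f zero) B
  go : ∀ s u q (v : Fin (suc k) → ℤ) → Path G s u q → (∀ j → Along (Within B) (f j) (v j) u) →
    ∃ λ u′ → length u′ ℕ.≤ L × Path G s u′ q × (∀ j → Along (Within B) (f j) (v j) u′) × (∀ j → total (f j) u′ ≡ total (f j) u)
  go s u q v p al with Along-start (f zero) _ u (al zero)
  ... | b , eq with lift s u q b p (subst (λ t → Along (Within B) (f zero) t u) eq (al zero))
  ... | w , b′ , pw , refl , eq′ with sh _ w _ (v ∘ suc) pw (λ j → Along-map⁻ (f (suc j)) orig _ w (al (suc j)))
  ... | w′ , le , pw′ , al′ , tot with project s w′ q b b′ pw′
  ... | p″ , al₀ , eq″ = map orig w′ , subst (ℕ._≤ L) (sym (ListP.length-map orig w′)) le , p″ ,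
    (λ { zero → subst (λ t → Along (Within B) (f zero) t (map orig w′)) (sym eq) al₀
       ; (suc j) → Along-map (f (suc j)) orig _ w′ (al′ j) }) ,
    λ { zero → ℤ-cancelˡ (+ toℕ b) (trans (sym eq″) eq′)
      ; (suc j) → trans (total-map (f (suc j)) orig w′) (trans (tot j) (sym (total-map (f (suc j)) orig w))) }

-- Bounds the drop of the counter along every prefix: a start this high makes the word safe.
cost : ∀ {n} → (Fin n → ℤ) → List (Fin n) → ℕ
cost f [] = 0
cost f (e ∷ u) = ∣ f e ∣ ℕ.+ cost f u

cost≤ : ∀ {n} (f : Fin n → ℤ) W → (∀ e → ∣ f e ∣ ℕ.≤ W) → ∀ u → cost f u ℕ.≤ length u ℕ.* W
cost≤ f W le [] = z≤n
cost≤ f W le (e ∷ u) = ℕP.+-mono-≤ (le e) (cost≤ f W le u)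

drop≤∣∣ : ∀ {m c z} a → + (∣ a ∣ ℕ.+ m) ℤ.+ c ℤ.≤ z → + m ℤ.+ c ℤ.≤ z ℤ.+ a
drop≤∣∣ {m} {c} {z} a le = ℤP.≤-trans
  (ℤP.≤-trans (ℤP.≤-reflexive (sym (ℤP.+-identityʳ _))) (ℤP.≤-trans (ℤP.+-monoʳ-≤ (+ m ℤ.+ c) (nonneg a))
     (ℤP.≤-reflexive (trans (lem (+ m) c (+ ∣ a ∣) a) (cong (λ t → t ℤ.+ c ℤ.+ a) (sym (ℤP.pos-+ ∣ a ∣ m)))))))
  (ℤP.+-monoˡ-≤ a le)
  where
  lem : ∀ m c x a → m ℤ.+ c ℤ.+ (x ℤ.+ a) ≡ x ℤ.+ m ℤ.+ c ℤ.+ a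
  lem = solve-∀
  nonneg : ∀ a → + 0 ℤ.≤ + ∣ a ∣ ℤ.+ a
  nonneg (+ n) = ℤ.+≤+ z≤n
  nonneg -[1+ n ] = ℤP.≤-reflexive (sym (ℤP.+-inverseʳ (+ suc n)))

Along-high : ∀ {n} (f : Fin n → ℤ) c z u → + cost f u ℤ.+ c ℤ.≤ z → Along (c ℤ.≤_) f z u
Along-high f c z [] le = ℤP.≤-trans (ℤP.≤-reflexive (sym (ℤP.+-identityˡ c))) le
Along-high f c z (e ∷ u) le = ℤP.≤-trans (ℤP.≤-trans (ℤP.≤-reflexive (sym (ℤP.+-identityˡ c))) (ℤP.+-monoˡ-≤ c (ℤ.+≤+ z≤n))) le ,
  Along-high f c (z ℤ.+ f e) u (drop≤∣∣ {cost f u} {c} (f e) le)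

total≥ : ∀ {n} (f : Fin n → ℤ) c z u → + cost f u ℤ.+ c ℤ.≤ z → c ℤ.≤ z ℤ.+ total f u
total≥ f c z u le = Along-end f z u (Along-high f c z u le)

Ever : ∀ {n} → ℕ → (Fin n → ℤ) → ℤ → List (Fin n) → Set
Ever B f z [] = + B ℤ.≤ z
Ever B f z (e ∷ u) = + B ℤ.≤ z ⊎ Ever B f (z ℤ.+ f e) u

ever? : ∀ {n} B (f : Fin n → ℤ) z u → Dec (Ever B f z u)
ever? B f z [] = + B ℤP.≤? z
ever? B f z (e ∷ u) = (+ B ℤP.≤? z) ⊎-dec ever? B f (z ℤ.+ f e) u

Ever-≤ : ∀ {n B B′} (f : Fin n → ℤ) z u → B′ ℕ.≤ B → Ever B f z u → Ever B′ f z u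
Ever-≤ f z [] le ev = ℤP.≤-trans (ℤ.+≤+ le) ev
Ever-≤ f z (e ∷ u) le (inj₁ ev) = inj₁ (ℤP.≤-trans (ℤ.+≤+ le) ev)
Ever-≤ f z (e ∷ u) le (inj₂ ev) = inj₂ (Ever-≤ f _ u le ev)

never⇒Within : ∀ {n B} (f : Fin n → ℤ) z u → Along NonNeg f z u → ¬ Ever B f z u → Along (Within B) f z u
never⇒Within f z [] p ¬ev = below⇒Within z p ¬ev
never⇒Within f z (e ∷ u) (p , al) ¬ev = below⇒Within z p (¬ev ∘ inj₁) , never⇒Within f _ u al (¬ev ∘ inj₂)

-- Rackoff's argument

module Rackoff {r n : ℕ} (G : Graph r n) where

  Safe : ∀ {k} → (Fin k → Fin n → ℤ) → (Fin k → ℤ) → List (Fin n) → Set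
  Safe f v u = ∀ j → Along NonNeg (f j) (v j) u

  Climb : ∀ {k} → (Fin k → Fin n → ℤ) → (Fin k → ℤ) → ℕ → ℕ → Fin r → Set
  Climb f v C L s = ∃ λ u → ∃ λ q → Path G s u q × length u ℕ.≤ L × Safe f v u × (∀ j → + C ℤ.≤ v j ℤ.+ total (f j) u)

  after : ∀ {k} → (Fin k → Fin n → ℤ) → (Fin k → ℤ) → List (Fin n) → Fin k → ℤ
  after f v u j = v j ℤ.+ total (f j) u

  record Cut {k} (f : Fin k → Fin n → ℤ) (B L : ℕ) (s : Fin r) (v : Fin k → ℤ) (q : Fin r) : Set where
    field
      u₁ u₂  : List (Fin n)
      mid    : Fin r
      path₁  : Path G s u₁ mid
      path₂  : Path G mid u₂ q
      short  : length u₁ ℕ.≤ L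
      safe₁  : Safe f v u₁
      safe₂  : Safe f (after f v u₁) u₂
      high   : ∃ λ i → + B ℤ.≤ after f v u₁ i
      ever₂  : ∀ j → Ever B (f j) (after f v u₁ j) u₂

  record Scan {k} (f : Fin k → Fin n → ℤ) (B : ℕ) (s : Fin r) (v : Fin k → ℤ) (q : Fin r) : Set where
    field
      w u₂   : List (Fin n)
      e      : Fin n
      path₁  : Path G s w (src G e)
      path₂  : Path G (tgt G e) u₂ q
      low    : ∀ j → Along (Within B) (f j) (v j) w
      safe₂  : Safe f (λ j → v j ℤ.+ total (f j) w ℤ.+ f j e) u₂
      high   : ∃ λ i → + B ℤ.≤ v i ℤ.+ total (f i) w ℤ.+ f i e
      ever₂  : ∀ j → Ever B (f j) (v j ℤ.+ total (f j) w ℤ.+ f j e) u₂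

  -- The cut is made at the first high vector. No counter is high earlier, so the moment at which
  -- each of them has to be high still lies ahead, which gives `ever₂`.
  scan : ∀ {k} (f : Fin (suc k) → Fin n → ℤ) B s u v q → Path G s u q → Safe f v u → (∀ j → Ever B (f j) (v j) u) →
    (∃ λ i → + B ℤ.≤ v i) ⊎ Scan f B s v q
  scan f B s [] v q p sf ev = inj₁ (zero , ev zero)
  scan f B s (e ∷ u) v q (refl , p) sf ev with FinP.any? (λ i → + B ℤP.≤? v i)
  ... | yes hi = inj₁ hi
  ... | no ¬hi = inj₂ (extend (scan f B (tgt G e) u (λ j → v j ℤ.+ f j e) q p (λ j → proj₂ (sf j)) ev′))
    where
    ev′ : ∀ j → Ever B (f j) (v j ℤ.+ f j e) u
    ev′ j with ev j
    ... | inj₁ hi = ⊥-elim (¬hi (j , hi))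
    ... | inj₂ later = later
    low₀ : ∀ j → Within B (v j)
    low₀ j = below⇒Within (v j) (proj₁ (sf j)) (λ hi → ¬hi (j , hi))
    one : ∀ j → v j ℤ.+ f j e ≡ v j ℤ.+ + 0 ℤ.+ f j e
    one j = cong (ℤ._+ f j e) (sym (ℤP.+-identityʳ (v j)))
    extend : (∃ λ i → + B ℤ.≤ v i ℤ.+ f i e) ⊎ Scan f B (tgt G e) (λ j → v j ℤ.+ f j e) q → Scan f B (src G e) v q
    extend (inj₁ (i , hi)) = record
      { w = [] ; u₂ = u ; e = e ; path₁ = refl ; path₂ = p ; low = low₀
      ; safe₂ = λ j → subst (λ t → Along NonNeg (f j) t u) (one j) (proj₂ (sf j))
      ; high = i , subst (+ B ℤ.≤_) (one i) hi
      ; ever₂ = λ j → subst (λ t → Ever B (f j) t u) (one j) (ev′ j) }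
    extend (inj₂ sc) = record
      { w = e ∷ w ; u₂ = u₂ ; e = e₁ ; path₁ = refl , path₁ ; path₂ = path₂
      ; low = λ j → low₀ j , low j
      ; safe₂ = λ j → subst (λ t → Along NonNeg (f j) t u₂) (assoc j) (safe₂ j)
      ; high = proj₁ high , subst (+ B ℤ.≤_) (assoc (proj₁ high)) (proj₂ high)
      ; ever₂ = λ j → subst (λ t → Ever B (f j) t u₂) (assoc j) (ever₂ j) }
      where
      open Scan sc renaming (e to e₁)
      assoc : ∀ j → v j ℤ.+ f j e ℤ.+ total (f j) w ℤ.+ f j e₁ ≡ v j ℤ.+ (f j e ℤ.+ total (f j) w) ℤ.+ f j e₁
      assoc j = cong (ℤ._+ f j e₁) (ℤP.+-assoc (v j) (f j e) (total (f j) w))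

  -- Shortening the low prefix preserves the total of every counter, so the rest of the walk goes on
  -- from the same vector. The `suc` counts the edge into the high vector.
  cut : ∀ {k} (f : Fin (suc k) → Fin n → ℤ) B s u v q → Path G s u q → Safe f v u → (∀ j → Ever B (f j) (v j) u) →
    Cut f B (suc (proj₁ (shorten-within G B (suc k) f))) s v q
  cut {k} f B s u v q p sf ev with scan f B s u v q p sf ev
  ... | inj₁ (i , hi) = record
      { u₁ = [] ; u₂ = u ; mid = s ; path₁ = refl ; path₂ = p ; short = z≤n ; safe₁ = λ j → Along-start (f j) _ u (sf j)
      ; safe₂ = λ j → subst (λ t → Along NonNeg (f j) t u) (sym (ℤP.+-identityʳ (v j))) (sf j)
      ; high = i , subst (+ B ℤ.≤_) (sym (ℤP.+-identityʳ (v i))) hi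
      ; ever₂ = λ j → subst (λ t → Ever B (f j) t u) (sym (ℤP.+-identityʳ (v j))) (ev j) }
  ... | inj₂ sc with proj₂ (shorten-within G B (suc k) f) s (Scan.w sc) _ v (Scan.path₁ sc) (Scan.low sc)
  ... | w′ , le , p′ , low′ , tot = record
      { u₁ = w′ ∷ʳ e ; u₂ = u₂ ; mid = tgt G e ; path₁ = Path-++ G w′ p′ (refl , refl) ; path₂ = path₂
      ; short = subst (ℕ._≤ suc _) (sym (ListP.length-++-comm w′ (e ∷ []))) (s≤s le)
      ; safe₁ = λ j → Along-++ (f j) (v j) w′ (e ∷ []) (Along-⇒ (f j) _ w′ Within⇒NonNeg (low′ j))
          (Within⇒NonNeg _ (Along-end (f j) _ w′ (low′ j)) , subst NonNeg (cong (λ t → v j ℤ.+ t ℤ.+ f j e) (sym (tot j))) (Along-start (f j) _ u₂ (safe₂ j)))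
      ; safe₂ = λ j → subst (λ t → Along NonNeg (f j) t u₂) (same j) (safe₂ j)
      ; high = proj₁ high , subst (+ B ℤ.≤_) (same (proj₁ high)) (proj₂ high)
      ; ever₂ = λ j → subst (λ t → Ever B (f j) t u₂) (same j) (ever₂ j) }
    where
    open Scan sc
    same : ∀ j → v j ℤ.+ total (f j) w ℤ.+ f j e ≡ v j ℤ.+ total (f j) (w′ ∷ʳ e)
    same j = sym (trans (cong (λ t → v j ℤ.+ t) (trans (total-++ (f j) w′ (e ∷ [])) (cong₂ ℤ._+_ (tot j) (ℤP.+-identityʳ (f j e)))))
                        (sym (ℤP.+-assoc (v j) _ _)))

  -- Rackoff's argument.  Cut the walk where a counter i first gets high: the prefix can be shortened, and
  -- the induction hypothesis for the other counters yields a continuation too short for i to fall below C.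
  rackoff : ∀ k (f : Fin k → Fin n → ℤ) (C : ℕ) → ∃ λ B → ∃ λ L → ∀ s u q v → Path G s u q → Safe f v u →
    (∀ j → Ever B (f j) (v j) u) → Climb f v C L s
  rackoff zero f C = 0 , 0 , λ s u q v p sf ev → [] , s , refl , z≤n , (λ ()) , λ ()
  rackoff (suc k) f C = B , suc L₁ ℕ.+ L′ , λ s u q v p sf ev → finish (cut f B s u v q p sf ev)
    where
    rec : ∀ i → ∃ λ B → ∃ λ L → ∀ s u q v → Path G s u q → Safe (f ∘ punchIn i) v u →
      (∀ j → Ever B (f (punchIn i j)) (v j) u) → Climb (f ∘ punchIn i) v C L s
    rec i = rackoff k (f ∘ punchIn i) C
    B′ L′ W B L₁ : ℕ
    B′ = ∑ℕ.sum (λ i → proj₁ (rec i))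
    L′ = ∑ℕ.sum (λ i → proj₁ (proj₂ (rec i)))
    W = ∑ℕ.sum (λ i → ∑ℕ.sum (λ e → ∣ f i e ∣))
    -- `B′` suffices for the induction hypothesis whichever counter gets high first; the second
    -- summand pays for `L′` edges of the continuation and leaves `C`.
    B = B′ ℕ.+ (L′ ℕ.* W ℕ.+ C)
    L₁ = proj₁ (shorten-within G B (suc k) f)
    finish : ∀ {s v q} → Cut f B (suc L₁) s v q → Climb f v C (suc L₁ ℕ.+ L′) s
    finish {s} {v} {q} c with Cut.high c
    ... | i , hi with proj₂ (proj₂ (rec i)) (Cut.mid c) (Cut.u₂ c) q (after f v (Cut.u₁ c) ∘ punchIn i) (Cut.path₂ c) (Cut.safe₂ c ∘ punchIn i)
               (λ j → Ever-≤ (f (punchIn i j)) _ (Cut.u₂ c) (ℕP.≤-trans (term≤∑ (λ i → proj₁ (rec i)) i) (ℕP.m≤m+n B′ _)) (Cut.ever₂ c (punchIn i j)))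
    ... | w , t , pw , lw , sw , cw = u₁ ++ w , t , Path-++ G u₁ path₁ pw ,
          subst (ℕ._≤ suc L₁ ℕ.+ L′) (sym (ListP.length-++ u₁)) (ℕP.+-mono-≤ short lw′) ,
          (λ j → Along-++ (f j) (v j) u₁ w (safe₁ j) (proj₁ (both j))) ,
          λ j → subst (+ C ℤ.≤_) (trans (ℤP.+-assoc (v j) _ _) (cong (λ t → v j ℤ.+ t) (sym (total-++ (f j) u₁ w)))) (proj₂ (both j))
      where
      open Cut c
      lw′ : length w ℕ.≤ L′
      lw′ = ℕP.≤-trans lw (term≤∑ (λ i → proj₁ (proj₂ (rec i))) i)
      enough : + cost (f i) w ℤ.+ + C ℤ.≤ after f v u₁ i
      enough = ℤP.≤-trans (ℤP.≤-reflexive (sym (ℤP.pos-+ (cost (f i) w) C)))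
        (ℤP.≤-trans (ℤ.+≤+ (ℕP.≤-trans (ℕP.+-monoˡ-≤ C (ℕP.≤-trans (cost≤ (f i) W (λ e → ℕP.≤-trans (term≤∑ (λ e → ∣ f i e ∣) e) (term≤∑ (λ i → ∑ℕ.sum (λ e → ∣ f i e ∣)) i)) w)
                                                        (ℕP.*-monoˡ-≤ W lw′))) (ℕP.m≤n+m _ B′))) hi)
      both : ∀ j → Along NonNeg (f j) (after f v u₁ j) w × + C ℤ.≤ after f v u₁ j ℤ.+ total (f j) w
      both j with i ≟ j
      ... | yes refl = Along-⇒ (f i) _ w (λ z → ℤP.≤-trans (ℤ.+≤+ z≤n)) (Along-high (f i) (+ C) _ w enough) , total≥ (f i) (+ C) _ w enough
      ... | no i≢j = subst (λ j → Along NonNeg (f j) (after f v u₁ j) w × + C ℤ.≤ after f v u₁ j ℤ.+ total (f j) w)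
                           (FinP.punchIn-punchOut i≢j) (sw (punchOut i≢j) , cw (punchOut i≢j))

words : ∀ n → ℕ → List (List (Fin n))
words n zero = [] ∷ []
words n (suc L) = [] ∷ concatMap (λ e → map (e ∷_) (words n L)) (allFin n)

words-complete : ∀ {n} L (u : List (Fin n)) → length u ℕ.≤ L → u ∈ words n L
words-complete zero [] le = here refl
words-complete (suc L) [] le = here refl
words-complete {n} (suc L) (e ∷ u) (s≤s le) = there (∈-concatMap⁺ (λ e → map (e ∷_) (words n L))
  (Any.map (λ { refl → ∈-map⁺ (e ∷_) (words-complete L u le) }) (∈-allFin e)))

along? : ∀ {n} {P : ℤ → Set} → (∀ z → Dec (P z)) → (f : Fin n → ℤ) → ∀ z u → Dec (Along P f z u)
along? P? f z [] = P? z
along? P? f z (e ∷ u) = P? z ×-dec along? P? f _ u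

-- A climbing walk may end at any vertex; `return` closes it to a cycle, once the climb is high
-- enough to pay for the way back.
module Pumping {r n : ℕ} (G : Graph r n) (p : Fin r)
  (return : ∀ u t → Path G p u t → ∃ λ w → Path G t w p) {k} (f : Fin k → Fin n → ℤ) (a : Fin k → ℕ) where

  open Rackoff G

  Pump : Set
  Pump = ∃ λ u → Path G p u p × (∀ j → Along NonNeg (f j) (+ a j) u × + 1 ℤ.≤ total (f j) u)

  Confined : Set
  Confined = ∃ λ B → ∀ u q → Path G p u q → (∀ j → Along NonNeg (f j) (+ a j) u) → ∃ λ j → Along (Within B) (f j) (+ a j) u

  back : Fin r → List (Fin n)
  back t with reachable? G t p
  ... | yes (w , _) = w
  -- A dummy for vertices without a way back; by `back-path` no vertex reached from `p` is one of
  -- them.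
  ... | no _ = []

  back-path : ∀ u t → Path G p u t → Path G t (back t) p
  back-path u t pu with reachable? G t p
  ... | yes (w , pw) = pw
  ... | no none = ⊥-elim (none (return u t pu))

  backCost : Fin r → Fin k → ℕ
  backCost t j = cost (f j) (back t)

  C : ℕ
  -- The first sum pays for the way back from any vertex; the rest exceeds every starting value, so
  -- each counter gains at least 1.
  C = ∑ℕ.sum (λ t → ∑ℕ.sum (backCost t)) ℕ.+ (1 ℕ.+ ∑ℕ.sum a)

  B L : ℕ
  B = proj₁ (rackoff k f C)
  L = proj₁ (proj₂ (rackoff k f C))

  Climbs : List (Fin n) → Set
  Climbs u = (∃ λ t → Path G p u t) × (∀ j → Along NonNeg (f j) (+ a j) u × + C ℤ.≤ + a j ℤ.+ total (f j) u)

  climbs? : ∀ u → Dec (Climbs u)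
  climbs? u = FinP.any? (λ t → path? G p u t) ×-dec
    FinP.all? (λ j → along? (λ z → + 0 ℤP.≤? z) (f j) (+ a j) u ×-dec (+ C ℤP.≤? (+ a j ℤ.+ total (f j) u)))

  pump : ∀ u → Climbs u → Pump
  pump u ((t , pu) , up) = u ++ back t , Path-++ G u pu (back-path u t pu) , λ j →
    Along-++ (f j) (+ a j) u (back t) (proj₁ (up j))
      (Along-⇒ (f j) _ (back t) (λ z → ℤP.≤-trans (ℤ.+≤+ z≤n)) (Along-high (f j) (+ (1 ℕ.+ ∑ℕ.sum a)) _ (back t) (enough j))) ,
    gain j
    where
    enough : ∀ j → + cost (f j) (back t) ℤ.+ + (1 ℕ.+ ∑ℕ.sum a) ℤ.≤ + a j ℤ.+ total (f j) u
    enough j = ℤP.≤-trans (ℤP.≤-reflexive (sym (ℤP.pos-+ (cost (f j) (back t)) _)))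
      (ℤP.≤-trans (ℤ.+≤+ (ℕP.+-monoˡ-≤ (1 ℕ.+ ∑ℕ.sum a) (ℕP.≤-trans (term≤∑ (backCost t) j) (term≤∑ (λ t → ∑ℕ.sum (backCost t)) t))))
                  (proj₂ (up j)))
    gain : ∀ j → + 1 ℤ.≤ total (f j) (u ++ back t)
    gain j = subst (+ 1 ℤ.≤_) (sym (total-++ (f j) u (back t)))
      (cancel {+ a j} {total (f j) u} {total (f j) (back t)} (ℤP.≤-trans (ℤP.≤-trans (ℤP.≤-reflexive (sym (ℤP.pos-+ 1 (a j)))) (ℤ.+≤+ (s≤s (term≤∑ a j)))) (total≥ (f j) _ _ (back t) (enough j))))
      where
      cancel : ∀ {x y z} → + 1 ℤ.+ x ℤ.≤ x ℤ.+ y ℤ.+ z → + 1 ℤ.≤ y ℤ.+ z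
      cancel {x} {y} {z} le = ℤP.≤-trans (ℤP.≤-reflexive (l₁ x)) (ℤP.≤-trans (ℤP.+-monoʳ-≤ (ℤ.- x) le) (ℤP.≤-reflexive (l₂ x y z)))
        where l₁ : ∀ x → + 1 ≡ ℤ.- x ℤ.+ (+ 1 ℤ.+ x)
              l₁ = solve-∀
              l₂ : ∀ x y z → ℤ.- x ℤ.+ (x ℤ.+ y ℤ.+ z) ≡ y ℤ.+ z
              l₂ = solve-∀

  -- Climbs of length at most `L` can be searched for. If there is none, then by `rackoff` no safe
  -- walk lets every counter reach `B`, even at different times, so along each safe walk some
  -- counter stays below.
  pump-or-confined : Pump ⊎ Confined
  pump-or-confined with Any.any? climbs? (words n L)
  ... | yes found with Any.satisfied found
  ... | u , cl = inj₁ (pump u cl)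
  pump-or-confined | no none = inj₂ (B , confined)
    where
    confined : ∀ u q → Path G p u q → (∀ j → Along NonNeg (f j) (+ a j) u) → ∃ λ j → Along (Within B) (f j) (+ a j) u
    confined u q pu sf with FinP.all? (λ j → ever? B (f j) (+ a j) u)
    ... | no ¬all with FinP.¬∀⟶∃¬ k _ (λ j → ever? B (f j) (+ a j) u) ¬all
    ... | j , never = j , never⇒Within (f j) _ u (sf j) never
    confined u q pu sf | yes ev with proj₂ (proj₂ (rackoff k f C)) p u q (λ j → + a j) pu sf ev
    ... | w , t , pw , le , sw , cw = ⊥-elim (none (Any.map (λ { refl → (t , pw) , λ j → sw j , cw j }) (words-complete L w le)))

-- Components and their refinements

-- The endpoints of the run in a component: inj₁ i is counter i at its entry, inj₂ i at its exit.
End : ℕ → Set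
End d = Fin d ⊎ Fin d

_≟ₑ_ : ∀ {d} (k l : End d) → Dec (k ≡ l)
_≟ₑ_ = SumP.≡-dec _≟_ _≟_

-- `glue` is the jump from the exit to the entry of the next component: after a walk has been cut at
-- an edge, the effect of that edge.
record Component (d : ℕ) : Set where
  field
    {#states #edges} : ℕ
    graph  : Graph #states #edges
    eff    : Fin d → Fin #edges → ℤ
    active : Fin d → Bool
    p q    : Fin #states
    mark   : End d → ℕω
    glue   : Fin d → ℤ
open Component public

_⊑_ : ℕ → ℕω → Set
n ⊑ nat a = n ≡ a
n ⊑ ω = ⊤

_⊑?_ : ∀ n x → Dec (n ⊑ x)
n ⊑? nat a = n ℕP.≟ a
n ⊑? ω = yes tt

-- A counter that is not active is encoded in the states, so a weak run, which need not keep it nonnegative, is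
-- what the pumping argument produces, while a decomposition loses no full run.
data Kind : Set where
  full weak : Kind

Guarded : ∀ {d} → Kind → (Fin d → Bool) → Fin d → Set
Guarded full active i = ⊤
Guarded weak active i = active i ≡ true

record Run {d} (σ : Kind) (C : Component d) (pt : End d → ℕ) : Set where
  field
    word   : List (Fin (#edges C))
    path   : Path (graph C) (p C) word (q C)
    safe   : ∀ i → Guarded σ (active C) i → Along NonNeg (eff C i) (+ pt (inj₁ i)) word
    effect : ∀ i → + pt (inj₂ i) ≡ + pt (inj₁ i) ℤ.+ total (eff C i) word
    marks  : ∀ k → pt k ⊑ mark C k
open Run public

ends : ∀ {d} → (Fin d → ℕ) → (Fin d → ℕ) → End d → ℕ
ends m n = case⊎ m n

Sol : ∀ {d} → Kind → List (Component d) → (m n : Fin d → ℕ) → Set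
Sol σ [] m n = m ≗ n
Sol {d} σ (C ∷ ξ) m n = Σ (Fin d → ℕ) λ n′ → Σ (Fin d → ℕ) λ m′ →
  Run σ C (ends m n′) × (∀ i → + m′ i ≡ + n′ i ℤ.+ glue C i) × Sol σ ξ m′ n

-- The priorities follow from the side effects: moving a counter into the states can multiply the
-- edges, cutting walks at an edge can create `ω` entries, and instantiating an `ω` leaves the other
-- two numbers alone.
Rank : Set
Rank = ℕ × ℕ × ℕ

_<₂_ : ℕ × ℕ → ℕ × ℕ → Set
_<₂_ = ×-Lex _≡_ ℕ._<_ ℕ._<_

_<ᵣ_ : Rank → Rank → Set
_<ᵣ_ = ×-Lex _≡_ ℕ._<_ _<₂_

indicator : Bool → ℕ
indicator true = 1
indicator false = 0

isω : ℕω → ℕ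
isω (nat _) = 0
isω ω = 1

#active : ∀ {d} → (Fin d → Bool) → ℕ
#active a = ∑ℕ.sum (λ i → indicator (a i))

#ω : ∀ {d} → (End d → ℕω) → ℕ
#ω mk = ∑ℕ.sum (λ i → isω (mk (inj₁ i))) ℕ.+ ∑ℕ.sum (λ i → isω (mk (inj₂ i)))

rank : ∀ {d} → Component d → Rank
rank C = #active (active C) , #edges C , #ω (mark C)

_<ᶜ_ : ∀ {d} → Component d → Component d → Set
_<ᶜ_ = _<ᵣ_ on rank

<ᶜ-wellFounded : ∀ {d} → WellFounded (_<ᶜ_ {d})
<ᶜ-wellFounded = On.wellFounded rank (×-wellFounded ℕI.<-wellFounded (×-wellFounded ℕI.<-wellFounded ℕI.<-wellFounded))

data _≺_ {d} : List (Component d) → List (Component d) → Set where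
  replace : ∀ {C Cs ξ} → All (_<ᶜ C) Cs → (Cs ++ ξ) ≺ (C ∷ ξ)
  skip    : ∀ {C ξ ξ′} → ξ′ ≺ ξ → (C ∷ ξ′) ≺ (C ∷ ξ)

-- Putting `C` in front preserves accessibility, by induction on `C` and, for fixed `C`, on the
-- rest: a replacement of `C` puts smaller components in front, one after another.
≺-wellFounded : ∀ {d} → WellFounded (_≺_ {d})
≺-wellFounded [] = acc λ ()
≺-wellFounded (C ∷ ξ) = cons C (<ᶜ-wellFounded C) (≺-wellFounded ξ)
  where
  Consable : _ → Set
  Consable C = ∀ {ξ} → Acc _≺_ ξ → Acc _≺_ (C ∷ ξ)
  appends : ∀ {Cs} → All Consable Cs → ∀ {ξ} → Acc _≺_ ξ → Acc _≺_ (Cs ++ ξ)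
  appends [] a = a
  appends (c ∷ cs) a = c (appends cs a)
  cons : ∀ C → Acc _<ᶜ_ C → Consable C
  cons C (acc rsC) = inner
    where
    below : ∀ {Cs} → All (_<ᶜ C) Cs → All Consable Cs
    below [] = []
    below (_∷_ {D} lt lts) = cons D (rsC lt) ∷ below lts
    inner : Consable C
    inner {ξ} a@(acc rs) = acc λ { (replace lts) → appends (below lts) a ; (skip lt) → inner (rs lt) }

-- `K` is what is known of the full runs, such as a bound: only runs with it have to be recovered,
-- whereas soundness is unconditional and speaks of weak runs. The remaining list `ξ` is quantified
-- because one component may become several.
record ComponentRefinement {d} (C : Component d) (K : ∀ pt → Run full C pt → Set) : Set where
  field
    parts    : List (List (Component d))
    smaller  : All (All (_<ᶜ C)) parts
    complete : ∀ ξ m n ((n′ , m′ , ρ , _) : Sol full (C ∷ ξ) m n) → K _ ρ → Any (λ Cs → Sol full (Cs ++ ξ) m n) parts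
    sound    : All (λ Cs → ∀ ξ m n → Sol weak (Cs ++ ξ) m n → Sol weak (C ∷ ξ) m n) parts

record Refinement {d} (ξ : List (Component d)) (K : ∀ m n → Sol full ξ m n → Set) : Set where
  field
    parts    : List (List (Component d))
    smaller  : All (_≺ ξ) parts
    complete : ∀ m n (ρ : Sol full ξ m n) → K m n ρ → Any (λ ξ′ → Sol full ξ′ m n) parts
    sound    : All (λ ξ′ → ∀ m n → Sol weak ξ′ m n → Sol weak ξ m n) parts

refine-head : ∀ {d} {C : Component d} {K} → ComponentRefinement C K → ∀ ξ →
  Refinement (C ∷ ξ) (λ m n (n′ , m′ , ρ , _) → K _ ρ)
refine-head R ξ = record
  { parts = map (_++ ξ) parts
  ; smaller = AllP.map⁺ (All.map replace smaller)
  ; complete = λ m n ρ k → AnyP.map⁺ (complete ξ m n ρ k)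
  ; sound = AllP.map⁺ (All.map (λ s → s ξ) sound) }
  where open ComponentRefinement R

refine-tail : ∀ {d} (C : Component d) {ξ K} → Refinement ξ K →
  Refinement (C ∷ ξ) (λ m n (n′ , m′ , _ , _ , ρ) → K m′ n ρ)
refine-tail C R = record
  { parts = map (C ∷_) parts
  ; smaller = AllP.map⁺ (All.map skip smaller)
  ; complete = λ { m n (n′ , m′ , ρ , gl , s) k → AnyP.map⁺ (Any.map (λ s′ → n′ , m′ , ρ , gl , s′) (complete m′ n s k)) }
  ; sound = AllP.map⁺ (All.map (λ { f m n (n′ , m′ , ρ , gl , s) → n′ , m′ , ρ , gl , f m′ n s }) sound) }
  where open Refinement R

-- The refinements: instantiating an endpoint, confining a counter, removing an edge

set : ∀ {d} → End d → ℕω → (End d → ℕω) → End d → ℕω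
set k x mk l with k ≟ₑ l
... | yes _ = x
... | no _ = mk l

set-⊑ : ∀ {d} {k : End d} {x mk} {pt : End d → ℕ} → pt k ⊑ x → (∀ l → pt l ⊑ mk l) → ∀ l → pt l ⊑ set k x mk l
set-⊑ {k = k} h hs l with k ≟ₑ l
... | yes refl = h
... | no _ = hs l

set-⊑⁻ : ∀ {d} {k : End d} {x mk} {pt : End d → ℕ} → (pt k ⊑ x → pt k ⊑ mk k) → (∀ l → pt l ⊑ set k x mk l) → ∀ l → pt l ⊑ mk l
set-⊑⁻ {k = k} {x} {mk} h hs l with k ≟ₑ l | hs l
... | yes refl | h′ = h h′
... | no _ | h′ = h′

set-same : ∀ {d} (k : End d) x mk → set k x mk k ≡ x
set-same k x mk with k ≟ₑ k
... | yes _ = refl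
... | no ¬p = ⊥-elim (¬p refl)

module Instantiate {d} (C : Component d) (k : End d) (kω : mark C k ≡ ω) (B : ℕ) where

  instance′ : Fin (suc B) → Component d
  instance′ b = record C { mark = set k (nat (toℕ b)) (mark C) }

  isω-set : ∀ a l → isω (set k (nat a) (mark C) l) ℕ.≤ isω (mark C l)
  isω-set a l with k ≟ₑ l
  ... | yes _ = z≤n
  ... | no _ = ℕP.≤-refl

  isω-set-at : ∀ a → isω (set k (nat a) (mark C) k) ℕ.< isω (mark C k)
  isω-set-at a rewrite set-same k (nat a) (mark C) | kω = s≤s z≤n

  fewer-ω : ∀ a → #ω (set k (nat a) (mark C)) ℕ.< #ω (mark C)
  fewer-ω a = at k (isω-set-at a)
    where
    at : ∀ l → isω (set k (nat a) (mark C) l) ℕ.< isω (mark C l) → #ω (set k (nat a) (mark C)) ℕ.< #ω (mark C)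
    at (inj₁ i) lt = ℕP.+-mono-<-≤ (∑-mono-< (λ i → isω-set a (inj₁ i)) i lt) (∑-mono-≤ (λ i → isω-set a (inj₂ i)))
    at (inj₂ i) lt = ℕP.+-mono-≤-< (∑-mono-≤ (λ i → isω-set a (inj₁ i))) (∑-mono-< (λ i → isω-set a (inj₂ i)) i lt)

  instantiate : ComponentRefinement C (λ pt _ → pt k ℕ.≤ B)
  instantiate = record
    { parts = map (λ b → [ instance′ b ]) (allFin (suc B))
    ; smaller = AllP.map⁺ (All.universal (λ b → inj₂ (refl , inj₂ (refl , fewer-ω (toℕ b))) ∷ []) (allFin (suc B)))
    ; complete = λ { ξ m n (n′ , m′ , ρ , gl , s) le → AnyP.map⁺ (Any.map
        (λ { refl → n′ , m′ , record { Run ρ ; marks = set-⊑ {k = k} {mk = mark C} (sym (FinP.toℕ-fromℕ< (s≤s le))) (marks ρ) } , gl , s })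
        (∈-allFin (fromℕ< (s≤s le)))) }
    ; sound = AllP.map⁺ (All.universal (λ { b ξ m n (n′ , m′ , ρ , gl , s) →
        n′ , m′ , record { word = word ρ ; path = path ρ ; safe = safe ρ ; effect = effect ρ
                          ; marks = set-⊑⁻ {k = k} {mk = mark C} (λ _ → subst (_ ⊑_) (sym kω) tt) (marks ρ) } , gl , s }) (allFin (suc B))) }

module Confine {d} (C : Component d) (i : Fin d) (act : active C i ≡ true) (B : ℕ) where

  open Fold (graph C) (eff C i) B

  inactivate : Fin d → Bool
  inactivate j with i ≟ j
  ... | yes _ = false
  ... | no _ = active C j

  -- Pinning the entry of `i` to `b` ties the states to the true value of `i`; the graph itself then
  -- keeps `i` in range, so `i` can cease to be active.
  confinedPart : Fin (suc B) → Fin (suc B) → Component d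
  confinedPart b b′ = record
    { graph = folded ; eff = λ j → eff C j ∘ orig ; active = inactivate
    ; p = combine (p C) b ; q = combine (q C) b′ ; mark = set (inj₁ i) (nat (toℕ b)) (mark C) ; glue = glue C }

  fewer-active : #active inactivate ℕ.< #active (active C)
  fewer-active = ∑-mono-< le i lt
    where
    le : ∀ j → indicator (inactivate j) ℕ.≤ indicator (active C j)
    le j with i ≟ j
    ... | yes _ = z≤n
    ... | no _ = ℕP.≤-refl
    lt : indicator (inactivate i) ℕ.< indicator (active C i)
    lt with i ≟ i
    ... | yes _ rewrite act = s≤s z≤n
    ... | no ¬p = ⊥-elim (¬p refl)

  -- Pinning overwrites the entry mark of `i`. Only values allowed by that mark may be pinned, or a
  -- run of the part would not be a run of `C`.
  Admissible : Fin (suc B) → Set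
  Admissible b = toℕ b ⊑ mark C (inj₁ i)

  entries : List (Fin (suc B))
  entries = filter (λ b → toℕ b ⊑? mark C (inj₁ i)) (allFin (suc B))

  pairs : List (Fin (suc B) × Fin (suc B))
  pairs = cartesianProduct entries (allFin (suc B))

  admissible : ∀ {x} → x ∈ pairs → Admissible (proj₁ x)
  admissible x∈ = proj₂ (∈-filter⁻ (λ b → toℕ b ⊑? mark C (inj₁ i)) {xs = allFin (suc B)} (proj₁ (∈-cartesianProduct⁻ entries (allFin (suc B)) x∈)))

  confined-sound : ∀ b b′ → Admissible b → ∀ pt → Run weak (confinedPart b b′) pt → Run weak C pt
  confined-sound b b′ adm pt ρ = record
    { word = map orig (word ρ)
    ; path = proj₁ projected
    ; safe = safe′
    ; effect = λ j → trans (effect ρ j) (cong (λ t → + pt (inj₁ j) ℤ.+ t) (sym (total-map (eff C j) orig (word ρ))))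
    ; marks = set-⊑⁻ {mk = mark C} (λ _ → subst (_⊑ mark C (inj₁ i)) (sym at-entry) adm) (marks ρ) }
    where
    projected = project (p C) (word ρ) (q C) b b′ (path ρ)
    at-entry : pt (inj₁ i) ≡ toℕ b
    at-entry = subst (pt (inj₁ i) ⊑_) (set-same (inj₁ i) (nat (toℕ b)) (mark C)) (marks ρ (inj₁ i))
    still-active : ∀ j → i ≢ j → active C j ≡ true → inactivate j ≡ true
    still-active j i≢j aj with i ≟ j
    ... | yes i≡j = ⊥-elim (i≢j i≡j)
    ... | no _ = aj
    safe′ : ∀ j → active C j ≡ true → Along NonNeg (eff C j) (+ pt (inj₁ j)) (map orig (word ρ))
    safe′ j aj with i ≟ j
    ... | yes refl = subst (λ t → Along NonNeg (eff C i) t (map orig (word ρ))) (cong +_ (sym at-entry))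
                       (Along-⇒ (eff C i) _ (map orig (word ρ)) Within⇒NonNeg (proj₁ (proj₂ projected)))
    ... | no i≢j = Along-map (eff C j) orig _ (word ρ) (safe ρ j (still-active j i≢j aj))

  confined-complete : ∀ pt (ρ : Run full C pt) → Along (Within B) (eff C i) (+ pt (inj₁ i)) (word ρ) →
    Any (λ (b , b′) → Run full (confinedPart b b′) pt) pairs
  confined-complete pt ρ al with Along-start (eff C i) _ (word ρ) al
  ... | b , eq with lift (p C) (word ρ) (q C) b (path ρ) (subst (λ t → Along (Within B) (eff C i) t (word ρ)) eq al)
  ... | u , b′ , path′ , word≡ , _ = Any.map (λ { refl → record
      { word = u ; path = path′
      ; safe = λ j g → Along-map⁻ (eff C j) orig _ u (subst (Along NonNeg (eff C j) _) (sym word≡) (safe ρ j g))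
      ; effect = λ j → trans (effect ρ j) (cong (λ t → + pt (inj₁ j) ℤ.+ t) (trans (cong (total (eff C j)) (sym word≡)) (total-map (eff C j) orig u)))
      ; marks = set-⊑ {mk = mark C} (ℤP.+-injective eq) (marks ρ) } })
      (∈-cartesianProduct⁺ (∈-filter⁺ (λ b → toℕ b ⊑? mark C (inj₁ i)) (∈-allFin b)
         (subst (_⊑ mark C (inj₁ i)) (ℤP.+-injective eq) (marks ρ (inj₁ i)))) (∈-allFin b′))

  confine : ComponentRefinement C (λ pt ρ → Along (Within B) (eff C i) (+ pt (inj₁ i)) (word ρ))
  confine = record
    { parts = map (λ (b , b′) → [ confinedPart b b′ ]) pairs
    ; smaller = AllP.map⁺ (All.universal (λ _ → inj₁ fewer-active ∷ []) pairs)
    ; complete = λ { ξ m n (n′ , m′ , ρ , gl , s) al → AnyP.map⁺ (Any.map (λ ρ′ → n′ , m′ , ρ′ , gl , s) (confined-complete _ ρ al)) }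
    ; sound = AllP.map⁺ (All.tabulate (λ { {b , b′} x∈ ξ m n (n′ , m′ , ρ , gl , s) →
        n′ , m′ , confined-sound b b′ (admissible x∈) _ ρ , gl , s })) }

first-use : ∀ {n} (e : Fin (suc n)) u → (∃ λ u′ → u ≡ map (punchIn e) u′) ⊎ (∃ λ u₁ → ∃ λ u₂ → u ≡ map (punchIn e) u₁ ++ e ∷ u₂)
first-use e [] = inj₁ ([] , refl)
first-use e (x ∷ u) with e ≟ x | first-use e u
... | yes refl | _ = inj₂ ([] , u , refl)
... | no e≢x | inj₁ (u′ , refl) = inj₁ (punchOut e≢x ∷ u′ , cong (_∷ map (punchIn e) u′) (sym (FinP.punchIn-punchOut e≢x)))
... | no e≢x | inj₂ (u₁ , u₂ , refl) = inj₂ (punchOut e≢x ∷ u₁ , u₂ , cong (_∷ map (punchIn e) u₁ ++ e ∷ u₂) (sym (FinP.punchIn-punchOut e≢x)))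

Path-delete : ∀ {r n} (G : Graph r (suc n)) e {s} u {q} → Path G s (map (punchIn e) u) q → Path (delete G e) s u q
Path-delete G e [] p = p
Path-delete G e (x ∷ u) (eq , p) = eq , Path-delete G e u p

-- A walk is cut at an unknown vector, so both sides of the cut are free; `glue` alone links them.
openEntry openExit : ∀ {d} → (End d → ℕω) → End d → ℕω
openEntry mk (inj₁ i) = ω
openEntry mk (inj₂ i) = mk (inj₂ i)
openExit mk (inj₁ i) = mk (inj₁ i)
openExit mk (inj₂ i) = ω

module Unuse {d r n} (G : Graph r (suc n)) (f : Fin d → Fin (suc n) → ℤ) (act : Fin d → Bool) (final : Fin r)
             (gl : Fin d → ℤ) (e : Fin (suc n)) where

  whole : Fin r → (End d → ℕω) → Component d
  whole p mk = record { graph = G ; eff = f ; active = act ; p = p ; q = final ; mark = mk ; glue = gl }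

  without : Fin r → Fin r → (End d → ℕω) → (Fin d → ℤ) → Component d
  without p q mk g = record { graph = delete G e ; eff = λ i → f i ∘ punchIn e ; active = act ; p = p ; q = q ; mark = mk ; glue = g }

  pre : Fin r → (End d → ℕω) → Component d
  pre p mk = without p (src G e) (openExit mk) (λ i → f i e)

  -- A walk with at most `B` uses of `e` either avoids `e` or splits at the first use into a walk
  -- without `e` and one with fewer uses.
  slices : ℕ → Fin r → (End d → ℕω) → List (List (Component d))
  slices zero p mk = [ without p final mk gl ] ∷ []
  slices (suc B) p mk = [ without p final mk gl ] ∷ map (pre p mk ∷_) (slices B (tgt G e) (openEntry mk))

  slices-smaller : ∀ p₀ mk₀ B p mk → All (All (_<ᶜ whole p₀ mk₀)) (slices B p mk)
  slices-smaller p₀ mk₀ zero p mk = (inj₂ (refl , inj₁ ℕP.≤-refl) ∷ []) ∷ []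
  slices-smaller p₀ mk₀ (suc B) p mk = (inj₂ (refl , inj₁ ℕP.≤-refl) ∷ []) ∷
    AllP.map⁺ (All.map (λ lts → inj₂ (refl , inj₁ ℕP.≤-refl) ∷ lts) (slices-smaller p₀ mk₀ B (tgt G e) (openEntry mk)))

  slices-sound : ∀ B p mk → All (λ Cs → ∀ ξ m n → Sol weak (Cs ++ ξ) m n → Sol weak (whole p mk ∷ ξ) m n) (slices B p mk)
  slices-sound = go
    where
    direct : ∀ p mk ξ m n → Sol weak (without p final mk gl ∷ ξ) m n → Sol weak (whole p mk ∷ ξ) m n
    direct p mk ξ m n (n′ , m′ , ρ , glue′ , s) = n′ , m′ , record
      { word = map (punchIn e) (word ρ)
      ; path = Path-undelete G e (word ρ) (path ρ)
      ; safe = λ i g → Along-map (f i) (punchIn e) _ (word ρ) (safe ρ i g)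
      ; effect = λ i → trans (effect ρ i) (cong (λ t → + m i ℤ.+ t) (sym (total-map (f i) (punchIn e) (word ρ))))
      ; marks = marks ρ } , glue′ , s
    glued : ∀ p mk Cs → (∀ ξ m n → Sol weak (Cs ++ ξ) m n → Sol weak (whole (tgt G e) (openEntry mk) ∷ ξ) m n) →
      ∀ ξ m n → Sol weak (pre p mk ∷ Cs ++ ξ) m n → Sol weak (whole p mk ∷ ξ) m n
    glued p mk Cs rec ξ m n (n₁ , m₁ , ρ₁ , g₁ , s₁) with rec ξ m₁ n s₁
    ... | n₂ , m₂ , ρ₂ , g₂ , s₂ = n₂ , m₂ , record
      { word = w₁ ++ e ∷ word ρ₂
      ; path = Path-++ G w₁ (Path-undelete G e (word ρ₁) (path ρ₁)) (refl , path ρ₂)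
      ; safe = λ i g → Along-++ (f i) _ w₁ (e ∷ word ρ₂) (Along-map (f i) (punchIn e) _ (word ρ₁) (safe ρ₁ i g))
          (subst (λ t → NonNeg t × Along NonNeg (f i) (t ℤ.+ f i e) (word ρ₂)) (after₁ i)
             -- Just before `e` the value is that of the exit of the first run, a natural number.
             (ℤ.+≤+ z≤n , subst (λ t → Along NonNeg (f i) t (word ρ₂)) (g₁ i) (safe ρ₂ i g)))
      ; effect = λ i → trans (effect ρ₂ i) (trans (cong (ℤ._+ total (f i) (word ρ₂)) (trans (g₁ i) (cong (ℤ._+ f i e) (after₁ i))))
          (trans (assoc (+ m i) (total (f i) w₁) (f i e) (total (f i) (word ρ₂))) (cong (λ t → + m i ℤ.+ t) (sym (total-++ (f i) w₁ (e ∷ word ρ₂))))))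
      ; marks = λ { (inj₁ i) → marks ρ₁ (inj₁ i) ; (inj₂ i) → marks ρ₂ (inj₂ i) } } , g₂ , s₂
      where
      w₁ = map (punchIn e) (word ρ₁)
      after₁ : ∀ i → + n₁ i ≡ + m i ℤ.+ total (f i) w₁
      after₁ i = trans (effect ρ₁ i) (cong (λ t → + m i ℤ.+ t) (sym (total-map (f i) (punchIn e) (word ρ₁))))
      assoc : ∀ a b c d → a ℤ.+ b ℤ.+ c ℤ.+ d ≡ a ℤ.+ (b ℤ.+ (c ℤ.+ d))
      assoc = solve-∀
    go : ∀ B p mk → All (λ Cs → ∀ ξ m n → Sol weak (Cs ++ ξ) m n → Sol weak (whole p mk ∷ ξ) m n) (slices B p mk)
    go zero p mk = direct p mk ∷ []
    go (suc B) p mk = direct p mk ∷ AllP.map⁺ (All.map (λ {Cs} → glued p mk Cs) (go B (tgt G e) (openEntry mk)))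

  slices-complete : ∀ B p mk ξ m n ((n′ , m′ , ρ , _) : Sol full (whole p mk ∷ ξ) m n) → parikh (word ρ) e ℕ.≤ B →
    Any (λ Cs → Sol full (Cs ++ ξ) m n) (slices B p mk)
  slices-complete B p mk ξ m n (n′ , m′ , ρ , glue′ , s) le with word ρ | path ρ | safe ρ | effect ρ | first-use e (word ρ)
  ... | .(map (punchIn e) u) | pth | sf | ef | inj₁ (u , refl) = head-slice B
    where
    unused : Sol full (without p final mk gl ∷ ξ) m n
    unused = n′ , m′ , record
      { word = u ; path = Path-delete G e u pth
      ; safe = λ i g → Along-map⁻ (f i) (punchIn e) _ u (sf i g)
      ; effect = λ i → trans (ef i) (cong (λ t → + m i ℤ.+ t) (total-map (f i) (punchIn e) u))
      ; marks = marks ρ } , glue′ , s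
    head-slice : ∀ B → Any (λ Cs → Sol full (Cs ++ ξ) m n) (slices B p mk)
    head-slice zero = here unused
    head-slice (suc B) = here unused
  ... | .(map (punchIn e) u₁ ++ e ∷ u₂) | pth | sf | ef | inj₂ (u₁ , u₂ , refl) = later B le
    where
    w₁ = map (punchIn e) u₁
    splitting = Path-split G w₁ pth
    n₁ m₁ : Fin d → ℕ
    -- The absolute values change nothing: a full run keeps all counters nonnegative at the cut,
    -- encoded ones included.
    n₁ i = ∣ + m i ℤ.+ total (f i) w₁ ∣
    m₁ i = ∣ + m i ℤ.+ total (f i) w₁ ℤ.+ f i e ∣
    cuts : ∀ i → Along NonNeg (f i) (+ m i) w₁ × Along NonNeg (f i) (+ m i ℤ.+ total (f i) w₁) (e ∷ u₂)
    cuts i = Along-++⁻ (f i) _ w₁ (e ∷ u₂) (sf i tt)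
    n₁≡ : ∀ i → + n₁ i ≡ + m i ℤ.+ total (f i) w₁
    n₁≡ i = ℤP.0≤i⇒+∣i∣≡i (proj₁ (proj₂ (cuts i)))
    m₁≡ : ∀ i → + m₁ i ≡ + m i ℤ.+ total (f i) w₁ ℤ.+ f i e
    m₁≡ i = ℤP.0≤i⇒+∣i∣≡i (Along-start (f i) _ u₂ (proj₂ (proj₂ (cuts i))))
    before : Run full (pre p mk) (ends m n₁)
    before = record
      { word = u₁ ; path = subst (Path (delete G e) p u₁) (sym (proj₁ (proj₂ (proj₂ splitting)))) (Path-delete G e u₁ (proj₁ (proj₂ splitting)))
      ; safe = λ i _ → Along-map⁻ (f i) (punchIn e) _ u₁ (proj₁ (cuts i))
      ; effect = λ i → trans (n₁≡ i) (cong (λ t → + m i ℤ.+ t) (total-map (f i) (punchIn e) u₁))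
      ; marks = λ { (inj₁ i) → marks ρ (inj₁ i) ; (inj₂ i) → tt } }
    rest : Run full (whole (tgt G e) (openEntry mk)) (ends m₁ n′)
    rest = record
      { word = u₂ ; path = proj₂ (proj₂ (proj₂ splitting))
      ; safe = λ i _ → subst (λ t → Along NonNeg (f i) t u₂) (sym (m₁≡ i)) (proj₂ (proj₂ (cuts i)))
      ; effect = λ i → trans (ef i) (trans (cong (λ t → + m i ℤ.+ t) (total-++ (f i) w₁ (e ∷ u₂)))
          (trans (assoc (+ m i) (total (f i) w₁) (f i e) (total (f i) u₂)) (cong (ℤ._+ total (f i) u₂) (sym (m₁≡ i)))))
      ; marks = λ { (inj₁ i) → tt ; (inj₂ i) → marks ρ (inj₂ i) } }
      where assoc : ∀ a b c d → a ℤ.+ (b ℤ.+ (c ℤ.+ d)) ≡ a ℤ.+ b ℤ.+ c ℤ.+ d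
            assoc = solve-∀
    count : parikh (w₁ ++ e ∷ u₂) e ≡ parikh w₁ e ℕ.+ suc (parikh u₂ e)
    count = trans (parikh-++ w₁ (e ∷ u₂) e) (cong (λ t → parikh w₁ e ℕ.+ (t ℕ.+ parikh u₂ e)) (δ-same e))
    later : ∀ B → parikh (w₁ ++ e ∷ u₂) e ℕ.≤ B → Any (λ Cs → Sol full (Cs ++ ξ) m n) (slices B p mk)
    later B le with subst (ℕ._≤ B) count le
    ... | le′ with ℕP.≤-trans (ℕP.m≤n+m (suc (parikh u₂ e)) (parikh w₁ e)) le′
    ... | s≤s le″ = there (AnyP.map⁺ (Any.map (λ sol → n₁ , m₁ , before , (λ i → trans (m₁≡ i) (cong (ℤ._+ f i e) (sym (n₁≡ i)))) , sol)
                       (slices-complete _ (tgt G e) (openEntry mk) ξ m₁ n (n′ , m′ , rest , glue′ , s) le″)))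

unuse : ∀ {d} (C : Component d) (e : Fin (#edges C)) B → ComponentRefinement C (λ pt ρ → parikh (word ρ) e ℕ.≤ B)
unuse record { #edges = suc n ; graph = G ; eff = f ; active = act ; p = p ; q = q ; mark = mk ; glue = gl } e B = record
  { parts = slices B p mk ; smaller = slices-smaller p mk B p mk ; complete = slices-complete B p mk ; sound = slices-sound B p mk }
  where open Unuse G f act q gl e

-- The characteristic system

at : ∀ {V : Set} → V → Functional V
at v = record { fn = λ z → + z v ; ext = λ eq → cong +_ (eq v) ; zer = refl ; add = λ z z′ → ℤP.pos-+ (z v) (z′ v) }

null : ∀ {V : Set} → Functional V
null = record { fn = λ _ → + 0 ; ext = λ _ → refl ; zer = refl ; add = λ _ _ → refl }

weigh : ∀ {V : Set} {n} → (Fin n → V) → (Fin n → ℤ) → Functional V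
weigh ι w = record
  { fn = λ z → dot (z ∘ ι) w ; ext = λ eq → dot-congˡ w (eq ∘ ι) ; zer = dot-𝟘 w ; add = λ z z′ → dot-⊕ (z ∘ ι) (z′ ∘ ι) w }

_⊖_ : ∀ {V : Set} → Functional V → Functional V → Functional V
f ⊖ g = record
  { fn = λ z → fn f z ℤ.- fn g z ; ext = λ eq → cong₂ ℤ._-_ (ext f eq) (ext g eq) ; zer = cong₂ ℤ._-_ (zer f) (zer g)
  ; add = λ z z′ → trans (cong₂ ℤ._-_ (add f z z′) (add g z z′)) (regroup (fn f z) (fn f z′) (fn g z) (fn g z′)) }
  where regroup : ∀ a b c d → (a ℤ.+ b) ℤ.- (c ℤ.+ d) ≡ (a ℤ.- c) ℤ.+ (b ℤ.- d)
        regroup = solve-∀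

along-ι : ∀ {V W : Set} → (V → W) → Functional V → Functional W
along-ι ι f = record { fn = λ z → fn f (z ∘ ι) ; ext = λ eq → ext f (eq ∘ ι) ; zer = zer f ; add = λ z z′ → add f (z ∘ ι) (z′ ∘ ι) }

-- The unknowns of the characteristic system: the endpoints of every component run, the number of uses of every edge,
-- and the final vector.
Var : ∀ {d} → List (Component d) → Set
Var {d} [] = Fin d
Var {d} (C ∷ ξ) = (End d ⊎ Fin (#edges C)) ⊎ Var ξ

pattern endVar k = inj₁ (inj₁ k)
pattern edgeVar e = inj₁ (inj₂ e)

startVar finalVar : ∀ {d} (ξ : List (Component d)) → Fin d → Var ξ
startVar [] i = i
startVar (C ∷ ξ) i = endVar (inj₁ i)
finalVar [] i = i
finalVar (C ∷ ξ) i = inj₂ (finalVar ξ i)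

Fin-finite : ∀ n → Finite (Fin n)
Fin-finite n = record { size = n ; index = λ i → i ; elem = λ i → i ; elem-index = λ _ → refl }

⊎-finite : ∀ {V W} → Finite V → Finite W → Finite (V ⊎ W)
⊎-finite fV fW = record
  { size = size fV ℕ.+ size fW
  ; index = λ v → join (size fV) (size fW) (⊎.map (index fV) (index fW) v)
  ; elem = λ k → ⊎.map (elem fV) (elem fW) (splitAt (size fV) k)
  ; elem-index = λ v → trans (cong (⊎.map (elem fV) (elem fW)) (FinP.splitAt-join (size fV) (size fW) (⊎.map (index fV) (index fW) v))) (back v) }
  where
  open Finite
  back : ∀ v → ⊎.map (elem fV) (elem fW) (⊎.map (index fV) (index fW) v) ≡ v
  back (inj₁ v) = cong inj₁ (elem-index fV v)
  back (inj₂ w) = cong inj₂ (elem-index fW w)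

Var-finite : ∀ {d} (ξ : List (Component d)) → Finite (Var ξ)
Var-finite {d} [] = Fin-finite d
Var-finite {d} (C ∷ ξ) = ⊎-finite (⊎-finite (⊎-finite (Fin-finite d) (Fin-finite d)) (Fin-finite (#edges C))) (Var-finite ξ)

Equation : Set → Set
Equation V = Functional V × ℤ

markEq′ : ∀ {V : Set} → V → ℕω → Equation V
markEq′ v (nat a) = at v , + a
-- A trivial equation, so that there is one for every endpoint and `system` consists of plain
-- tabulations.
markEq′ v ω = null , + 0

module _ {d} (C : Component d) (ξ : List (Component d)) where

  markEq : End d → Equation (Var (C ∷ ξ))
  markEq k = markEq′ (endVar k) (mark C k)

  effectEq : Fin d → Equation (Var (C ∷ ξ))
  effectEq i = (at (endVar (inj₂ i)) ⊖ at (endVar (inj₁ i))) ⊖ weigh (λ e → edgeVar e) (eff C i) , + 0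

  flowEq : Fin (#states C) → Equation (Var (C ∷ ξ))
  flowEq t = weigh (λ e → edgeVar e) (κ (graph C) t) , + [ p C ≟ t ]? ℤ.- + [ q C ≟ t ]?

  glueEq : Fin d → Equation (Var (C ∷ ξ))
  glueEq i = at (inj₂ (startVar ξ i)) ⊖ at (endVar (inj₂ i)) , glue C i

  tailEq : Equation (Var ξ) → Equation (Var (C ∷ ξ))
  tailEq (f , c) = along-ι inj₂ f , c

system : ∀ {d} (ξ : List (Component d)) → System (Var ξ)
system [] = []
system (C ∷ ξ) = tabulate (markEq C ξ ∘ inj₁) ++ tabulate (markEq C ξ ∘ inj₂) ++ tabulate (effectEq C ξ)
  ++ tabulate (flowEq C ξ) ++ tabulate (glueEq C ξ) ++ map (tailEq C ξ) (system ξ)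

module _ {d} {C : Component d} {ξ : List (Component d)} {P : Equation (Var (C ∷ ξ)) → Set} where

  system⁺ : (∀ k → P (markEq C ξ k)) → (∀ i → P (effectEq C ξ i)) → (∀ t → P (flowEq C ξ t)) → (∀ i → P (glueEq C ξ i)) →
    All (P ∘ tailEq C ξ) (system ξ) → All P (system (C ∷ ξ))
  system⁺ m e f g t = AllP.++⁺ (AllP.tabulate⁺ (m ∘ inj₁)) (AllP.++⁺ (AllP.tabulate⁺ (m ∘ inj₂)) (AllP.++⁺ (AllP.tabulate⁺ e)
    (AllP.++⁺ (AllP.tabulate⁺ f) (AllP.++⁺ (AllP.tabulate⁺ g) (AllP.map⁺ t)))))

  system⁻ : All P (system (C ∷ ξ)) → (∀ k → P (markEq C ξ k)) × (∀ i → P (effectEq C ξ i)) × (∀ t → P (flowEq C ξ t)) ×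
    (∀ i → P (glueEq C ξ i)) × All (P ∘ tailEq C ξ) (system ξ)
  system⁻ a with AllP.++⁻ _ a
  ... | m₁ , a₁ with AllP.++⁻ _ a₁
  ... | m₂ , a₂ with AllP.++⁻ _ a₂
  ... | e , a₃ with AllP.++⁻ _ a₃
  ... | f , a₄ with AllP.++⁻ _ a₄
  ... | g , t = (λ { (inj₁ i) → AllP.tabulate⁻ m₁ i ; (inj₂ i) → AllP.tabulate⁻ m₂ i }) , AllP.tabulate⁻ e , AllP.tabulate⁻ f , AllP.tabulate⁻ g , AllP.map⁻ t

Effect : ∀ {d} (C : Component d) → (End d → ℕ) → (Fin (#edges C) → ℕ) → Set
Effect C pt φ = ∀ i → + pt (inj₂ i) ≡ + pt (inj₁ i) ℤ.+ dot φ (eff C i)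

record Solves {d} (C : Component d) (pt : End d → ℕ) (φ : Fin (#edges C) → ℕ) (next : Fin d → ℕ) : Set where
  field
    marked   : ∀ k → pt k ⊑ mark C k
    effects  : Effect C pt φ
    flow     : Flow (graph C) (p C) (q C) φ
    glued    : ∀ i → + next i ≡ + pt (inj₂ i) ℤ.+ glue C i

record SolvesHom {d} (C : Component d) (pt : End d → ℕ) (φ : Fin (#edges C) → ℕ) (next : Fin d → ℕ) : Set where
  field
    marked   : ∀ k {a} → mark C k ≡ nat a → pt k ≡ 0
    effects  : Effect C pt φ
    circ     : Circulation (graph C) φ
    glued    : ∀ i → next i ≡ pt (inj₂ i)

endsOf : ∀ {d} {C : Component d} {ξ} → (Var (C ∷ ξ) → ℕ) → End d → ℕ
endsOf z k = z (endVar k)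

edgesOf : ∀ {d} {C : Component d} {ξ} → (Var (C ∷ ξ) → ℕ) → Fin (#edges C) → ℕ
edgesOf z e = z (edgeVar e)

tailOf : ∀ {d} {C : Component d} {ξ} → (Var (C ∷ ξ) → ℕ) → Var ξ → ℕ
tailOf z v = z (inj₂ v)

module _ {d} (C : Component d) (ξ : List (Component d)) (z : Var (C ∷ ξ) → ℕ) where

  private
    next : Fin d → ℕ
    next i = z (inj₂ (startVar ξ i))
    shift : ∀ n m t → n ≡ (n ℤ.- m ℤ.- t) ℤ.+ (m ℤ.+ t)
    shift = solve-∀
    unshift : ∀ m t → (m ℤ.+ t) ℤ.- m ℤ.- t ≡ + 0
    unshift = solve-∀
    glue⁻ : ∀ x y → x ≡ y ℤ.+ (x ℤ.- y)
    glue⁻ = solve-∀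
    glue⁺ : ∀ y g → (y ℤ.+ g) ℤ.- y ≡ g
    glue⁺ = solve-∀
    effect⁻ : ∀ i → fn (proj₁ (effectEq C ξ i)) z ≡ + 0 → + z (endVar (inj₂ i)) ≡ + z (endVar (inj₁ i)) ℤ.+ dot (edgesOf {C = C} {ξ} z) (eff C i)
    effect⁻ i eq = trans (shift _ (+ z (endVar (inj₁ i))) (dot (edgesOf {C = C} {ξ} z) (eff C i)))
      (trans (cong (ℤ._+ (+ z (endVar (inj₁ i)) ℤ.+ dot (edgesOf {C = C} {ξ} z) (eff C i))) eq) (ℤP.+-identityˡ _))

  satisfies⁻ : Satisfies (system (C ∷ ξ)) z → Solves C (endsOf {C = C} {ξ} z) (edgesOf {C = C} {ξ} z) next × Satisfies (system ξ) (tailOf {C = C} {ξ} z)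
  satisfies⁻ sat with system⁻ {C = C} {ξ} {P = λ (f , c) → fn f z ≡ c} sat
  ... | m , e , f , g , t = record
    { marked = λ k → marked k (m k)
    ; effects = λ i → effect⁻ i (e i)
    ; flow = f
    ; glued = λ i → trans (glue⁻ (+ next i) (+ z (endVar (inj₂ i)))) (cong (λ t → + z (endVar (inj₂ i)) ℤ.+ t) (g i)) } , t
    where
    marked : ∀ k → fn (proj₁ (markEq C ξ k)) z ≡ proj₂ (markEq C ξ k) → z (endVar k) ⊑ mark C k
    marked k eq with mark C k
    ... | nat a = ℤP.+-injective eq
    ... | ω = tt

  homogeneous⁻ : Homogeneous (system (C ∷ ξ)) z → SolvesHom C (endsOf {C = C} {ξ} z) (edgesOf {C = C} {ξ} z) next × Homogeneous (system ξ) (tailOf {C = C} {ξ} z)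
  homogeneous⁻ sat with system⁻ {C = C} {ξ} {P = λ (f , c) → fn f z ≡ + 0} sat
  ... | m , e , f , g , t = record
    { marked = λ k → marked k (m k)
    ; effects = λ i → effect⁻ i (e i)
    ; circ = f
    ; glued = λ i → ℤP.+-injective (trans (glue⁻ (+ next i) (+ z (endVar (inj₂ i)))) (trans (cong (λ t → + z (endVar (inj₂ i)) ℤ.+ t) (g i)) (ℤP.+-identityʳ _))) } , t
    where
    marked : ∀ k → fn (proj₁ (markEq C ξ k)) z ≡ + 0 → ∀ {a} → mark C k ≡ nat a → z (endVar k) ≡ 0
    marked k eq {a} mk rewrite mk = ℤP.+-injective eq

  satisfies⁺ : Solves C (endsOf {C = C} {ξ} z) (edgesOf {C = C} {ξ} z) next → Satisfies (system ξ) (tailOf {C = C} {ξ} z) → Satisfies (system (C ∷ ξ)) z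
  satisfies⁺ s t = system⁺ {C = C} {ξ} {P = λ (f , c) → fn f z ≡ c} marked′
    (λ i → trans (cong (λ x → x ℤ.- + z (endVar (inj₁ i)) ℤ.- dot (edgesOf {C = C} {ξ} z) (eff C i)) (effects i)) (unshift (+ z (endVar (inj₁ i))) (dot (edgesOf {C = C} {ξ} z) (eff C i)))) flow
    (λ i → trans (cong (ℤ._- + z (endVar (inj₂ i))) (glued i)) (glue⁺ (+ z (endVar (inj₂ i))) (glue C i))) t
    where
    open Solves s
    marked′ : ∀ k → fn (proj₁ (markEq C ξ k)) z ≡ proj₂ (markEq C ξ k)
    marked′ k with mark C k | marked k
    ... | nat a | eq = cong +_ eq
    ... | ω | _ = refl

val : ∀ {d σ} (ξ : List (Component d)) m n → Sol σ ξ m n → Var ξ → ℕ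
val [] m n _ i = n i
val (C ∷ ξ) m n (n′ , m′ , ρ , _ , s) = case⊎ (case⊎ (ends m n′) (parikh (word ρ))) (val ξ m′ n s)

val-start : ∀ {d σ} (ξ : List (Component d)) m n (s : Sol σ ξ m n) i → val ξ m n s (startVar ξ i) ≡ m i
val-start [] m n eq i = sym (eq i)
val-start (C ∷ ξ) m n _ i = refl

val-final : ∀ {d σ} (ξ : List (Component d)) m n (s : Sol σ ξ m n) i → val ξ m n s (finalVar ξ i) ≡ n i
val-final [] m n _ i = refl
val-final (C ∷ ξ) m n (n′ , m′ , _ , _ , s) i = val-final ξ m′ n s i

val-satisfies : ∀ {d σ} (ξ : List (Component d)) m n (s : Sol σ ξ m n) → Satisfies (system ξ) (val ξ m n s)
val-satisfies [] m n s = []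
val-satisfies (C ∷ ξ) m n sol@(n′ , m′ , ρ , gl , s) = satisfies⁺ C ξ (val (C ∷ ξ) m n sol) (record
  { marked = marks ρ
  ; effects = λ i → trans (effect ρ i) (cong (λ t → + m i ℤ.+ t) (sym (dot-parikh (word ρ) (eff C i))))
  ; flow = path-flow (graph C) (word ρ) (path ρ)
  ; glued = λ i → trans (cong +_ (val-start ξ m′ n s i)) (gl i) }) (val-satisfies ξ m′ n s)

-- The unknowns for which a bound yields a refinement. The final vector is left out: a bound on a
-- required coordinate of it already answers the question.
Relevant : ∀ {d} (ξ : List (Component d)) → Var ξ → Set
Relevant [] v = ⊥
Relevant (C ∷ ξ) (endVar k) = mark C k ≡ ω
Relevant (C ∷ ξ) (edgeVar e) = ⊤
Relevant (C ∷ ξ) (inj₂ v) = Relevant ξ v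

relevant? : ∀ {d} (ξ : List (Component d)) v → Dec (Relevant ξ v)
relevant? [] v = no λ ()
relevant? (C ∷ ξ) (endVar k) with mark C k
... | nat _ = no λ ()
... | ω = yes refl
relevant? (C ∷ ξ) (edgeVar e) = yes tt
relevant? (C ∷ ξ) (inj₂ v) = relevant? ξ v

refine-bounded : ∀ {d} (ξ : List (Component d)) v → Relevant ξ v → ∀ B → Refinement ξ (λ m n ρ → val ξ m n ρ v ℕ.≤ B)
refine-bounded (C ∷ ξ) (endVar k) rel B = refine-head (Instantiate.instantiate C k rel B) ξ
refine-bounded (C ∷ ξ) (edgeVar e) rel B = refine-head (unuse C e B) ξ
refine-bounded (C ∷ ξ) (inj₂ v) rel B = refine-tail C (refine-bounded ξ v rel B)

-- Pumping

weaken : ∀ {d} {C : Component d} {K K′ : ∀ pt → Run full C pt → Set} → (∀ pt ρ → K′ pt ρ → K pt ρ) →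
  ComponentRefinement C K → ComponentRefinement C K′
weaken imp R = record { ComponentRefinement R ; complete = λ ξ m n s k → complete ξ m n s (imp _ _ k) }
  where open ComponentRefinement R

union : ∀ {d} {C : Component d} {k} {K : Fin k → ∀ pt → Run full C pt → Set} → (∀ j → ComponentRefinement C (K j)) →
  ComponentRefinement C (λ pt ρ → ∃ λ j → K j pt ρ)
union {k = k} R = record
  { parts = concatMap (parts ∘ R) (allFin k)
  ; smaller = AllP.concat⁺ (AllP.map⁺ (All.universal (λ j → smaller (R j)) (allFin k)))
  ; complete = λ { ξ m n s (j , h) → AnyP.concat⁺ (AnyP.map⁺ (Any.map (λ { refl → complete (R j) ξ m n s h }) (∈-allFin j))) }
  ; sound = AllP.concat⁺ (AllP.map⁺ (All.universal (λ j → sound (R j)) (allFin k))) }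
  where open ComponentRefinement

Along-cong : ∀ {n} {P : ℤ → Set} {f g : Fin n → ℤ} {z z′} u → f ≗ g → z ≡ z′ → Along P f z u → Along P g z′ u
Along-cong {P = P} [] eq refl p = p
Along-cong {P = P} {g = g} {z} (e ∷ u) eq refl (p , a) = p , Along-cong u eq (cong (λ t → z ℤ.+ t) (eq e)) a

negate : ∀ {n} → (Fin n → ℤ) → Fin n → ℤ
negate f e = ℤ.- f e

-- K is the amount of an unbounded counter that is put in before, or taken out after, every turn of the pumping cycle u.
record Boost {n} (f : Fin n → ℤ) (x : ℕ) (K : ℕ) (u : List (Fin n)) : Set where
  field
    safe-turn : Along NonNeg f (+ x ℤ.+ + K) u
    gain      : + 1 ℤ.≤ + K ℤ.+ total f u

nonneg-* : ∀ r {x} → + 0 ℤ.≤ x → + 0 ℤ.≤ + r ℤ.* x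
nonneg-* r {+ n} _ = subst (+ 0 ℤ.≤_) (ℤP.pos-* r n) (ℤ.+≤+ z≤n)

1≤⇒0≤ : ∀ {x} → + 1 ℤ.≤ x → + 0 ℤ.≤ x
1≤⇒0≤ = ℤP.≤-trans (ℤ.+≤+ z≤n)

nonneg-+ : ∀ {x y} → + 0 ℤ.≤ x → + 0 ℤ.≤ y → + 0 ℤ.≤ x ℤ.+ y
nonneg-+ p q = ℤP.+-mono-≤ p q

raise : ∀ {n} (f : Fin n → ℤ) {z z′} k u → + 0 ℤ.≤ k → z′ ≡ z ℤ.+ k → Along NonNeg f z u → Along NonNeg f z′ u
raise f k u 0≤k refl al = Along-shift f k _ u (λ _ p → nonneg-+ p 0≤k) al

-- All copies of `K` are present from the start. A turn is safe with one of them, and `gain` ensures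
-- that the remaining turns start no lower than in the induction hypothesis.
pump-up : ∀ {n} {f : Fin n → ℤ} {x K u} → Boost f x K u → ∀ r → Along NonNeg f (+ x ℤ.+ + r ℤ.* + K) (iterate r u)
pump-up {f = f} {x} {K} {u} b zero = ℤ.+≤+ z≤n
pump-up {f = f} {x} {K} {u} b (suc r) = Along-++ f _ u (iterate r u)
  (raise f (+ r ℤ.* + K) u (nonneg-* r (ℤ.+≤+ z≤n)) (trans (cong (λ t → + x ℤ.+ t) (suc* r (+ K))) (sym (ℤP.+-assoc (+ x) (+ K) (+ r ℤ.* + K)))) safe-turn)
  (raise f (+ K ℤ.+ total f u) (iterate r u) (1≤⇒0≤ gain)
    (trans (cong (λ t → + x ℤ.+ t ℤ.+ total f u) (suc* r (+ K))) (lem (+ x) (+ K) (+ r ℤ.* + K) (total f u))) (pump-up b r))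
  where
  open Boost b
  lem : ∀ x k rk t → x ℤ.+ (k ℤ.+ rk) ℤ.+ t ≡ x ℤ.+ rk ℤ.+ (k ℤ.+ t)
  lem = solve-∀

-- The mirror image of `pump-up`, with `u` a cycle against the direction of the run: the starting
-- value is the one from which `r` turns of the reversed word arrive at `x` plus `r` times `K`.
pump-down : ∀ {n} {f : Fin n → ℤ} {x K u} → Boost (negate f) x K u → ∀ r →
  Along NonNeg f (+ x ℤ.+ + r ℤ.* (+ K ℤ.- total f (reverse u))) (iterate r (reverse u))
pump-down {f = f} {x} {K} {u} b r = go r
  where
  open Boost b
  v = reverse u
  g = + K ℤ.- total f v
  dv : total (negate f) u ≡ ℤ.- total f v
  dv = trans (total-neg f u) (cong ℤ.-_ (sym (total-reverse f u)))
  turn : Along NonNeg f (+ x ℤ.+ + K ℤ.- total f v) v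
  turn = Along-cong v (λ e → ℤP.neg-involutive (f e)) (cong (λ t → + x ℤ.+ + K ℤ.+ t) dv) (Along-reverse (negate f) _ u safe-turn)
  gain′ : + 1 ℤ.≤ + K ℤ.- total f v
  gain′ = subst (λ t → + 1 ℤ.≤ + K ℤ.+ t) dv gain
  lem₁ : ∀ x k t r → x ℤ.+ ((k ℤ.- t) ℤ.+ r) ≡ (x ℤ.+ k ℤ.- t) ℤ.+ r
  lem₁ = solve-∀
  lem₂ : ∀ x k t r → x ℤ.+ ((k ℤ.- t) ℤ.+ r) ℤ.+ t ≡ x ℤ.+ r ℤ.+ k
  lem₂ = solve-∀
  go : ∀ r → Along NonNeg f (+ x ℤ.+ + r ℤ.* (+ K ℤ.- total f v)) (iterate r v)
  go zero = subst NonNeg (sym (trans (cong (λ t → + x ℤ.+ t) (ℤP.*-zeroˡ (+ K ℤ.- total f v))) (ℤP.+-identityʳ (+ x)))) (ℤ.+≤+ z≤n)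
  go (suc r) = Along-++ f _ v (iterate r v)
    (raise f (+ r ℤ.* (+ K ℤ.- total f v)) v (nonneg-* r (1≤⇒0≤ gain′))
      (trans (cong (λ t → + x ℤ.+ t) (suc* r g)) (lem₁ (+ x) (+ K) (total f v) (+ r ℤ.* g))) turn)
    (raise f (+ K) (iterate r v) (ℤ.+≤+ z≤n)
      (trans (cong (λ t → + x ℤ.+ t ℤ.+ total f v) (suc* r g)) (lem₂ (+ x) (+ K) (total f v) (+ r ℤ.* g))) (go r))

-- The value before each of r copies of w lies between the values before the first and after the last one.
cycle-safe : ∀ {n} (f : Fin n → ℤ) w c r z → + cost f w ℤ.≤ + c → + c ℤ.≤ z → + c ℤ.≤ z ℤ.+ + r ℤ.* total f w → Along NonNeg f z (iterate r w)
cycle-safe f w c zero z cw lo hi = ℤP.≤-trans (ℤ.+≤+ z≤n) lo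
cycle-safe f w c (suc r) z cw lo hi = Along-++ f z w (iterate r w)
  (Along-high f (+ 0) z w (ℤP.≤-trans (ℤP.≤-reflexive (ℤP.+-identityʳ _)) (ℤP.≤-trans cw lo)))
  (cycle-safe f w c r (z ℤ.+ total f w) cw next end)
  where
  end : + c ℤ.≤ z ℤ.+ total f w ℤ.+ + r ℤ.* total f w
  end = subst (+ c ℤ.≤_) (trans (cong (λ t → z ℤ.+ t) (suc* r (total f w))) (sym (ℤP.+-assoc z (total f w) _))) hi
  next : + c ℤ.≤ z ℤ.+ total f w
  next with ℤP.≤-total (+ 0) (total f w)
  ... | inj₁ up = ℤP.≤-trans lo (ℤP.≤-trans (ℤP.≤-reflexive (sym (ℤP.+-identityʳ z))) (ℤP.+-monoʳ-≤ z up))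
  ... | inj₂ down = ℤP.≤-trans end (ℤP.≤-trans (ℤP.+-monoʳ-≤ (z ℤ.+ total f w)
          (ℤP.≤-trans (ℤP.*-monoˡ-≤-nonNeg (+ r) down) (ℤP.≤-reflexive (ℤP.*-zeroʳ (+ r))))) (ℤP.≤-reflexive (ℤP.+-identityʳ _)))

pumped : ∀ {n} → ℕ → (u w σ v : List (Fin n)) → List (Fin n)
pumped r u w σ v = iterate r u ++ iterate r w ++ σ ++ iterate r v

total-pumped : ∀ {n} (f : Fin n → ℤ) r u w σ v →
  total f (pumped r u w σ v) ≡ + r ℤ.* total f u ℤ.+ (+ r ℤ.* total f w ℤ.+ (total f σ ℤ.+ + r ℤ.* total f v))
total-pumped f r u w σ v = trans (total-++ f (iterate r u) _) (cong₂ ℤ._+_ (total-iterate f r u)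
  (trans (total-++ f (iterate r w) _) (cong₂ ℤ._+_ (total-iterate f r w)
    (trans (total-++ f σ _) (cong (λ t → total f σ ℤ.+ t) (total-iterate f r v))))))

-- After the turns of `u` the value is at least `r`, and by the balance so it is after those of `w`.
-- As `r` covers the costs of `w` and `σ`, neither the turns between these two values nor `σ` reach
-- below 0; only the way down to the exit remains.
pumped-safe : ∀ {n} (f : Fin n → ℤ) (x y K K′ : ℕ) (u w σ v : List (Fin n)) →
  Boost f x K u → Boost (negate f) y K′ v → + y ≡ + x ℤ.+ total f σ →
  total f u ℤ.+ total f w ℤ.+ total f (reverse v) ≡ + K′ ℤ.- + K →
  ∀ r → cost f w ℕ.+ cost f σ ℕ.≤ r → Along NonNeg f (+ x ℤ.+ + r ℤ.* + K) (pumped r u w σ (reverse v))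
pumped-safe f x y K K′ u w σ v bu bv y≡ bal r r≥ =
  Along-++ f _ (iterate r u) _ (pump-up bu r)
    (Along-cong (iterate r w ++ σ ++ iterate r (reverse v)) (λ _ → refl) (sym after-u) (Along-++ f _ (iterate r w) _
      (cycle-safe f w r r z₁ (ℤ.+≤+ (ℕP.≤-trans (ℕP.m≤m+n _ _) r≥)) r≤z₁ (subst (+ r ℤ.≤_) z₂≡ r≤z₂))
      (Along-cong (σ ++ iterate r (reverse v)) (λ _ → refl) after-w (Along-++ f z₂ σ _
        (Along-high f (+ 0) z₂ σ (ℤP.≤-trans (ℤP.≤-reflexive (ℤP.+-identityʳ _)) (ℤP.≤-trans (ℤ.+≤+ (ℕP.≤-trans (ℕP.m≤n+m _ _) r≥)) r≤z₂)))
        (Along-cong (iterate r (reverse v)) (λ _ → refl) after-σ (pump-down bv r))))))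
  where
  z₁ z₂ : ℤ
  z₁ = + x ℤ.+ + r ℤ.* (+ K ℤ.+ total f u)
  z₂ = + x ℤ.+ + r ℤ.* (+ K′ ℤ.- total f (reverse v))
  grows : ∀ {g} → + 1 ℤ.≤ g → + r ℤ.≤ + x ℤ.+ + r ℤ.* g
  grows {g} 1≤g = ℤP.≤-trans (ℤP.≤-reflexive (trans (sym (ℤP.*-identityʳ (+ r))) (sym (ℤP.+-identityˡ _))))
    (ℤP.+-mono-≤ (ℤ.+≤+ {0} {x} z≤n) (ℤP.*-monoˡ-≤-nonNeg (+ r) 1≤g))
  r≤z₁ : + r ℤ.≤ z₁
  r≤z₁ = grows (Boost.gain bu)
  r≤z₂ : + r ℤ.≤ z₂
  r≤z₂ = grows (subst (λ t → + 1 ℤ.≤ + K′ ℤ.+ t) (trans (total-neg f v) (cong ℤ.-_ (sym (total-reverse f v)))) (Boost.gain bv))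
  distrib : ∀ x r k t → x ℤ.+ r ℤ.* k ℤ.+ r ℤ.* t ≡ x ℤ.+ r ℤ.* (k ℤ.+ t)
  distrib = solve-∀
  after-u : + x ℤ.+ + r ℤ.* + K ℤ.+ total f (iterate r u) ≡ z₁
  after-u = trans (cong (λ t → + x ℤ.+ + r ℤ.* + K ℤ.+ t) (total-iterate f r u)) (distrib (+ x) (+ r) (+ K) (total f u))
  z₂≡ : z₂ ≡ z₁ ℤ.+ + r ℤ.* total f w
  z₂≡ = trans (cong (λ t → + x ℤ.+ + r ℤ.* t) (trans (move (+ K) (+ K′) (total f (reverse v))) (trans (cong (λ t → + K ℤ.+ t ℤ.- total f (reverse v)) (sym bal))
          (lem (+ K) (total f u) (total f w) (total f (reverse v)))))) (sym (distrib (+ x) (+ r) (+ K ℤ.+ total f u) (total f w)))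
    where move : ∀ k k′ t → k′ ℤ.- t ≡ k ℤ.+ (k′ ℤ.- k) ℤ.- t
          move = solve-∀
          lem : ∀ k a b c → k ℤ.+ (a ℤ.+ b ℤ.+ c) ℤ.- c ≡ k ℤ.+ a ℤ.+ b
          lem = solve-∀
  after-w : z₂ ≡ z₁ ℤ.+ total f (iterate r w)
  after-w = trans z₂≡ (cong (λ t → z₁ ℤ.+ t) (sym (total-iterate f r w)))
  after-σ : + y ℤ.+ + r ℤ.* (+ K′ ℤ.- total f (reverse v)) ≡ z₂ ℤ.+ total f σ
  after-σ = trans (cong (ℤ._+ + r ℤ.* (+ K′ ℤ.- total f (reverse v))) y≡) (lem (+ x) (total f σ) _)
    where lem : ∀ x s t → x ℤ.+ s ℤ.+ t ≡ x ℤ.+ t ℤ.+ s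
          lem = solve-∀

boost-finite : ∀ {n} {f : Fin n → ℤ} {x u} → Along NonNeg f (+ x) u → + 1 ℤ.≤ total f u → Boost f x 0 u
boost-finite {f = f} {x} {u} al g = record
  { safe-turn = subst (λ t → Along NonNeg f t u) (sym (ℤP.+-identityʳ (+ x))) al
  ; gain = subst (+ 1 ℤ.≤_) (sym (ℤP.+-identityˡ _)) g }

-- At an `ω` endpoint no climbing cycle is needed, since the added amount pays for any word.
boost-unbounded : ∀ {n} {f : Fin n → ℤ} {x K u} → suc (cost f u) ℕ.≤ K → Boost f x K u
boost-unbounded {f = f} {x} {K} {u} le = record
  { safe-turn = Along-high f (+ 0) _ u (ℤP.≤-trans (ℤP.≤-reflexive (ℤP.+-identityʳ _)) (ℤP.≤-trans (ℤ.+≤+ (ℕP.≤-trans (ℕP.n≤1+n _) (ℕP.≤-trans le (ℕP.m≤n+m K x)))) (ℤP.≤-reflexive (ℤP.pos-+ x K))))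
  ; gain = total≥ f (+ 1) (+ K) u (ℤP.≤-trans (ℤP.≤-reflexive (trans (sym (ℤP.pos-+ (cost f u) 1)) (cong +_ (ℕP.+-comm (cost f u) 1)))) (ℤ.+≤+ le)) }

-- Pumping cycles of a component

last-edge : ∀ {r n} (G : Graph r n) {s} u {t} → Path G s u t → s ≡ t ⊎ ∃ λ e → t ≡ tgt G e
last-edge G [] p = inj₁ p
last-edge G (e ∷ u) (_ , p) with last-edge G u p
... | inj₁ eq = inj₂ (e , sym eq)
... | inj₂ found = inj₂ found

Unconditional : ∀ {d} → Component d → Set
Unconditional C = ComponentRefinement C (λ _ _ → ⊤)

unreached : ∀ {d} (C : Component d) e → ¬ (∃ λ u → Path (graph C) (p C) u (src (graph C) e)) → Unconditional C
unreached C e none = weaken (λ _ ρ _ → unused ρ) (unuse C e 0)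
  where
  unused : ∀ {pt} (ρ : Run full C pt) → parikh (word ρ) e ℕ.≤ 0
  unused ρ with 1 ℕP.≤? parikh (word ρ) e
  ... | yes used = ⊥-elim (none (path-to-edge (graph C) (word ρ) e (path ρ) used))
  ... | no ¬used = ℕP.≤-pred (ℕP.≰⇒> ¬used)

value : ℕω → ℕ
value (nat a) = a
value ω = 0

-- Only these counters need a climbing cycle: the homogeneous solution raises those with `ω`, and
-- weak runs do not guard the inactive ones. `side` selects entry or exit.
module Pinned {d} (C : Component d) (side : Fin d → End d) where

  IsPinned : Fin d → Set
  IsPinned i = active C i ≡ true × ∃ λ a → mark C (side i) ≡ nat a

  pinned? : ∀ i → Dec (IsPinned i)
  pinned? i = (active C i BoolP.≟ true) ×-dec has-value (mark C (side i))
    where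
    has-value : ∀ x → Dec (∃ λ a → x ≡ nat a)
    has-value (nat a) = yes (a , refl)
    has-value ω = no λ ()

  counters : List (Fin d)
  counters = filter pinned? (allFin d)

  counter : Fin (length counters) → Fin d
  counter = lookup counters

  start : Fin (length counters) → ℕ
  start j = value (mark C (side (counter j)))

  counter-pinned : ∀ j → IsPinned (counter j)
  counter-pinned j = proj₂ (∈-filter⁻ pinned? {xs = allFin d} (∈-lookup j))

  start≡ : ∀ {pt : End d → ℕ} → (∀ k → pt k ⊑ mark C k) → ∀ j → start j ≡ pt (side (counter j))
  start≡ ms j with mark C (side (counter j)) | proj₂ (counter-pinned j) | ms (side (counter j))
  ... | nat a | _ | eq = sym eq
  ... | ω | _ , () | _

  find : ∀ {i a} (P : Fin d → ℕ → Set) → active C i ≡ true → mark C (side i) ≡ nat a →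
    (∀ j → P (counter j) (start j)) → P i a
  find {i} {a} P act mk all = subst₂ P (sym (AnyP.lookup-index i∈)) start-a (all (Any.index i∈))
    where
    i∈ : i ∈ counters
    i∈ = ∈-filter⁺ pinned? {xs = allFin d} (∈-allFin i) (act , a , mk)
    start-a : start (Any.index i∈) ≡ a
    start-a = cong value (trans (cong (mark C ∘ side) (sym (AnyP.lookup-index i∈))) mk)

EntryPump ExitPump : ∀ {d} → Component d → Set
EntryPump C = ∃ λ u → Path (graph C) (p C) u (p C) × (∀ i a → active C i ≡ true → mark C (inj₁ i) ≡ nat a →
  Along NonNeg (eff C i) (+ a) u × + 1 ℤ.≤ total (eff C i) u)
ExitPump C = ∃ λ u → Path (rev (graph C)) (q C) u (q C) × (∀ i a → active C i ≡ true → mark C (inj₂ i) ≡ nat a →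
  Along NonNeg (negate (eff C i)) (+ a) u × + 1 ℤ.≤ total (negate (eff C i)) u)

module Analyse {d} (C : Component d) (φ ψ : Fin (#edges C) → ℕ)
  (flow : Flow (graph C) (p C) (q C) φ) (φ-full : ∀ e → 1 ℕ.≤ φ e)
  (circ : Circulation (graph C) ψ) (ψ-full : ∀ e → 1 ℕ.≤ ψ e)
  (reach : ∀ e → ∃ λ u → Path (graph C) (p C) u (src (graph C) e)) where

  G = graph C

  tour : ∃ λ u → Path G (p C) u (p C) × ψ ≗ parikh u
  tour = euler G (p C) (p C) ψ (circulation→flow G ψ (p C) circ) ψ-full reach

  main : ∃ λ u → Path G (p C) u (q C) × φ ≗ parikh u
  main = euler G (p C) (q C) φ flow φ-full reach

  -- The last edge of the walk occurs on `tour`, which leads on from there to its end `p C`.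
  return : ∀ u t → Path G (p C) u t → ∃ λ w → Path G t w (p C)
  return u t pu with last-edge G u pu
  ... | inj₁ eq = [] , sym eq
  ... | inj₂ (e , refl) with visited-tgt G (proj₁ tour) e (proj₁ (proj₂ tour)) (subst (1 ℕ.≤_) (proj₂ (proj₂ tour) e) (ψ-full e))
  ... | _ , w , _ , _ , pw = w , pw

  return-rev : ∀ u t → Path (rev G) (q C) u t → ∃ λ w → Path (rev G) t w (q C)
  return-rev u t pu with last-edge (rev G) u pu
  ... | inj₁ eq = [] , sym eq
  ... | inj₂ (e , refl) with return (proj₁ main) (q C) (proj₁ (proj₂ main)) | reach e
  ... | w₁ , p₁ | w₂ , p₂ = reverse (w₁ ++ w₂) , Path-reverse G (w₁ ++ w₂) (Path-++ G w₁ p₁ p₂)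

  entry : Unconditional C ⊎ EntryPump C
  entry with pump-or-confined
    where open Pinned C inj₁
          open Pumping G (p C) return (λ j → eff C (counter j)) start
  ... | inj₁ (u , pu , up) = inj₂ (u , pu , λ i a act mk → find (λ i a → Along NonNeg (eff C i) (+ a) u × + 1 ℤ.≤ total (eff C i) u) act mk up)
    where open Pinned C inj₁
  ... | inj₂ (B , conf) = inj₁ (weaken K (union (λ j → Confine.confine C (counter j) (proj₁ (counter-pinned j)) B)))
    where
    open Pinned C inj₁
    K : ∀ pt (ρ : Run full C pt) → ⊤ → ∃ λ j → Along (Within B) (eff C (counter j)) (+ pt (inj₁ (counter j))) (word ρ)
    K pt ρ _ with conf (word ρ) (q C) (path ρ) (λ j → subst (λ t → Along NonNeg (eff C (counter j)) (+ t) (word ρ)) (sym (start≡ (marks ρ) j)) (safe ρ (counter j) tt))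
    ... | j , al = j , subst (λ t → Along (Within B) (eff C (counter j)) (+ t) (word ρ)) (start≡ (marks ρ) j) al

  -- The argument for the entry, in the reversed graph. A run read backwards visits the same values,
  -- so a counter confined backwards is confined along the run, and `Confine` applies again.
  exit : Unconditional C ⊎ ExitPump C
  exit with pump-or-confined
    where open Pinned C inj₂
          open Pumping (rev G) (q C) return-rev (λ j → negate (eff C (counter j))) start
  ... | inj₁ (u , pu , up) = inj₂ (u , pu , λ i a act mk → find (λ i a → Along NonNeg (negate (eff C i)) (+ a) u × + 1 ℤ.≤ total (negate (eff C i)) u) act mk up)
    where open Pinned C inj₂
  ... | inj₂ (B , conf) = inj₁ (weaken K (union (λ j → Confine.confine C (counter j) (proj₁ (counter-pinned j)) B)))
    where
    open Pinned C inj₂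
    K : ∀ pt (ρ : Run full C pt) → ⊤ → ∃ λ j → Along (Within B) (eff C (counter j)) (+ pt (inj₁ (counter j))) (word ρ)
    K pt ρ _ = proj₁ confined , forth (proj₁ confined) (proj₂ confined)
      where
      exit≡ : ∀ j → + pt (inj₁ (counter j)) ℤ.+ total (eff C (counter j)) (word ρ) ≡ + start j
      exit≡ j = trans (sym (effect ρ (counter j))) (cong +_ (sym (start≡ (marks ρ) j)))
      confined : ∃ λ j → Along (Within B) (negate (eff C (counter j))) (+ start j) (reverse (word ρ))
      confined = conf (reverse (word ρ)) (p C) (Path-reverse G (word ρ) (path ρ))
        (λ j → subst (λ t → Along NonNeg (negate (eff C (counter j))) t (reverse (word ρ))) (exit≡ j) (Along-reverse (eff C (counter j)) _ (word ρ) (safe ρ (counter j) tt)))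
      forth : ∀ j → Along (Within B) (negate (eff C (counter j))) (+ start j) (reverse (word ρ)) → Along (Within B) (eff C (counter j)) (+ pt (inj₁ (counter j))) (word ρ)
      forth j al = subst (Along (Within B) f (+ pt (inj₁ (counter j)))) (ListP.reverse-involutive w)
        (Along-cong (reverse (reverse w)) (λ e → ℤP.neg-involutive (f e)) back (Along-reverse (negate f) _ (reverse w) al))
        where
        f = eff C (counter j)
        w = word ρ
        cancel : ∀ x t → x ℤ.+ t ℤ.+ (ℤ.- t) ≡ x
        cancel = solve-∀
        back : + start j ℤ.+ total (negate f) (reverse w) ≡ + pt (inj₁ (counter j))
        back = trans (cong₂ ℤ._+_ (sym (exit≡ j)) (trans (total-neg f (reverse w)) (cong ℤ.-_ (total-reverse f w)))) (cancel (+ pt (inj₁ (counter j))) (total f w))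

  -- The walk `main` realises `z`. For each of the `r` copies of s ψ there is one turn of `u`, one
  -- of `v′`, and one of an Euler tour `w` of the edges that those two leave; hence the endpoints
  -- are exactly those of the linear solution.
  pumping : EntryPump C → ExitPump C → ∀ (z h : End d → ℕ) → (∀ k → z k ⊑ mark C k) → Effect C z φ →
    (∀ k {a} → mark C k ≡ nat a → h k ≡ 0) → (∀ k → mark C k ≡ ω → 1 ℕ.≤ h k) → Effect C h ψ →
    ∃ λ s₀ → ∀ s → s₀ ℕ.≤ s → ∃ λ r₀ → ∀ r → r₀ ℕ.≤ r → Run weak C (z ⊕ r ⊙ (s ⊙ h))
  pumping (u , pu , u-up) (v , pv , v-up) z h z-marks z-eff h-zero h-pos h-eff = s₀ , pump-s
    where
    σ = proj₁ main
    v′ = reverse v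
    pv′ : Path G (q C) v′ (q C)
    pv′ = Path-reverse (rev G) v pv
    costs : ℕ
    costs = ∑ℕ.sum (λ i → cost (eff C i) u) ℕ.+ ∑ℕ.sum (λ i → cost (negate (eff C i)) v)
    s₀ : ℕ
    -- The lengths let s ψ contain `u` and `v′` with a copy of every edge to spare, as `euler`
    -- requires; `costs` lets `s` times a positive entry of `h` pay for either cycle at an `ω`
    -- endpoint.
    s₀ = 1 ℕ.+ (length u ℕ.+ length v′) ℕ.+ costs
    pump-s : ∀ s → s₀ ℕ.≤ s → ∃ λ r₀ → ∀ r → r₀ ℕ.≤ r → Run weak C (z ⊕ r ⊙ (s ⊙ h))
    pump-s s s≥ = ∑ℕ.sum (λ i → cost (eff C i) w ℕ.+ cost (eff C i) σ) , pump-r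
      where
      used : Fin (#edges C) → ℕ
      used e = parikh u e ℕ.+ parikh v′ e
      left : Fin (#edges C) → ℕ
      left e = s ℕ.* ψ e ℕ.∸ used e
      s≤s* : ∀ {x} → 1 ℕ.≤ x → s ℕ.≤ s ℕ.* x
      s≤s* le = ℕP.≤-trans (ℕP.≤-reflexive (sym (ℕP.*-identityʳ s))) (ℕP.*-monoʳ-≤ s le)
      used< : ∀ e → used e ℕ.< s ℕ.* ψ e
      used< e = ℕP.≤-trans (s≤s (ℕP.+-mono-≤ (parikh≤length u e) (parikh≤length v′ e)))
        (ℕP.≤-trans (ℕP.m≤m+n _ costs) (ℕP.≤-trans s≥ (s≤s* (ψ-full e))))
      split : s ⊙ ψ ≗ used ⊕ left
      split = +-monus (λ e → ℕP.<⇒≤ (used< e))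
      dot-split : ∀ f → + s ℤ.* dot ψ f ≡ total f u ℤ.+ total f v′ ℤ.+ dot left f
      dot-split f = trans (sym (dot-⊙ s ψ f)) (trans (dot-congˡ f split) (trans (dot-⊕ used left f)
        (cong (ℤ._+ dot left f) (trans (dot-⊕ (parikh u) (parikh v′) f) (cong₂ ℤ._+_ (dot-parikh u f) (dot-parikh v′ f))))))
      cycle-zero : ∀ {a} w t → Path G a w a → total (κ G t) w ≡ + 0
      cycle-zero {a} w t pw = trans (sym (dot-parikh w (κ G t))) (trans (path-flow G w pw t) (ℤP.+-inverseʳ (+ [ a ≟ t ]?)))
      left-circ : Circulation G left
      left-circ t = trans (sym (ℤP.+-identityˡ _)) (trans (cong (ℤ._+ dot left (κ G t)) (sym (cong₂ ℤ._+_ (cycle-zero u t pu) (cycle-zero v′ t pv′))))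
        (trans (sym (dot-split (κ G t))) (trans (cong (λ t → + s ℤ.* t) (circ t)) (ℤP.*-zeroʳ (+ s)))))
      rest : ∃ λ w → Path G (p C) w (p C) × left ≗ parikh w
      rest = euler G (p C) (p C) left (circulation→flow G left (p C) left-circ) (λ e → ℕP.m<n⇒0<n∸m (used< e)) reach
      w = proj₁ rest
      total-w : ∀ f → total f w ≡ dot left f
      total-w f = trans (sym (dot-parikh w f)) (sym (dot-congˡ f (proj₂ (proj₂ rest))))
      h-diff : ∀ i → + h (inj₂ i) ℤ.- + h (inj₁ i) ≡ dot ψ (eff C i)
      h-diff i = trans (cong (ℤ._- + h (inj₁ i)) (h-eff i)) (lem (+ h (inj₁ i)) (dot ψ (eff C i)))
        where lem : ∀ a b → a ℤ.+ b ℤ.- a ≡ b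
              lem = solve-∀
      balance : ∀ i → total (eff C i) u ℤ.+ total (eff C i) w ℤ.+ total (eff C i) v′ ≡ + (s ℕ.* h (inj₂ i)) ℤ.- + (s ℕ.* h (inj₁ i))
      balance i = trans (trans (cong (λ t → total f u ℤ.+ t ℤ.+ total f v′) (total-w f)) (swap (total f u) (dot left f) (total f v′)))
        (trans (sym (dot-split f)) (trans (cong (λ t → + s ℤ.* t) (sym (h-diff i)))
        (trans (distrib (+ s) (+ h (inj₂ i)) (+ h (inj₁ i))) (sym (cong₂ ℤ._-_ (ℤP.pos-* s (h (inj₂ i))) (ℤP.pos-* s (h (inj₁ i))))))))
        where
        f = eff C i
        swap : ∀ a b c → a ℤ.+ b ℤ.+ c ≡ a ℤ.+ c ℤ.+ b
        swap = solve-∀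
        distrib : ∀ s a b → s ℤ.* (a ℤ.- b) ≡ s ℤ.* a ℤ.- s ℤ.* b
        distrib = solve-∀
      finite-boost : ∀ {n} {f : Fin n → ℤ} {x a k w} → x ≡ a → k ≡ 0 → Along NonNeg f (+ a) w × + 1 ℤ.≤ total f w → Boost f x k w
      finite-boost refl refl (al , g) = boost-finite al g
      ω-boost : ∀ {n} {f : Fin n → ℤ} {w} k → mark C k ≡ ω → cost f w ℕ.≤ costs → Boost f (z k) (s ℕ.* h k) w
      ω-boost k kω le = boost-unbounded (ℕP.≤-trans (s≤s le) (ℕP.≤-trans (s≤s (ℕP.m≤n+m costs (length u ℕ.+ length v′))) (ℕP.≤-trans s≥ (s≤s* (h-pos k kω)))))
      s*0 : ∀ k {a} → mark C k ≡ nat a → s ℕ.* h k ≡ 0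
      s*0 k mk = trans (cong (s ℕ.*_) (h-zero k mk)) (ℕP.*-zeroʳ s)
      z≡ : ∀ k {a} → mark C k ≡ nat a → z k ≡ a
      z≡ k mk = subst (z k ⊑_) mk (z-marks k)
      entry-boost : ∀ i → active C i ≡ true → Boost (eff C i) (z (inj₁ i)) (s ℕ.* h (inj₁ i)) u
      entry-boost i act with mark C (inj₁ i) in mk
      ... | nat a = finite-boost (z≡ (inj₁ i) mk) (s*0 (inj₁ i) mk) (u-up i a act mk)
      ... | ω = ω-boost (inj₁ i) mk (ℕP.≤-trans (term≤∑ (λ i → cost (eff C i) u) i) (ℕP.m≤m+n _ _))
      exit-boost : ∀ i → active C i ≡ true → Boost (negate (eff C i)) (z (inj₂ i)) (s ℕ.* h (inj₂ i)) v
      exit-boost i act with mark C (inj₂ i) in mk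
      ... | nat a = finite-boost (z≡ (inj₂ i) mk) (s*0 (inj₂ i) mk) (v-up i a act mk)
      ... | ω = ω-boost (inj₂ i) mk (ℕP.≤-trans (term≤∑ (λ i → cost (negate (eff C i)) v) i) (ℕP.m≤n+m _ _))
      z-step : ∀ i → + z (inj₂ i) ≡ + z (inj₁ i) ℤ.+ total (eff C i) σ
      z-step i = trans (z-eff i) (cong (λ t → + z (inj₁ i) ℤ.+ t) (trans (dot-congˡ (eff C i) (proj₂ (proj₂ main))) (dot-parikh σ (eff C i))))
      cast : ∀ r k → + (z k ℕ.+ r ℕ.* (s ℕ.* h k)) ≡ + z k ℤ.+ + r ℤ.* + (s ℕ.* h k)
      cast r k = trans (ℤP.pos-+ (z k) _) (cong (λ t → + z k ℤ.+ t) (ℤP.pos-* r (s ℕ.* h k)))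
      pump-r : ∀ r → ∑ℕ.sum (λ i → cost (eff C i) w ℕ.+ cost (eff C i) σ) ℕ.≤ r → Run weak C (z ⊕ r ⊙ (s ⊙ h))
      pump-r r r≥ = record
        { word = pumped r u w σ v′
        ; path = Path-++ G (iterate r u) (Path-iterate G r u pu) (Path-++ G (iterate r w) (Path-iterate G r w (proj₁ (proj₂ rest)))
                   (Path-++ G σ (proj₁ (proj₂ main)) (Path-iterate G r v′ pv′)))
        ; safe = λ i act → subst (λ t → Along NonNeg (eff C i) t (pumped r u w σ v′)) (sym (cast r (inj₁ i)))
                   (pumped-safe (eff C i) (z (inj₁ i)) (z (inj₂ i)) (s ℕ.* h (inj₁ i)) (s ℕ.* h (inj₂ i)) u w σ v
                      (entry-boost i act) (exit-boost i act) (z-step i) (balance i) r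
                      (ℕP.≤-trans (term≤∑ (λ i → cost (eff C i) w ℕ.+ cost (eff C i) σ) i) r≥))
        ; effect = λ i → trans (cast r (inj₂ i)) (trans (cong (ℤ._+ + r ℤ.* + (s ℕ.* h (inj₂ i))) (z-step i))
            (trans (trans (cong (λ t → + z (inj₁ i) ℤ.+ total (eff C i) σ ℤ.+ + r ℤ.* t) (trans (move (+ (s ℕ.* h (inj₁ i))) (+ (s ℕ.* h (inj₂ i)))) (cong (λ t → + (s ℕ.* h (inj₁ i)) ℤ.+ t) (sym (balance i)))))
               (regroup (+ z (inj₁ i)) (total (eff C i) σ) (+ r) (+ (s ℕ.* h (inj₁ i))) (total (eff C i) u) (total (eff C i) w) (total (eff C i) v′)))
            (cong₂ ℤ._+_ (sym (cast r (inj₁ i))) (sym (total-pumped (eff C i) r u w σ v′)))))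
        ; marks = λ k → marks′ k (mark C k) refl }
        where
        move : ∀ a b → b ≡ a ℤ.+ (b ℤ.- a)
        move = solve-∀
        regroup : ∀ z t r k a b c → z ℤ.+ t ℤ.+ r ℤ.* (k ℤ.+ (a ℤ.+ b ℤ.+ c)) ≡ z ℤ.+ r ℤ.* k ℤ.+ (r ℤ.* a ℤ.+ (r ℤ.* b ℤ.+ (t ℤ.+ r ℤ.* c)))
        regroup = solve-∀
        marks′ : ∀ k x → mark C k ≡ x → (z ⊕ r ⊙ (s ⊙ h)) k ⊑ mark C k
        marks′ k (nat a) mk = subst (_ ⊑_) (sym mk) (trans (cong₂ ℕ._+_ (z≡ k mk) (trans (cong (r ℕ.*_) (s*0 k mk)) (ℕP.*-zeroʳ r))) (ℕP.+-identityʳ a))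
        marks′ k ω mk = subst (_ ⊑_) (sym mk) tt

-- The decomposition

Splitting : ∀ {d} → List (Component d) → Set
Splitting ξ = Refinement ξ (λ _ _ _ → ⊤)

-- Runs of neighbours fit together only for equal multiples, so `s` and `r` are shared, and
-- thresholds can be added up along the list. `r₀` depends on `s` because the cycle left over after
-- the pumping cycles does.
Pumped : ∀ {d} (ξ : List (Component d)) → (z h : Var ξ → ℕ) → Set
Pumped ξ z h = ∃ λ s₀ → ∀ s → s₀ ℕ.≤ s → ∃ λ r₀ → ∀ r → r₀ ℕ.≤ r →
  Sol weak ξ ((z ⊕ r ⊙ (s ⊙ h)) ∘ startVar ξ) ((z ⊕ r ⊙ (s ⊙ h)) ∘ finalVar ξ)

Run-ends : ∀ {d σ} {C : Component d} {pt} → Run σ C pt → Run σ C (ends (pt ∘ inj₁) (pt ∘ inj₂))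
Run-ends ρ = record { word = word ρ ; path = path ρ ; safe = safe ρ ; effect = effect ρ
                     ; marks = λ { (inj₁ i) → marks ρ (inj₁ i) ; (inj₂ i) → marks ρ (inj₂ i) } }

pump-cons : ∀ {d} (C : Component d) ξ (z h : Var (C ∷ ξ) → ℕ) →
  (∀ i → + z (inj₂ (startVar ξ i)) ≡ + z (endVar (inj₂ i)) ℤ.+ glue C i) → (∀ i → h (inj₂ (startVar ξ i)) ≡ h (endVar (inj₂ i))) →
  (∃ λ s₀ → ∀ s → s₀ ℕ.≤ s → ∃ λ r₀ → ∀ r → r₀ ℕ.≤ r → Run weak C (endsOf {C = C} {ξ} z ⊕ r ⊙ (s ⊙ endsOf {C = C} {ξ} h))) →
  Pumped ξ (tailOf {C = C} {ξ} z) (tailOf {C = C} {ξ} h) → Pumped (C ∷ ξ) z h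
pump-cons C ξ z h z-glue h-glue (s₁ , head) (s₂ , tail) = s₁ ℕ.+ s₂ , λ s s≥ →
  let (r₁ , head-r) = head s (ℕP.m+n≤o⇒m≤o s₁ s≥)
      (r₂ , tail-r) = tail s (ℕP.m+n≤o⇒n≤o s₁ s≥)
  in r₁ ℕ.+ r₂ , λ r r≥ → _ , _ , Run-ends (head-r r (ℕP.m+n≤o⇒m≤o r₁ r≥)) , (λ i → glued s r i) , tail-r r (ℕP.m+n≤o⇒n≤o r₁ r≥)
  where
  glued : ∀ s r i → + (z (inj₂ (startVar ξ i)) ℕ.+ r ℕ.* (s ℕ.* h (inj₂ (startVar ξ i)))) ≡
    + (z (endVar (inj₂ i)) ℕ.+ r ℕ.* (s ℕ.* h (endVar (inj₂ i)))) ℤ.+ glue C i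
  glued s r i rewrite h-glue i = trans (ℤP.pos-+ (z (inj₂ (startVar ξ i))) _) (trans (cong (ℤ._+ + (r ℕ.* (s ℕ.* h (endVar (inj₂ i))))) (z-glue i))
    (trans (swap (+ z (endVar (inj₂ i))) (glue C i) _) (cong (ℤ._+ glue C i) (sym (ℤP.pos-+ (z (endVar (inj₂ i))) _)))))
    where swap : ∀ a b c → a ℤ.+ b ℤ.+ c ≡ a ℤ.+ c ℤ.+ b
          swap = solve-∀

-- `h` uses every edge, and lying above `h` makes `z` do so as well; with all sources reachable,
-- Euler's theorem then applies to both.
split-or-pump : ∀ {d} (ξ : List (Component d)) (z h : Var ξ → ℕ) → Satisfies (system ξ) z → Homogeneous (system ξ) h →
  (∀ v → Relevant ξ v → 1 ℕ.≤ h v) → (∀ v → h v ℕ.≤ z v) → Splitting ξ ⊎ Pumped ξ z h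
split-or-pump [] z h sat hom pos h≤z = inj₂ (0 , λ s _ → 0 , λ r _ i → refl)
split-or-pump (C ∷ ξ) z h sat hom pos h≤z
  with satisfies⁻ C ξ z sat | homogeneous⁻ C ξ h hom | FinP.all? (λ e → reachable? (graph C) (p C) (src (graph C) e))
... | _ | _ | no ¬reach with FinP.¬∀⟶∃¬ _ _ (λ e → reachable? (graph C) (p C) (src (graph C) e)) ¬reach
... | e , none = inj₁ (refine-head (unreached C e none) ξ)
split-or-pump (C ∷ ξ) z h sat hom pos h≤z | S , sat′ | H , hom′ | yes reach = combine′ entry exit
    (split-or-pump ξ (tailOf {C = C} {ξ} z) (tailOf {C = C} {ξ} h) sat′ hom′ (λ v → pos (inj₂ v)) (λ v → h≤z (inj₂ v)))
  where
  h-full : ∀ e → 1 ℕ.≤ edgesOf {C = C} {ξ} h e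
  h-full e = pos (edgeVar e) tt
  open Analyse C (edgesOf {C = C} {ξ} z) (edgesOf {C = C} {ξ} h) (Solves.flow S) (λ e → ℕP.≤-trans (h-full e) (h≤z (edgeVar e)))
    (SolvesHom.circ H) h-full reach
  combine′ : Unconditional C ⊎ EntryPump C → Unconditional C ⊎ ExitPump C → Splitting ξ ⊎ Pumped ξ (tailOf {C = C} {ξ} z) (tailOf {C = C} {ξ} h) →
    Splitting (C ∷ ξ) ⊎ Pumped (C ∷ ξ) z h
  combine′ (inj₁ R) _ _ = inj₁ (refine-head R ξ)
  combine′ (inj₂ _) (inj₁ R) _ = inj₁ (refine-head R ξ)
  combine′ (inj₂ _) (inj₂ _) (inj₁ R) = inj₁ (refine-tail C R)
  combine′ (inj₂ en) (inj₂ ex) (inj₂ pumped-tail) = inj₂ (pump-cons C ξ z h (Solves.glued S) (SolvesHom.glued H)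
    (pumping en ex (endsOf {C = C} {ξ} z) (endsOf {C = C} {ξ} h) (Solves.marked S) (Solves.effects S) (SolvesHom.marked H)
      (λ k → pos (endVar k)) (SolvesHom.effects H)) pumped-tail)

search : ∀ {V} {P : V → Set} → Finite V → (∀ v → Dec (P v)) → (∃ P) ⊎ (∀ v → ¬ P v)
search {P = P} fin P? with FinP.any? (λ k → P? (Finite.elem fin k))
... | yes (k , pk) = inj₁ (Finite.elem fin k , pk)
... | no none = inj₂ λ v pv → none (Finite.index fin v , subst P (sym (Finite.elem-index fin v)) pv)

module Dichotomy {d} (I : Fin d → Bool) where

  -- If no coordinate is in `I`, these say that a weak solution exists and that no full one does,
  -- which is the reachability question. In `Bounded` the coordinate may depend on the solution, so
  -- bounds for finitely many parts combine into one.
  Unbounded Bounded : List (Component d) → Set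
  Unbounded ξ = ∀ b → ∃ λ m → ∃ λ n → Sol weak ξ m n × (∀ i → I i ≡ true → b ℕ.≤ n i)
  Bounded ξ = ∃ λ b → ∀ m n → Sol full ξ m n → ∃ λ i → I i ≡ true × n i ℕ.≤ b

  merge : ∀ {ξs} → All (λ ξ → Unbounded ξ ⊎ Bounded ξ) ξs →
    Any Unbounded ξs ⊎ (∃ λ b → ∀ m n → Any (λ ξ → Sol full ξ m n) ξs → ∃ λ i → I i ≡ true × n i ℕ.≤ b)
  merge [] = inj₂ (0 , λ m n ())
  merge (inj₁ unb ∷ _) = inj₁ (here unb)
  merge (inj₂ (b , bd) ∷ rest) with merge rest
  ... | inj₁ unb = inj₁ (there unb)
  ... | inj₂ (b′ , bd′) = inj₂ (b ℕ.+ b′ , λ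
    { m n (here s) → let (i , Ii , le) = bd m n s in i , Ii , ℕP.≤-trans le (ℕP.m≤m+n b b′)
    ; m n (there s) → let (i , Ii , le) = bd′ m n s in i , Ii , ℕP.≤-trans le (ℕP.m≤n+m b′ b) })

  by-splitting : ∀ {ξ} (R : Splitting ξ) → All (λ ξ → Unbounded ξ ⊎ Bounded ξ) (Refinement.parts R) → Unbounded ξ ⊎ Bounded ξ
  by-splitting R decided with merge decided
  ... | inj₂ (b , bd) = inj₂ (b , λ m n s → bd m n (Refinement.complete R m n s tt))
  ... | inj₁ unb = inj₁ λ b → let (lift′ , unbounded) = both (Refinement.sound R) unb
                                  (m , n , s , large) = unbounded b in m , n , lift′ m n s , large
    where
    both : ∀ {ξs} {Q : List (Component d) → Set} → All Q ξs → (a : Any Unbounded ξs) → Q (Any.lookup a) × Unbounded (Any.lookup a)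
    both (q ∷ _) (here u) = q , u
    both (_ ∷ qs) (there a) = both qs a

  split-or-decide : ∀ ξ → Splitting ξ ⊎ (Unbounded ξ ⊎ Bounded ξ)
  split-or-decide ξ with profile (Var-finite ξ) (system ξ)
  ... | inj₁ unsat = inj₂ (inj₂ (0 , λ m n s → ⊥-elim (unsat _ (val-satisfies ξ m n s))))
  ... | inj₂ pr with search (Var-finite ξ) (λ v → relevant? ξ v ×-dec (Profile.h pr v ℕP.≟ 0))
  ... | inj₁ (v , rel , h≡0) with Profile.dichotomy pr v
  ... | inj₁ 1≤h = ⊥-elim (ℕP.<⇒≢ 1≤h (sym h≡0))
  ... | inj₂ (_ , B , bound) = inj₁ record { Refinement R ; complete = λ m n s _ → Refinement.complete R m n s (bound _ (val-satisfies ξ m n s)) }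
    where R = refine-bounded ξ v rel B
  split-or-decide ξ | inj₂ pr | inj₂ none with search (Fin-finite d) (λ i → (I i BoolP.≟ true) ×-dec (Profile.h pr (finalVar ξ i) ℕP.≟ 0))
  ... | inj₁ (i , Ii , h≡0) with Profile.dichotomy pr (finalVar ξ i)
  ... | inj₁ 1≤h = ⊥-elim (ℕP.<⇒≢ 1≤h (sym h≡0))
  ... | inj₂ (_ , B , bound) = inj₂ (inj₂ (B , λ m n s → i , Ii , subst (ℕ._≤ B) (val-final ξ m n s i) (bound _ (val-satisfies ξ m n s))))
  split-or-decide ξ | inj₂ pr | inj₂ none | inj₂ none-final
    -- Adding `h` to `z₀` gives a solution above `h`.
    with split-or-pump ξ (z₀ ⊕ h) h (all-shift (system ξ) z₀-sol h-hom) h-hom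
           (λ v rel → ℕP.n≢0⇒n>0 (λ h≡0 → none v (rel , h≡0))) (λ v → ℕP.m≤n+m (h v) (z₀ v))
    where open Profile pr
  ... | inj₁ R = inj₁ R
  ... | inj₂ (s₀ , pump-s) = inj₂ (inj₁ unbounded)
    where
    open Profile pr
    s : ℕ
    -- Positive even if `s₀` is 0, so that every turn adds at least 1 wherever `h` is positive.
    s = suc s₀
    unbounded : Unbounded ξ
    unbounded b with pump-s s (ℕP.n≤1+n s₀)
    ... | r₀ , pump-r = _ , _ , pump-r (b ℕ.+ r₀) (ℕP.m≤n+m r₀ b) , λ i Ii → large i (ℕP.n≢0⇒n>0 (λ h≡0 → none-final i (Ii , h≡0)))
      where
      large : ∀ i → 1 ℕ.≤ h (finalVar ξ i) → b ℕ.≤ ((z₀ ⊕ h) ⊕ (b ℕ.+ r₀) ⊙ (s ⊙ h)) (finalVar ξ i)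
      large i 1≤h = ℕP.≤-trans (ℕP.m≤m+n b r₀) (ℕP.≤-trans (ℕP.≤-reflexive (sym (ℕP.*-identityʳ (b ℕ.+ r₀))))
        (ℕP.≤-trans (ℕP.*-monoʳ-≤ (b ℕ.+ r₀) (ℕP.*-mono-≤ {1} {s} (s≤s z≤n) 1≤h)) (ℕP.m≤n+m _ ((z₀ ⊕ h) (finalVar ξ i)))))

  decide : ∀ ξ → Acc _≺_ ξ → Unbounded ξ ⊎ Bounded ξ
  decide ξ (acc rs) with split-or-decide ξ
  ... | inj₂ answer = answer
  ... | inj₁ R = by-splitting R (go (Refinement.smaller R))
    where
    go : ∀ {ξs} → All (_≺ ξ) ξs → All (λ ξ → Unbounded ξ ⊎ Bounded ξ) ξs
    go [] = []
    go (lt ∷ lts) = decide _ (rs lt) ∷ go lts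

-- Vector addition systems

lookup-ext : ∀ {A : Set} {n} {xs ys : Vec A n} → (∀ i → Vec.lookup xs i ≡ Vec.lookup ys i) → xs ≡ ys
lookup-ext {xs = xs} {ys} eq = trans (sym (VecP.tabulate∘lookup xs)) (trans (VecP.tabulate-cong eq) (VecP.tabulate∘lookup ys))

module _ {d} (V : VAS d) where

  effects : Fin d → Fin (k V) → ℤ
  effects i a = Vec.lookup (δ V a) i

  lookup-difference : ∀ (x y : Vec ℕ d) i → Vec.lookup (Vec.zipWith ℤ._-_ (Vec.map +_ y) (Vec.map +_ x)) i ≡ + Vec.lookup y i ℤ.- + Vec.lookup x i
  lookup-difference x y i = trans (VecP.lookup-zipWith ℤ._-_ i (Vec.map +_ y) (Vec.map +_ x)) (cong₂ ℤ._-_ (VecP.lookup-map i +_ y) (VecP.lookup-map i +_ x))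

  step-effect : ∀ {x a y} → Step V x a y → ∀ i → + Vec.lookup y i ≡ + Vec.lookup x i ℤ.+ effects i a
  step-effect {x} {a} {y} st i = trans (lem (+ Vec.lookup y i) (+ Vec.lookup x i))
      (cong (λ t → + Vec.lookup x i ℤ.+ t) (trans (sym (lookup-difference x y i)) (cong (λ v → Vec.lookup v i) st)))
    where lem : ∀ y x → y ≡ x ℤ.+ (y ℤ.- x)
          lem = solve-∀

  run⇒safe : ∀ {x u y} → D.Run V x u y → ∀ i → Along NonNeg (effects i) (+ Vec.lookup x i) u × + Vec.lookup y i ≡ + Vec.lookup x i ℤ.+ total (effects i) u
  run⇒safe run-[] i = ℤ.+≤+ z≤n , sym (ℤP.+-identityʳ _)
  run⇒safe {x} {a ∷ u} (run-∷ st r) i with run⇒safe r i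
  ... | al , eq = (ℤ.+≤+ z≤n , subst (λ t → Along NonNeg (effects i) t u) (step-effect st i) al) ,
    trans eq (trans (cong (ℤ._+ total (effects i) u) (step-effect st i)) (ℤP.+-assoc (+ Vec.lookup x i) (effects i a) (total (effects i) u)))

  safe⇒run : ∀ x u → (∀ i → Along NonNeg (effects i) (+ Vec.lookup x i) u) →
    ∃ λ y → D.Run V x u y × (∀ i → + Vec.lookup y i ≡ + Vec.lookup x i ℤ.+ total (effects i) u)
  safe⇒run x [] _ = x , run-[] , λ i → sym (ℤP.+-identityʳ _)
  safe⇒run x (a ∷ u) al = extend (safe⇒run x′ u (λ i → subst (λ t → Along NonNeg (effects i) t u) (sym (x′≡ i)) (proj₂ (al i))))
    where
    x′ : Vec ℕ d
    x′ = Vec.tabulate (λ i → ∣ + Vec.lookup x i ℤ.+ effects i a ∣)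
    x′≡ : ∀ i → + Vec.lookup x′ i ≡ + Vec.lookup x i ℤ.+ effects i a
    x′≡ i = trans (cong +_ (VecP.lookup∘tabulate _ i)) (ℤP.0≤i⇒+∣i∣≡i (Along-start (effects i) _ u (proj₂ (al i))))
    st : Step V x a x′
    st = lookup-ext (λ i → trans (lookup-difference x x′ i) (trans (cong (ℤ._- + Vec.lookup x i) (x′≡ i)) (lem (+ Vec.lookup x i) (effects i a))))
      where lem : ∀ x t → x ℤ.+ t ℤ.- x ≡ t
            lem = solve-∀
    extend : _ → _
    extend (y , r , eq) = y , run-∷ st r , λ i → trans (eq i) (trans (cong (ℤ._+ total (effects i) u) (x′≡ i)) (ℤP.+-assoc (+ Vec.lookup x i) (effects i a) (total (effects i) u)))

  module _ (x : Vec ℕω d) where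

    -- One vertex with a loop for each letter. As exit mark, `x` prescribes its finite coordinates
    -- and leaves the others free. All counters are active, so weak and full runs coincide here, and
    -- the two alternatives become complementary.
    initial : Component d
    initial = record
      { #states = 1 ; graph = record { src = λ _ → zero ; tgt = λ _ → zero } ; eff = effects ; active = λ _ → true ; p = zero ; q = zero
      ; mark = case⊎ (λ i → nat (Vec.lookup (x-in V) i)) (Vec.lookup x) ; glue = λ _ → + 0 }

    loops : ∀ u → Path (graph initial) zero u zero
    loops [] = refl
    loops (a ∷ u) = refl , loops u

    Compatible : Vec ℕ d → Set
    Compatible y = ∀ i → Vec.lookup y i ⊑ Vec.lookup x i

    post⇒sol : ∀ y → Post* V y → Compatible y → Sol full (initial ∷ []) (Vec.lookup (x-in V)) (Vec.lookup y)
    post⇒sol y (u , r) comp = Vec.lookup y , Vec.lookup y , record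
      { word = u ; path = loops u ; safe = λ i _ → proj₁ (run⇒safe r i) ; effect = λ i → proj₂ (run⇒safe r i)
      ; marks = λ { (inj₁ i) → refl ; (inj₂ i) → comp i } } , (λ i → sym (ℤP.+-identityʳ _)) , λ _ → refl

    sol⇒post : ∀ m n → Sol weak (initial ∷ []) m n → ∃ λ y → Post* V y × Compatible y × (∀ i → Vec.lookup y i ≡ n i)
    sol⇒post m n (n′ , m′ , ρ , glued , m′≡n) with safe⇒run (x-in V) (word ρ) (λ i → subst (λ t → Along NonNeg (effects i) (+ t) (word ρ)) (marks ρ (inj₁ i)) (safe ρ i refl))
    ... | y , r , eq = y , (word ρ , r) , (λ i → subst (_⊑ Vec.lookup x i) (sym (y≡n′ i)) (marks ρ (inj₂ i))) ,
        λ i → trans (y≡n′ i) (trans (ℤP.+-injective (sym (trans (glued i) (ℤP.+-identityʳ _)))) (m′≡n i))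
      where
      y≡n′ : ∀ i → Vec.lookup y i ≡ n′ i
      y≡n′ i = ℤP.+-injective (trans (eq i) (trans (cong (λ t → + t ℤ.+ total (effects i) (word ρ)) (sym (marks ρ (inj₁ i)))) (sym (effect ρ i))))

    infinite : Fin d → Bool
    infinite i with Vec.lookup x i
    ... | nat _ = false
    ... | ω = true

    open Dichotomy infinite

    -- The term with index `b` is a reachable vector that is exact at the finite coordinates and at
    -- least `b` at the others.
    unbounded⇒limit : Unbounded (initial ∷ []) → Lim (Post*ω V) x
    unbounded⇒limit unb = (λ b → Vec.map nat (y b)) , (λ b → y b , proj₁ (proj₂ (point b)) , refl) , converges
      where
      point : ∀ b → ∃ λ y → Post* V y × Compatible y × (∀ i → infinite i ≡ true → b ℕ.≤ Vec.lookup y i)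
      point b with unb b
      ... | m , n , s , large with sol⇒post m n s
      ... | y , post , comp , eq = y , post , comp , λ i inf → subst (b ℕ.≤_) (sym (eq i)) (large i inf)
      y : ℕ → Vec ℕ d
      y b = proj₁ (point b)
      converges : ConvergesVec (λ b → Vec.map nat (y b)) x
      converges i = conv (Vec.lookup x i) (λ b → proj₁ (proj₂ (proj₂ (point b))) i) λ b eq → proj₂ (proj₂ (proj₂ (point b))) i (inf eq)
        where
        inf : Vec.lookup x i ≡ ω → infinite i ≡ true
        inf eq rewrite eq = refl
        conv : ∀ ℓ → (∀ b → Vec.lookup (y b) i ⊑ ℓ) → (∀ b → ℓ ≡ ω → b ℕ.≤ Vec.lookup (y b) i) → Converges (λ b → Vec.lookup (Vec.map nat (y b)) i) ℓ
        conv (nat a) eq _ = inj₁ (0 , λ b _ → trans (VecP.lookup-map i nat (y b)) (cong nat (eq b)))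
        conv ω _ large = inj₂ ((λ b → b , ℕP.≤-refl , Vec.lookup (y b) i , VecP.lookup-map i nat (y b)) ,
          (λ B → B , λ b v B≤b eq → ℕP.≤-trans B≤b (subst (b ℕ.≤_) (nat-injective (trans (sym (VecP.lookup-map i nat (y b))) eq)) (large b refl))) , refl)
          where nat-injective : ∀ {a b} → nat a ≡ nat b → a ≡ b
                nat-injective refl = refl

    -- A late term of a convergent sequence is exact at the finite coordinates and above `B` at all
    -- others, against the bound.
    bounded⇒no-limit : Bounded (initial ∷ []) → ¬ Lim (Post*ω V) x
    bounded⇒no-limit (B , bd) (s , inM , conv) = contradiction′ (inM N)
      where
      Near : Fin d → ℕ → Set
      Near i N = ∀ n → N ℕ.≤ n → ∀ v → Vec.lookup (s n) i ≡ nat v → v ⊑ Vec.lookup x i × (infinite i ≡ true → B ℕ.< v)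
      near : ∀ i → ∃ (Near i)
      near i with Vec.lookup x i | conv i
      ... | nat a | inj₁ (N , const) = N , λ n N≤n v eq → nat-eq (trans (sym eq) (const n N≤n)) , λ ()
        where nat-eq : ∀ {a b} → nat a ≡ nat b → a ≡ b
              nat-eq refl = refl
      ... | nat a | inj₂ (_ , _ , ())
      -- If the coordinate is constantly `ω` from `N` on, it takes no natural value there and `Near`
      -- is vacuous.
      ... | ω | inj₁ (N , const) = N , λ n N≤n v eq → ⊥-elim (absurd (trans (sym eq) (const n N≤n)))
        where absurd : ∀ {v} → nat v ≡ ω → ⊥
              absurd ()
      ... | ω | inj₂ (_ , tends , _) = let (N , large) = tends (suc B) in N , λ n N≤n v eq → tt , λ _ → large n v N≤n eq
      N : ℕ
      N = ∑ℕ.sum (λ i → proj₁ (near i))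
      contradiction′ : Post*ω V (s N) → ⊥
      contradiction′ (y , post , sN≡) = small (bd _ _ (post⇒sol y post (λ i → proj₁ (at-N i))))
        where
        at-N : ∀ i → Vec.lookup y i ⊑ Vec.lookup x i × (infinite i ≡ true → B ℕ.< Vec.lookup y i)
        at-N i = proj₂ (near i) N (term≤∑ (λ i → proj₁ (near i)) i) (Vec.lookup y i) (trans (cong (λ v → Vec.lookup v i) sN≡) (VecP.lookup-map i nat y))
        small : (∃ λ i → infinite i ≡ true × Vec.lookup y i ℕ.≤ B) → ⊥
        small (i , inf , le) = ℕP.<⇒≱ (proj₂ (at-N i) inf) le

    limit? : Dec (Lim (Post*ω V) x)
    limit? with decide (initial ∷ []) (≺-wellFounded _)
    ... | inj₁ unb = yes (unbounded⇒limit unb)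
    ... | inj₂ bd = no (bounded⇒no-limit bd)

theorem4p1 : (d : ℕ) (V : VAS d) (x : Vec ℕω d) → Dec (Lim (Post*ω V) x)
theorem4p1 d V x = limit? V x
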